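{- Let $\Bbbk$ be a field and let $\mathcal A=\{H_1,\dots,H_n\}$ be a central arrangement of $n$ distinct linear hyperplanes in $\mathbb C^\ell$ with underlying matroid $\mathfrak G$. Then $$\mathcal R(\mathcal A,\Bbbk)=\bigcup_{\Gamma\in \mathcal N(\mathfrak G,\Bbbk)} V(\Gamma,\Bbbk).$$
   Context: Write $[n]=\{1,\dots,n\}$. The matroid $\mathfrak G$ is the matroid on $[n]$ whose circuits are the minimal sets $C\subseteq[n]$ with $\operatorname{codim}(\bigcap_{i\in C}H_i)<|C|$. The Orlik-Solomon algebra $A=A_\Bbbk(\mathfrak G)$ is the quotient of the exterior algebra over $\Bbbk$ on degree-one generators $e_1,\dots,e_n$ by the ideal generated by all $\partial e_C=\sum_{j=1}^p(-1)^{j-1}e_{i_1}\cdots\hat e_{i_j}\cdots e_{i_p}$, for $C=\{i_1,\dots,i_p\}$ a circuit. The image of $e_i$ in $A$ is $a_i$. For $\xi\in\Bbbk^n$ put $a_\xi=\sum_i\xi_ia_i$. For $\lambda\in\Bbbk^n$ let $Z(\lambda,\Bbbk)=\{\eta\in\Bbbk^n: a_\lambda a_\eta=0\}$. The (degree-one) resonance variety is $\mathcal R(\mathcal A,\Bbbk)=\{\lambda\in\Bbbk^n:\dim_\Bbbk Z(\lambda,\Bbbk)\ge 2\}$. A line of $\mathfrak G$ is a rank-two flat, i.e. a set $\{m\in[n]: H_m\supseteq H_i\cap H_j\}$ with $i\ne j$; $\mathcal X(\mathfrak G)$ is the set of lines, and $\mathcal X_0(\mathfrak G)$ is the set of lines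 $X$ with $|X|\ge3$ (nontrivial lines). For $S\subseteq[n]$ and $\xi\in\Bbbk^n$, $\xi_S=\sum_{i\in S}\xi_i$. Let $\Gamma$ be a (simple) graph with vertex set $[n]$. A clique is a set of pairwise adjacent vertices; a block is a maximal clique; a cone vertex is a vertex adjacent to every other vertex. Let $U$ be the set of non-cone vertices of $\Gamma$. $\Gamma$ is $\mathfrak G$-neighborly if for every $X\in\mathcal X(\mathfrak G)$ with $|X\cap U|\ge 2$ and every block $S$ of $\Gamma$, $|X\cap U\cap S|\ge|X\cap U|-1$ implies $X\subseteq S$. Let $\mathcal X_\Gamma(\mathfrak G)=\{X\in\mathcal X_0(\mathfrak G): X\text{ is not a clique of }\Gamma\}$ and $K(\Gamma,\Bbbk)=\{\xi\in\Bbbk^n:\xi_X=0\text{ for every }X\in\mathcal X_\Gamma(\mathfrak G)\}$. For $\lambda\in K(\Gamma,\Bbbk)$ let $Z_\Gamma(\lambda,\Bbbk)=\{\eta\in K(\Gamma,\Bbbk):\lambda_i\eta_j-\lambda_j\eta_i=0\text{ for every edge }\{i,j\}\text{ of }\Gamma\}$, a linear subspace. $\mathcal N(\mathfrak G,\Bbbk)$ is the set of $\mathfrak G$-neighborly graphs $\Gamma$ with vertex set $[n]$ and $\dim K(\Gamma,\Bbbk)\ge2$. For $\Gamma\in\mathcal N(\mathfrak G,\Bbbk)$, $V(\Gamma,\Bbbk)=\{\lambda\in K(\Gamma,\Bbbk):\dim_\Bbbk Z_\Gamma(\lambda,\Bbbk)\ge 2\}$. -}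

module Defs where

open import Algebra.Bundles using (CommutativeRing; Ring)
open import Data.Bool.Base using (not; if_then_else_)
open import Data.Fin.Base using (Fin; toℕ)
import Data.Fin.Properties as Fin
open import Data.Fin.Subset as Subset using (Subset; ∣_∣; _∈_)
open import Data.Fin.Subset.Properties using (_∈?_)
open import Data.List.Base as List using (List; length; map; removeAt)
open import Data.Nat.Base as ℕ using (ℕ)
import Data.Nat.Properties as ℕₚ
open import Data.Product.Base using (Σ; Σ-syntax; ∃; ∃₂; ∃-syntax; _×_; _,_; proj₁; proj₂)
open import Data.Rational.Base as ℚ using (ℚ; 0ℚ; 1ℚ)
import Data.Rational.Properties as ℚₚ
open import Data.Rational.Solver using (module +-*-Solver)
open import Data.Vec.Base as Vec using (lookup)
open import Data.Vec.Functional as Vector using (Vector)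
open import Function.Bundles using (_⇔_)
open import Level using (Level; _⊔_; suc; 0ℓ)
open import Relation.Binary.Core using (Rel)
open import Relation.Binary.Definitions as B using (Symmetric; Irreflexive)
open import Relation.Binary.PropositionalEquality as ≡ using (_≡_; _≢_; subst; module ≡-Reasoning)
open import Relation.Nullary.Decidable using (does; ¬?; _→-dec_)
open import Relation.Nullary.Negation using (¬_)
open import Relation.Unary as U using (Pred; _≐_)
import Algebra.Properties.CommutativeMonoid.Sum as Sum
import Algebra.Properties.Ring as RingProperties
import Algebra.Properties.Semiring.Exp as Exp
import Algebra.Solver.Ring.NaturalCoefficients.Default as NaturalCoefficients

-- Reals are Cauchy sequences of rationals.  The two sequences are read at
-- independent indices, so that x ∼ x says that x is Cauchy, and, for
-- Cauchy sequences x and y, x ∼ y says that x − y tends to zero.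

Vanishing : (ℕ → ℕ → ℚ) → Set
Vanishing d = ∀ {ε} → 0ℚ ℚ.< ε →
  ∃[ N ] (∀ {m n} → N ℕ.≤ m → N ℕ.≤ n → ℚ.∣ d m n ∣ ℚ.< ε)

infix 4 _∼_
record _∼_ (x y : ℕ → ℚ) : Set where
  constructor vanishing
  field
    vanishes : Vanishing (λ m n → x m ℚ.- y n)

open _∼_

record ℝ : Set where
  constructor mkℝ
  field
    seq    : ℕ → ℚ
    cauchy : seq ∼ seq

open ℝ

module _ where
  open +-*-Solver

  private
    Vanishing-≗ : ∀ {d e} → (∀ m n → d m n ≡ e m n) → Vanishing d → Vanishing e
    Vanishing-≗ d≗e v ε>0 with v ε>0
    ... | N , h = N , λ {m} {n} p q → subst (λ z → ℚ.∣ z ∣ ℚ.< _) (d≗e m n) (h p q)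

    half+half : ∀ ε → ε ℚ.* ℚ.½ ℚ.+ ε ℚ.* ℚ.½ ≡ ε
    half+half = solve 1 (λ e → e :* con ℚ.½ :+ e :* con ℚ.½ := e) ≡.refl

    half>0 : ∀ {ε} → 0ℚ ℚ.< ε → 0ℚ ℚ.< ε ℚ.* ℚ.½
    half>0 {ε} ε>0 = subst (ℚ._< ε ℚ.* ℚ.½) (ℚₚ.*-zeroˡ ℚ.½) (ℚₚ.*-monoˡ-<-pos ℚ.½ ε>0)

    Vanishing-+ : ∀ {d e} → Vanishing d → Vanishing e → Vanishing (λ m n → d m n ℚ.+ e m n)
    Vanishing-+ {d} {e} v w {ε} ε>0 with v (half>0 ε>0) | w (half>0 ε>0)
    ... | M , f | N , g = M ℕ.⊔ N , λ {m} {n} p q →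
      ℚₚ.≤-<-trans (ℚₚ.∣p+q∣≤∣p∣+∣q∣ (d m n) (e m n))
        (subst (ℚ.∣ d m n ∣ ℚ.+ ℚ.∣ e m n ∣ ℚ.<_) (half+half ε)
          (ℚₚ.+-mono-<
            (f (ℕₚ.≤-trans (ℕₚ.m≤m⊔n M N) p) (ℕₚ.≤-trans (ℕₚ.m≤m⊔n M N) q))
            (g (ℕₚ.≤-trans (ℕₚ.m≤n⊔m M N) p) (ℕₚ.≤-trans (ℕₚ.m≤n⊔m M N) q))))

    Vanishing-neg : ∀ {d} → Vanishing d → Vanishing (λ m n → ℚ.- d m n)
    Vanishing-neg {d} v ε>0 with v ε>0
    ... | N , h = N , λ {m} {n} p q →
      subst (ℚ._< _) (≡.sym (ℚₚ.∣-p∣≡∣p∣ (d m n))) (h p q)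

    Vanishing-flip : ∀ {d} → Vanishing d → Vanishing (λ m n → d n m)
    Vanishing-flip v ε>0 with v ε>0
    ... | N , h = N , λ p q → h q p

    Bounded : (ℕ → ℚ) → Set
    Bounded x = ∃[ B ] (ℚ.Positive B × ∃[ N ] (∀ {n} → N ℕ.≤ n → ℚ.∣ x n ∣ ℚ.≤ B))

    ∼⇒Boundedˡ : ∀ {x y} → x ∼ y → Bounded x
    ∼⇒Boundedˡ {x} {y} (vanishing v) with v (ℚₚ.positive⁻¹ 1ℚ)
    ... | N , h = 1ℚ ℚ.+ ℚ.∣ y N ∣
        , ℚₚ.pos+nonNeg⇒pos 1ℚ ℚ.∣ y N ∣ {{ℚₚ.∣-∣-nonNeg (y N)}}
        , N , λ {n} p →
          subst (λ z → ℚ.∣ z ∣ ℚ.≤ _)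
            (solve 2 (λ a b → (a :- b) :+ b := a) ≡.refl (x n) (y N))
            (ℚₚ.≤-trans (ℚₚ.∣p+q∣≤∣p∣+∣q∣ (x n ℚ.- y N) (y N))
              (ℚₚ.+-monoˡ-≤ ℚ.∣ y N ∣ (ℚₚ.<⇒≤ (h p ℕₚ.≤-refl))))

    Vanishing-* : ∀ {d} {x : ℕ → ℚ} → Bounded x → Vanishing d →
                  Vanishing (λ m n → x n ℚ.* d m n)
    Vanishing-* {d} {x} (B , B>0 , M , b) v {ε} ε>0 = go (v δ>0)
      where
      instance
        posB = B>0
        nzB  = ℚₚ.pos⇒nonZero B
        posB⁻¹ = ℚₚ.1/pos⇒pos B
      δ = ε ℚ.* ℚ.1/ B
      δ>0 : 0ℚ ℚ.< δ
      δ>0 = subst (ℚ._< δ) (ℚₚ.*-zeroˡ (ℚ.1/ B)) (ℚₚ.*-monoˡ-<-pos (ℚ.1/ B) ε>0)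
      B*δ≡ε : B ℚ.* δ ≡ ε
      B*δ≡ε = begin
        B ℚ.* (ε ℚ.* ℚ.1/ B)  ≡⟨ solve 3 (λ a b c → a :* (b :* c) := b :* (a :* c)) ≡.refl B ε (ℚ.1/ B) ⟩
        ε ℚ.* (B ℚ.* ℚ.1/ B)  ≡⟨ ≡.cong (ε ℚ.*_) (ℚₚ.*-inverseʳ B) ⟩
        ε ℚ.* 1ℚ              ≡⟨ ℚₚ.*-identityʳ ε ⟩
        ε                     ∎
        where open ≡-Reasoning
      go : ∃[ N ] (∀ {m n} → N ℕ.≤ m → N ℕ.≤ n → ℚ.∣ d m n ∣ ℚ.< δ) →
           ∃[ N ] (∀ {m n} → N ℕ.≤ m → N ℕ.≤ n → ℚ.∣ x n ℚ.* d m n ∣ ℚ.< ε)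
      go (N , h) = M ℕ.⊔ N , λ {m} {n} p q →
        subst (ℚ._< ε) (≡.sym (ℚₚ.∣p*q∣≡∣p∣*∣q∣ (x n) (d m n)))
          (ℚₚ.≤-<-trans
            (ℚₚ.*-monoʳ-≤-nonNeg ℚ.∣ d m n ∣ {{ℚₚ.∣-∣-nonNeg (d m n)}}
              (b (ℕₚ.≤-trans (ℕₚ.m≤m⊔n M N) q)))
            (subst (B ℚ.* ℚ.∣ d m n ∣ ℚ.<_) B*δ≡ε
              (ℚₚ.*-monoʳ-<-pos B
                (h (ℕₚ.≤-trans (ℕₚ.m≤n⊔m M N) p) (ℕₚ.≤-trans (ℕₚ.m≤n⊔m M N) q)))))

  ∼-sym : ∀ {x y} → x ∼ y → y ∼ x
  ∼-sym {x} {y} (vanishing v) = vanishing (Vanishing-≗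
    (λ m n → solve 2 (λ a b → :- (a :- b) := b :- a) ≡.refl (x n) (y m))
    (Vanishing-neg {λ m n → x n ℚ.- y m} (Vanishing-flip {λ m n → x m ℚ.- y n} v)))

  ∼-trans : ∀ {x y z} → x ∼ y → y ∼ z → x ∼ z
  ∼-trans {x} {y} {z} (vanishing v) (vanishing w) = vanishing go
    where
    go : Vanishing (λ m n → x m ℚ.- z n)
    go {ε} ε>0 with v (half>0 ε>0) | w (half>0 ε>0)
    ... | M , f | N , g = M ℕ.⊔ N , λ {m} {n} p q →
      let k = M ℕ.⊔ N in
      subst (λ t → ℚ.∣ t ∣ ℚ.< ε)
        (solve 3 (λ a b c → (a :- b) :+ (b :- c) := a :- c) ≡.refl (x m) (y k) (z n))
        (ℚₚ.≤-<-trans (ℚₚ.∣p+q∣≤∣p∣+∣q∣ (x m ℚ.- y k) (y k ℚ.- z n))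
          (subst (ℚ.∣ x m ℚ.- y k ∣ ℚ.+ ℚ.∣ y k ℚ.- z n ∣ ℚ.<_) (half+half ε)
            (ℚₚ.+-mono-<
              (f (ℕₚ.≤-trans (ℕₚ.m≤m⊔n M N) p) (ℕₚ.m≤m⊔n M N))
              (g (ℕₚ.m≤n⊔m M N) (ℕₚ.≤-trans (ℕₚ.m≤n⊔m M N) q)))))

  ∼-+ : ∀ {x x′ y y′} → x ∼ x′ → y ∼ y′ → (λ n → x n ℚ.+ y n) ∼ (λ n → x′ n ℚ.+ y′ n)
  ∼-+ {x} {x′} {y} {y′} (vanishing v) (vanishing w) = vanishing (Vanishing-≗
    (λ m n → solve 4 (λ a a′ b b′ → (a :- a′) :+ (b :- b′) := (a :+ b) :- (a′ :+ b′))
               ≡.refl (x m) (x′ n) (y m) (y′ n))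
    (Vanishing-+ {λ m n → x m ℚ.- x′ n} {λ m n → y m ℚ.- y′ n} v w))

  ∼-neg : ∀ {x x′} → x ∼ x′ → (λ n → ℚ.- x n) ∼ (λ n → ℚ.- x′ n)
  ∼-neg {x} {x′} (vanishing v) = vanishing (Vanishing-≗
    (λ m n → solve 2 (λ a a′ → :- (a :- a′) := (:- a) :- (:- a′)) ≡.refl (x m) (x′ n))
    (Vanishing-neg {λ m n → x m ℚ.- x′ n} v))

  ∼-* : ∀ {x x′ y y′} → x ∼ x′ → y ∼ y′ → (λ n → x n ℚ.* y n) ∼ (λ n → x′ n ℚ.* y′ n)
  ∼-* {x} {x′} {y} {y′} v w = vanishing (Vanishing-≗
    (λ m n → solve 4 (λ a a′ b b′ → b :* (a :- a′) :+ a′ :* (b :- b′) := a :* b :- a′ :* b′)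
               ≡.refl (x m) (x′ n) (y m) (y′ n))
    (Vanishing-+ {λ m n → y m ℚ.* (x m ℚ.- x′ n)} {λ m n → x′ n ℚ.* (y m ℚ.- y′ n)}
      (Vanishing-flip {λ m n → y n ℚ.* (x n ℚ.- x′ m)}
        (Vanishing-* {λ m n → x n ℚ.- x′ m} {y} (∼⇒Boundedˡ w)
          (Vanishing-flip {λ m n → x m ℚ.- x′ n} (vanishes v))))
      (Vanishing-* {λ m n → y m ℚ.- y′ n} {x′} (∼⇒Boundedˡ (∼-sym v)) (vanishes w))))

  ∼-const : ∀ q → (λ _ → q) ∼ (λ _ → q)
  ∼-const q = vanishing λ {ε} ε>0 →
    0 , λ _ _ → subst (λ z → ℚ.∣ z ∣ ℚ.< ε) (≡.sym (ℚₚ.+-inverseʳ q)) ε>0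

infix 4 _≈ℝ_
_≈ℝ_ : Rel ℝ 0ℓ
x ≈ℝ y = seq x ∼ seq y

infixl 6 _+ℝ_
infixl 7 _*ℝ_
_+ℝ_ _*ℝ_ : ℝ → ℝ → ℝ
x +ℝ y = mkℝ (λ n → seq x n ℚ.+ seq y n) (∼-+ (cauchy x) (cauchy y))
x *ℝ y = mkℝ (λ n → seq x n ℚ.* seq y n) (∼-* (cauchy x) (cauchy y))

-ℝ_ : ℝ → ℝ
-ℝ x = mkℝ (λ n → ℚ.- seq x n) (∼-neg (cauchy x))

fromℚ : ℚ → ℝ
fromℚ q = mkℝ (λ _ → q) (∼-const q)

≗⇒≈ℝ : ∀ x y → (∀ n → seq x n ≡ seq y n) → x ≈ℝ y
≗⇒≈ℝ x y x≗y = vanishing λ {ε} ε>0 →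
  let (N , h) = vanishes (cauchy x) ε>0 in
  N , λ {m} {n} p q → subst (λ z → ℚ.∣ seq x m ℚ.- z ∣ ℚ.< ε) (x≗y n) (h p q)

ℝ-commutativeRing : CommutativeRing 0ℓ 0ℓ
ℝ-commutativeRing = record
  { Carrier = ℝ ; _≈_ = _≈ℝ_ ; _+_ = _+ℝ_ ; _*_ = _*ℝ_ ; -_ = -ℝ_
  ; 0# = fromℚ 0ℚ ; 1# = fromℚ 1ℚ
  ; isCommutativeRing = record
    { isRing = record
      { +-isAbelianGroup = record
        { isGroup = record
          { isMonoid = record
            { isSemigroup = record
              { isMagma = record
                { isEquivalence = record
                  { refl = λ {x} → cauchy x
                  ; sym = ∼-sym
                  ; trans = ∼-trans
                  }
                ; ∙-cong = ∼-+
                }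
              ; assoc = λ x y z → ≗⇒≈ℝ ((x +ℝ y) +ℝ z) (x +ℝ (y +ℝ z))
                  (λ n → ℚₚ.+-assoc (seq x n) (seq y n) (seq z n))
              }
            ; identity = (λ x → ≗⇒≈ℝ (fromℚ 0ℚ +ℝ x) x (λ n → ℚₚ.+-identityˡ (seq x n)))
                       , (λ x → ≗⇒≈ℝ (x +ℝ fromℚ 0ℚ) x (λ n → ℚₚ.+-identityʳ (seq x n)))
            }
          ; inverse = (λ x → ≗⇒≈ℝ (-ℝ x +ℝ x) (fromℚ 0ℚ) (λ n → ℚₚ.+-inverseˡ (seq x n)))
                    , (λ x → ≗⇒≈ℝ (x +ℝ -ℝ x) (fromℚ 0ℚ) (λ n → ℚₚ.+-inverseʳ (seq x n)))
          ; ⁻¹-cong = ∼-neg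
          }
        ; comm = λ x y → ≗⇒≈ℝ (x +ℝ y) (y +ℝ x) (λ n → ℚₚ.+-comm (seq x n) (seq y n))
        }
      ; *-cong = ∼-*
      ; *-assoc = λ x y z → ≗⇒≈ℝ ((x *ℝ y) *ℝ z) (x *ℝ (y *ℝ z))
          (λ n → ℚₚ.*-assoc (seq x n) (seq y n) (seq z n))
      ; *-identity = (λ x → ≗⇒≈ℝ (fromℚ 1ℚ *ℝ x) x (λ n → ℚₚ.*-identityˡ (seq x n)))
                   , (λ x → ≗⇒≈ℝ (x *ℝ fromℚ 1ℚ) x (λ n → ℚₚ.*-identityʳ (seq x n)))
      ; distrib = (λ x y z → ≗⇒≈ℝ (x *ℝ (y +ℝ z)) ((x *ℝ y) +ℝ (x *ℝ z))
                    (λ n → ℚₚ.*-distribˡ-+ (seq x n) (seq y n) (seq z n)))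
                , (λ x y z → ≗⇒≈ℝ ((y +ℝ z) *ℝ x) ((y *ℝ x) +ℝ (z *ℝ x))
                    (λ n → ℚₚ.*-distribʳ-+ (seq x n) (seq y n) (seq z n)))
      }
    ; *-comm = λ x y → ≗⇒≈ℝ (x *ℝ y) (y *ℝ x) (λ n → ℚₚ.*-comm (seq x n) (seq y n))
    }
  }

-- R[i] with i² = −1; a pair (a , b) stands for a + b i.
module AdjoinI {c ℓ} (R : CommutativeRing c ℓ) where
  open CommutativeRing R
  open NaturalCoefficients commutativeSemiring using (solve; _:=_; _:+_; _:*_)
  open RingProperties ring using (-0#≈0#; -1*x≈-x)

  C : Set c
  C = Carrier × Carrier

  infix 4 _≈C_
  _≈C_ : Rel C ℓ
  (a , b) ≈C (a′ , b′) = (a ≈ a′) × (b ≈ b′)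

  add mul : C → C → C
  add (a , b) (a′ , b′) = a + a′ , b + b′
  mul (a , b) (a′ , b′) = a * a′ - b * b′ , a * b′ + b * a′

  neg : C → C
  neg (a , b) = - a , - b

  zeroC one : C
  zeroC = 0# , 0#
  one   = 1# , 0#

  private
    mul-comm : ∀ x y → mul x y ≈C mul y x
    mul-comm (a , b) (c , d) =
        +-cong (*-comm a c) (-‿cong (*-comm b d))
      , trans (+-comm (a * d) (b * c)) (+-cong (*-comm b c) (*-comm a d))

    neg≈ : ∀ x → - x ≈ - 1# * x
    neg≈ x = sym (-1*x≈-x x)

    mul-assoc : ∀ x y z → mul (mul x y) z ≈C mul x (mul y z)
    mul-assoc (a , b) (c , d) (e , f) =
        trans (+-cong (*-congʳ (+-congˡ (neg≈ _))) (neg≈ _))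
          (trans (solve 7 (λ j a b c d e f →
              ((a :* c :+ j :* (b :* d)) :* e :+ j :* ((a :* d :+ b :* c) :* f))
              := (a :* (c :* e :+ j :* (d :* f)) :+ j :* (b :* (c :* f :+ d :* e)))) refl (- 1#) a b c d e f)
            (sym (+-cong (*-congˡ (+-congˡ (neg≈ _))) (neg≈ _))))
      , trans (+-congʳ (*-congʳ (+-congˡ (neg≈ _))))
          (trans (solve 7 (λ j a b c d e f →
              ((a :* c :+ j :* (b :* d)) :* f :+ (a :* d :+ b :* c) :* e)
              := (a :* (c :* f :+ d :* e) :+ b :* (c :* e :+ j :* (d :* f)))) refl (- 1#) a b c d e f)
            (sym (+-congˡ (*-congˡ (+-congˡ (neg≈ _))))))

    mul-distribˡ : ∀ x y z → mul x (add y z) ≈C add (mul x y) (mul x z)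
    mul-distribˡ (a , b) (c , d) (e , f) =
        trans (+-congˡ (neg≈ _))
          (trans (solve 7 (λ j a b c d e f →
              a :* (c :+ e) :+ j :* (b :* (d :+ f))
              := (a :* c :+ j :* (b :* d)) :+ (a :* e :+ j :* (b :* f))) refl (- 1#) a b c d e f)
            (sym (+-cong (+-congˡ (neg≈ _)) (+-congˡ (neg≈ _)))))
      , solve 6 (λ a b c d e f →
          a :* (d :+ f) :+ b :* (c :+ e)
          := (a :* d :+ b :* c) :+ (a :* f :+ b :* e)) refl a b c d e f

    mul-identityˡ : ∀ x → mul one x ≈C x
    mul-identityˡ (a , b) =
        trans (+-cong (*-identityˡ a) (trans (-‿cong (zeroˡ b)) -0#≈0#)) (+-identityʳ a)
      , trans (+-cong (*-identityˡ b) (zeroˡ a)) (+-identityʳ b)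

    ≈C-trans : ∀ {x y z} → x ≈C y → y ≈C z → x ≈C z
    ≈C-trans (p , q) (p′ , q′) = trans p p′ , trans q q′

  commutativeRing : CommutativeRing c ℓ
  commutativeRing = record
    { Carrier = C ; _≈_ = _≈C_ ; _+_ = add ; _*_ = mul ; -_ = neg ; 0# = zeroC ; 1# = one
    ; isCommutativeRing = record
      { isRing = record
        { +-isAbelianGroup = record
          { isGroup = record
            { isMonoid = record
              { isSemigroup = record
                { isMagma = record
                  { isEquivalence = record
                    { refl = refl , refl
                    ; sym = λ { (p , q) → sym p , sym q }
                    ; trans = ≈C-trans
                    }
                  ; ∙-cong = λ { (p , q) (p′ , q′) → +-cong p p′ , +-cong q q′ }
                  }
                ; assoc = λ { (a , b) (c , d) (e , f) → +-assoc a c e , +-assoc b d f }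
                }
              ; identity = (λ { (a , b) → +-identityˡ a , +-identityˡ b })
                         , (λ { (a , b) → +-identityʳ a , +-identityʳ b })
              }
            ; inverse = (λ { (a , b) → -‿inverseˡ a , -‿inverseˡ b })
                      , (λ { (a , b) → -‿inverseʳ a , -‿inverseʳ b })
            ; ⁻¹-cong = λ { (p , q) → -‿cong p , -‿cong q }
            }
          ; comm = λ { (a , b) (c , d) → +-comm a c , +-comm b d }
          }
        ; *-cong = λ { (p , q) (p′ , q′) →
              +-cong (*-cong p p′) (-‿cong (*-cong q q′))
            , +-cong (*-cong p q′) (*-cong q p′) }
        ; *-assoc = mul-assoc
        ; *-identity = mul-identityˡ , λ x → ≈C-trans (mul-comm x one) (mul-identityˡ x)
        ; distrib = mul-distribˡ , λ x y z →
            let (p , q) = mul-comm y x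
                (p′ , q′) = mul-comm z x
            in ≈C-trans (mul-comm (add y z) x)
                 (≈C-trans (mul-distribˡ x y z)
                   (sym (+-cong p p′) , sym (+-cong q q′)))
        }
      ; *-comm = mul-comm
      }
    }

ℂ : CommutativeRing 0ℓ 0ℓ
ℂ = AdjoinI.commutativeRing ℝ-commutativeRing

-- The classical notion of field: every element not equal to zero is invertible.
record Field c ℓ : Set (suc (c ⊔ ℓ)) where
  field
    commutativeRing : CommutativeRing c ℓ
  open CommutativeRing commutativeRing public
  field
    0≉1     : ¬ (0# ≈ 1#)
    inverse : ∀ x → ¬ (x ≈ 0#) → ∃[ y ] (x * y ≈ 1#)

module Linear {c ℓ} (R : CommutativeRing c ℓ) where
  open CommutativeRing R
  open Sum +-commutativeMonoid using (sum; sum-syntax)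

  infix 4 _≋_
  _≋_ : ∀ {n} → Rel (Vector Carrier n) ℓ
  v ≋ w = ∀ i → v i ≈ w i

  0ᵛ : ∀ {n} → Vector Carrier n
  0ᵛ _ = 0#

  infix 7 _·_
  _·_ : ∀ {n} → Vector Carrier n → Vector Carrier n → Carrier
  _·_ {n} v w = ∑[ i < n ] (v i * w i)

  lincomb : ∀ {n d} → Vector Carrier d → Vector (Vector Carrier n) d → Vector Carrier n
  lincomb {d = d} a v j = ∑[ i < d ] (a i * v i j)

  LinearlyIndependent : ∀ {n d} → Vector (Vector Carrier n) d → Set (c ⊔ ℓ)
  LinearlyIndependent v = ∀ a → lincomb a v ≋ 0ᵛ → a ≋ 0ᵛ

  module _ {n p} (W : Pred (Vector Carrier n) p) where

    IsBasis : ∀ {d} → Vector (Vector Carrier n) d → Set (c ⊔ ℓ ⊔ p)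
    IsBasis v = (∀ i → W (v i))
              × LinearlyIndependent v
              × (∀ w → W w → ∃[ a ] (w ≋ lincomb a v))

    HasDim : ℕ → Set (c ⊔ ℓ ⊔ p)
    HasDim d = Σ[ v ∈ Vector (Vector Carrier n) d ] IsBasis v

    HasCodim : ℕ → Set (c ⊔ ℓ ⊔ p)
    HasCodim k = ∃[ d ] (HasDim d × d ℕ.+ k ≡ n)

    Dim≥ : ℕ → Set (c ⊔ ℓ ⊔ p)
    Dim≥ m = ∃[ d ] (HasDim d × m ℕ.≤ d)

    Codim< : ℕ → Set (c ⊔ ℓ ⊔ p)
    Codim< m = ∃[ k ] (HasCodim k × k ℕ.< m)

  sumOver : ∀ {n} → Vector Carrier n → Subset n → Carrier
  sumOver ξ S = sum (λ i → if lookup S i then ξ i else 0#)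

-- The quotient of a ring, not necessarily commutative, by the two-sided ideal
-- generated by G.
module Quotient {c ℓ g} (R : Ring c ℓ) (G : Pred (Ring.Carrier R) g) where
  open Ring R hiding (zero)

  data Ideal : Pred Carrier (c ⊔ ℓ ⊔ g) where
    generator : ∀ {x} → G x → Ideal x
    zero      : Ideal 0#
    add       : ∀ {x y} → Ideal x → Ideal y → Ideal (x + y)
    mulˡ      : ∀ r {x} → Ideal x → Ideal (r * x)
    mulʳ      : ∀ r {x} → Ideal x → Ideal (x * r)
    resp      : ∀ {x y} → x ≈ y → Ideal x → Ideal y

  infix 4 _≈/_
  _≈/_ : Rel Carrier (c ⊔ ℓ ⊔ g)
  x ≈/ y = Ideal (x - y)

  private
    open RingProperties R using
      (-1*x≈-x; -‿+-comm; -‿involutive; x[y-z]≈xy-xz; [y-z]x≈yx-zx)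
    open import Relation.Binary.Reasoning.Setoid setoid
    open import Algebra.Properties.CommutativeSemigroup +-commutativeSemigroup using (interchange)

    lift : ∀ {x y} → x ≈ y → x ≈/ y
    lift {x} {y} x≈y = resp (sym (trans (+-congʳ x≈y) (-‿inverseʳ y))) zero

    Ideal-neg : ∀ {x} → Ideal x → Ideal (- x)
    Ideal-neg {x} h = resp (-1*x≈-x x) (mulˡ (- 1#) h)

    telescope : ∀ x y z → (x - y) + (y - z) ≈ x - z
    telescope x y z = begin
      (x - y) + (y - z)    ≈⟨ +-assoc x (- y) (y - z) ⟩
      x + (- y + (y - z))  ≈⟨ +-congˡ (sym (+-assoc (- y) y (- z))) ⟩
      x + ((- y + y) - z)  ≈⟨ +-congˡ (+-congʳ (-‿inverseˡ y)) ⟩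
      x + (0# - z)         ≈⟨ +-congˡ (+-identityˡ (- z)) ⟩
      x - z                ∎

    ≈/-trans : ∀ {x y z} → x ≈/ y → y ≈/ z → x ≈/ z
    ≈/-trans {x} {y} {z} p q = resp (telescope x y z) (add p q)

    ≈/-neg : ∀ {x y} → x ≈/ y → (- x) ≈/ (- y)
    ≈/-neg {x} {y} p = resp (sym (-‿+-comm x (- y))) (Ideal-neg p)

    ≈/-sym : ∀ {x y} → x ≈/ y → y ≈/ x
    ≈/-sym {x} {y} p = resp (begin
      - (x - y)      ≈⟨ sym (-‿+-comm x (- y)) ⟩
      - x - (- y)    ≈⟨ +-congˡ (-‿involutive y) ⟩
      - x + y        ≈⟨ +-comm (- x) y ⟩
      y - x          ∎) (Ideal-neg p)

    ≈/-+ : ∀ {x y u v} → x ≈/ y → u ≈/ v → (x + u) ≈/ (y + v)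
    ≈/-+ {x} {y} {u} {v} p q = resp (begin
      (x - y) + (u - v)      ≈⟨ interchange x (- y) u (- v) ⟩
      (x + u) + (- y - v)    ≈⟨ +-congˡ (-‿+-comm y v) ⟩
      (x + u) - (y + v)      ∎) (add p q)

    ≈/-* : ∀ {x y u v} → x ≈/ y → u ≈/ v → (x * u) ≈/ (y * v)
    ≈/-* {x} {y} {u} {v} p q =
      ≈/-trans (resp ([y-z]x≈yx-zx u x y) (mulʳ u p)) (resp (x[y-z]≈xy-xz y u v) (mulˡ y q))

  quotientRing : Ring c (c ⊔ ℓ ⊔ g)
  quotientRing = record
    { Carrier = Carrier ; _≈_ = _≈/_ ; _+_ = _+_ ; _*_ = _*_ ; -_ = -_ ; 0# = 0# ; 1# = 1#
    ; isRing = record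
      { +-isAbelianGroup = record
        { isGroup = record
          { isMonoid = record
            { isSemigroup = record
              { isMagma = record
                { isEquivalence = record { refl = lift refl ; sym = ≈/-sym ; trans = ≈/-trans }
                ; ∙-cong = ≈/-+
                }
              ; assoc = λ x y z → lift (+-assoc x y z)
              }
            ; identity = (λ x → lift (+-identityˡ x)) , (λ x → lift (+-identityʳ x))
            }
          ; inverse = (λ x → lift (-‿inverseˡ x)) , (λ x → lift (-‿inverseʳ x))
          ; ⁻¹-cong = ≈/-neg
          }
        ; comm = λ x y → lift (+-comm x y)
        }
      ; *-cong = ≈/-*
      ; *-assoc = λ x y z → lift (*-assoc x y z)
      ; *-identity = (λ x → lift (*-identityˡ x)) , (λ x → lift (*-identityʳ x))
      ; distrib = (λ x y z → lift (distribˡ x y z)) , (λ x y z → lift (distribʳ x y z))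
      }
    }

-- The free associative unital R-algebra on e 0, …, e (n − 1), presented by
-- terms, modulo v v = 0 for every linear combination v of the generators;
-- equivalently, modulo (e i)² = 0 and e i e j + e j e i = 0.
module Exterior {c ℓ} (R : CommutativeRing c ℓ) (n : ℕ) where
  private module R = CommutativeRing R

  infixl 6 _⊕_
  infixl 7 _⊗_
  infix  8 ⊝_
  infix  4 _≈Λ_

  data Term : Set c where
    scalar  : R.Carrier → Term
    e       : Fin n → Term
    _⊕_ _⊗_ : Term → Term → Term
    ⊝_      : Term → Term

  linear : Vector R.Carrier n → Term
  linear ξ = Vector.foldr _⊕_ (scalar R.0#) (λ i → scalar (ξ i) ⊗ e i)

  data _≈Λ_ : Rel Term (c ⊔ ℓ) where
    ≈-refl      : ∀ {x} → x ≈Λ x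
    ≈-sym       : ∀ {x y} → x ≈Λ y → y ≈Λ x
    ≈-trans     : ∀ {x y z} → x ≈Λ y → y ≈Λ z → x ≈Λ z
    ⊕-cong      : ∀ {x y u v} → x ≈Λ y → u ≈Λ v → x ⊕ u ≈Λ y ⊕ v
    ⊗-cong      : ∀ {x y u v} → x ≈Λ y → u ≈Λ v → x ⊗ u ≈Λ y ⊗ v
    ⊝-cong      : ∀ {x y} → x ≈Λ y → ⊝ x ≈Λ ⊝ y
    ⊕-assoc     : ∀ x y z → (x ⊕ y) ⊕ z ≈Λ x ⊕ (y ⊕ z)
    ⊕-comm      : ∀ x y → x ⊕ y ≈Λ y ⊕ x
    ⊕-identityˡ : ∀ x → scalar R.0# ⊕ x ≈Λ x
    ⊕-inverseˡ  : ∀ x → ⊝ x ⊕ x ≈Λ scalar R.0#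
    ⊗-assoc     : ∀ x y z → (x ⊗ y) ⊗ z ≈Λ x ⊗ (y ⊗ z)
    ⊗-identityˡ : ∀ x → scalar R.1# ⊗ x ≈Λ x
    distribˡ    : ∀ x y z → x ⊗ (y ⊕ z) ≈Λ x ⊗ y ⊕ x ⊗ z
    distribʳ    : ∀ x y z → (y ⊕ z) ⊗ x ≈Λ y ⊗ x ⊕ z ⊗ x
    scalar-cong : ∀ {a b} → a R.≈ b → scalar a ≈Λ scalar b
    scalar-+    : ∀ a b → scalar (a R.+ b) ≈Λ scalar a ⊕ scalar b
    scalar-*    : ∀ a b → scalar (a R.* b) ≈Λ scalar a ⊗ scalar b
    central     : ∀ a x → scalar a ⊗ x ≈Λ x ⊗ scalar a
    alternating : ∀ ξ → linear ξ ⊗ linear ξ ≈Λ scalar R.0#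

  Λ : Ring c (c ⊔ ℓ)
  Λ = record
    { Carrier = Term ; _≈_ = _≈Λ_ ; _+_ = _⊕_ ; _*_ = _⊗_ ; -_ = ⊝_
    ; 0# = scalar R.0# ; 1# = scalar R.1#
    ; isRing = record
      { +-isAbelianGroup = record
        { isGroup = record
          { isMonoid = record
            { isSemigroup = record
              { isMagma = record
                { isEquivalence = record { refl = ≈-refl ; sym = ≈-sym ; trans = ≈-trans }
                ; ∙-cong = ⊕-cong
                }
              ; assoc = ⊕-assoc
              }
            ; identity = ⊕-identityˡ
                       , λ x → ≈-trans (⊕-comm x (scalar R.0#)) (⊕-identityˡ x)
            }
          ; inverse = ⊕-inverseˡ , λ x → ≈-trans (⊕-comm x (⊝ x)) (⊕-inverseˡ x)
          ; ⁻¹-cong = ⊝-cong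
          }
        ; comm = ⊕-comm
        }
      ; *-cong = ⊗-cong
      ; *-assoc = ⊗-assoc
      ; *-identity = ⊗-identityˡ
                   , λ x → ≈-trans (≈-sym (central R.1# x)) (⊗-identityˡ x)
      ; distrib = distribˡ , distribʳ
      }
    }

  open Ring Λ using (1#; -_; +-commutativeMonoid; semiring)
  open Sum +-commutativeMonoid using (sum-syntax)
  open Exp semiring using (_^_)

  monomial : List (Fin n) → Term
  monomial is = List.foldr _⊗_ 1# (map e is)

  elements : Subset n → List (Fin n)
  elements C = List.filter (_∈? C) (List.allFin n)

  -- With C = {i₁ < ⋯ < i_p}, the sum over j of (−1)^(j−1) e_{i₁} ⋯ ê_{i_j} ⋯ e_{i_p};
  -- indices here start at 0, so the sign exponent is toℕ j.
  ∂ : Subset n → Term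
  ∂ C = ∑[ j < length (elements C) ] ((- 1#) ^ toℕ j ⊗ monomial (removeAt (elements C) j))

-- An arrangement in F^l; F is unrelated to the coefficient field of the
-- Orlik–Solomon algebra.
record CentralArrangement {f ℓf} (F : CommutativeRing f ℓf) (n l : ℕ) : Set (f ⊔ ℓf) where
  open CommutativeRing F using (Carrier; _≈_; 0#)
  open Linear F
  field
    form   : Fin n → Vector Carrier l
    form≉0 : ∀ i → ¬ (form i ≋ 0ᵛ)

  H : Fin n → Pred (Vector Carrier l) ℓf
  H i x = form i · x ≈ 0#

  field
    distinct : ∀ {i j} → i ≢ j → ¬ (H i ≐ H j)

  ⋂H : Subset n → Pred (Vector Carrier l) ℓf
  ⋂H C x = ∀ i → i ∈ C → H i x

  Dependent : Pred (Subset n) (f ⊔ ℓf)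
  Dependent C = Codim< (⋂H C) ∣ C ∣

  Circuit : Pred (Subset n) (f ⊔ ℓf)
  Circuit C = Dependent C × (∀ D → D Subset.⊂ C → ¬ Dependent D)

  Line : Pred (Subset n) (f ⊔ ℓf)
  Line X = ∃₂ λ i j → i ≢ j × (∀ m → m ∈ X ⇔ (H i U.∩ H j) U.⊆ H m)

  NontrivialLine : Pred (Subset n) (f ⊔ ℓf)
  NontrivialLine X = Line X × 3 ℕ.≤ ∣ X ∣

module OrlikSolomon {c ℓ f ℓf} (k : Field c ℓ) {F : CommutativeRing f ℓf} {n l}
  (𝒜 : CentralArrangement F n l) where
  open Field k using (commutativeRing) renaming (Carrier to 𝕜)
  open CentralArrangement 𝒜
  open Exterior commutativeRing n

  ∂Circuit : Pred Term (c ⊔ f ⊔ ℓf)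
  ∂Circuit x = ∃[ C ] (Circuit C × x ≡ ∂ C)

  A : Ring c (c ⊔ ℓ ⊔ f ⊔ ℓf)
  A = Quotient.quotientRing Λ ∂Circuit

  open Ring A using (_*_; _≈_; 0#; +-commutativeMonoid)
  open Sum +-commutativeMonoid using (sum-syntax)

  a : Vector 𝕜 n → Ring.Carrier A
  a ξ = ∑[ i < n ] (scalar (ξ i) * e i)

  Z : Vector 𝕜 n → Pred (Vector 𝕜 n) (c ⊔ ℓ ⊔ f ⊔ ℓf)
  Z λ′ η = a λ′ * a η ≈ 0#

Resonance : ∀ {c ℓ f ℓf} (k : Field c ℓ) {F : CommutativeRing f ℓf} {n l} →
            CentralArrangement F n l →
            Pred (Vector (Field.Carrier k) n) (c ⊔ ℓ ⊔ f ⊔ ℓf)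
Resonance k 𝒜 λ′ = Dim≥ (Z λ′) 2
  where
  open Linear (Field.commutativeRing k)
  open OrlikSolomon k 𝒜

record Graph (n : ℕ) : Set₁ where
  field
    Adj    : Rel (Fin n) 0ℓ
    sym    : Symmetric Adj
    irrefl : Irreflexive _≡_ Adj
    adj?   : B.Decidable Adj

  Clique : Pred (Subset n) 0ℓ
  Clique S = ∀ {i j} → i ∈ S → j ∈ S → i ≢ j → Adj i j

  Block : Pred (Subset n) 0ℓ
  Block S = Clique S × (∀ T → Clique T → S Subset.⊆ T → T ≡ S)

  Cone : Pred (Fin n) 0ℓ
  Cone v = ∀ w → w ≢ v → Adj v w

  cone? : U.Decidable Cone
  cone? v = Fin.all? (λ w → ¬? (w Fin.≟ v) →-dec adj? v w)

  nonCone : Subset n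
  nonCone = Vec.tabulate (λ v → not (does (cone? v)))

module _ {f ℓf} {F : CommutativeRing f ℓf} {n l} (𝒜 : CentralArrangement F n l) where
  open CentralArrangement 𝒜

  -- The truncated subtraction below is harmless, as 2 ≤ ∣ X ∩ U ∣.
  IsNeighborly : Pred (Graph n) (f ⊔ ℓf)
  IsNeighborly Γ =
    ∀ X → Line X → 2 ℕ.≤ ∣ X Subset.∩ U ∣ →
    ∀ S → Block S → ∣ X Subset.∩ U ∣ ℕ.∸ 1 ℕ.≤ ∣ X Subset.∩ U Subset.∩ S ∣ → X Subset.⊆ S
    where open Graph Γ renaming (nonCone to U)

  module _ {c ℓ} (k : Field c ℓ) where
    open Field k
    open Linear commutativeRing

    K : Graph n → Pred (Vector Carrier n) (ℓ ⊔ f ⊔ ℓf)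
    K Γ ξ = ∀ X → NontrivialLine X → ¬ Graph.Clique Γ X → sumOver ξ X ≈ 0#

    ZΓ : Graph n → Vector Carrier n → Pred (Vector Carrier n) (ℓ ⊔ f ⊔ ℓf)
    ZΓ Γ λ′ η = K Γ η × (∀ i j → Graph.Adj Γ i j → λ′ i * η j - λ′ j * η i ≈ 0#)

    𝒩 : Set (suc 0ℓ ⊔ c ⊔ ℓ ⊔ f ⊔ ℓf)
    𝒩 = Σ[ Γ ∈ Graph n ] (IsNeighborly Γ × Dim≥ (K Γ) 2)

    V : 𝒩 → Pred (Vector Carrier n) (c ⊔ ℓ ⊔ f ⊔ ℓf)
    V (Γ , _) λ′ = K Γ λ′ × Dim≥ (ZΓ Γ λ′) 2

{-# OPTIONS --safe #-}
module Submission where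

-- In degree two, a_λ a_η = 0 holds if and only if λ_i η_X = λ_X η_i for every line X and
-- every i ∈ X.  For necessity, the functionals ξ ↦ ξ_i and ξ ↦ ξ_X induce a homomorphism
-- from the exterior algebra to the exterior algebra on two generators; it kills every ∂ e_C
-- and maps a_λ a_η to λ_i η_X − λ_X η_i.  For sufficiency, let b(i,j) be a point of the line
-- through i and j, depending only on the line: then e_i e_j = e_i e_b − e_j e_b, so
-- a_λ a_η = Σ_{i,j} (λ_i η_j − λ_j η_i) e_i e_b(i,j), and for fixed i and b the coefficients
-- with b(i,j) = b add up to λ_i η_X − λ_X η_i, where X is the line through i and b.
--
-- Given λ, let i and j be adjacent in Γ if λ_i η_j = λ_j η_i for all η in Z(λ).  On a line X
-- containing two non-adjacent points, a 2 × 2 determinant forces η_X = 0 for all η in Z(λ),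
-- so that Z(λ) ⊆ K(Γ) and Z_Γ(λ) = Z(λ); the same vanishing makes Γ neighborly.  Conversely,
-- for neighborly Γ every line is a clique or one of the lines on which K(Γ) vanishes, so
-- Z_Γ(λ) ⊆ Z(λ).

-- Adjacency in the graph of λ is the vanishing of 2 × 2 minors on Z(λ). It fails to be transitive
-- only through a vertex u with λ_u = 0 and η_u = 0 for every η in Z(λ). Such a u is adjacent to
-- every other vertex, so it is a cone vertex; this explains why neighborliness counts points of U
-- only, and why transitivity is proved through non-cone vertices. No basis of the degree-two part
-- of A is computed. Homomorphisms to a small exterior algebra show that certain scalars must
-- vanish, and rewriting through base points shows that their vanishing suffices. A circuit with
-- more than three elements gives a relation of degree at least three, so degree two sees exactly
-- the collinear triples. Excluded middle enters in three ways: `Dim≥` asks for an actual basis, a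
-- failure of parallelism has to yield a witness in Z(λ), and a real number that is not zero has to
-- be invertible.

open import Defs
open import Axiom.ExcludedMiddle using (ExcludedMiddle)
open import Relation.Unary using (Pred; _⊆_; _∩_; _≐_; ⋃)

open import Algebra.Bundles using (CommutativeRing; Ring)
open import Algebra.Bundles.Raw using (RawRing)
import Algebra.Properties.CommutativeSemigroup as CommutativeSemigroupProperties
import Algebra.Properties.Ring as RingProperties
import Algebra.Properties.Semiring.Exp as Exp
import Algebra.Properties.Semiring.Mult as Mult
import Algebra.Properties.Semiring.Sum as SemiringSum
import Algebra.Solver.Ring
open import Algebra.Solver.Ring.AlmostCommutativeRing using (fromCommutativeRing; _-Raw-AlmostCommutative⟶_)
open import Data.Bool.Base using (true; false; if_then_else_)
open import Data.Empty using (⊥-elim)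
open import Data.Fin.Base using (Fin; zero; suc; toℕ; punchIn)
import Data.Fin.Properties as Fin
open import Data.Fin.Subset as Subset using (Subset; ∣_∣; _∈_; _∉_; _∪_; ⁅_⁆; inside; outside; Nonempty)
open import Data.Fin.Subset.Properties
open import Data.List.Base as List using (List; []; _∷_; length; removeAt)
import Data.List.Membership.Propositional as List
import Data.List.Membership.Propositional.Properties as List
import Data.List.Properties as List
open import Data.List.Relation.Unary.All using (_∷_)
open import Data.List.Relation.Unary.AllPairs using (_∷_)
open import Data.List.Relation.Unary.Any using (here; there)
open import Data.List.Relation.Unary.Unique.Propositional using (Unique)
import Data.List.Relation.Unary.Unique.Propositional.Properties as Unique
open import Data.Maybe.Base using (Maybe; just; nothing)
open import Data.Nat.Base as ℕ using (ℕ; z≤n; s≤s)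
import Data.Nat.Properties as ℕₚ
open import Data.Product.Base using (∃-syntax; _×_; _,_; proj₁; proj₂)
open import Data.Rational.Base as ℚ using (ℚ; 0ℚ; 1ℚ)
import Data.Rational.Properties as ℚₚ
open import Data.Rational.Solver using (module +-*-Solver)
open import Data.Sum.Base using (_⊎_; inj₁; inj₂)
open import Data.Vec.Base as Vec using ([]; _∷_; here; there; lookup)
open import Data.Vec.Functional as Vector using (Vector; insertAt) renaming ([] to []ᵛ; _∷_ to infixr 5 _∷ᵛ_)
import Data.Vec.Functional.Properties as Vector
import Data.Vec.Properties as Vec
open import Function.Base using (_∘_; id)
open import Function.Bundles using (Equivalence; mk⇔)
open import Level using (0ℓ)
open import Relation.Binary.PropositionalEquality as ≡ using (_≡_; _≢_; subst)
open import Relation.Nullary.Decidable using (Dec; yes; no; does; dec-true; True; toWitness; fromWitness; ¬?)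
open import Relation.Nullary.Decidable.Core using (T?)
open import Relation.Nullary.Negation using (¬_; contradiction)

-- A coefficient (m , n) stands for the integer m − n, so that the solver can cancel.
module RingSolver {c ℓ} (R : CommutativeRing c ℓ) where
  open CommutativeRing R
  open RingProperties ring
  open Mult semiring using (×-homo-+; ×1-homo-*) renaming (_×_ to _⋆_)
  open CommutativeSemigroupProperties +-commutativeSemigroup using (interchange)

  private
    -- The special values of `⟦_⟧` let `con (0 , 0)` and `con (1 , 0)` compute to `0#` and `1#`;
    -- under `⟦_⟧ᵤ` they would be formal differences, which do not match goals that mention `0#` or
    -- `1#`.
    ⟦_⟧ᵤ ⟦_⟧ : ℕ × ℕ → Carrier
    ⟦ m , n ⟧ᵤ = m ⋆ 1# - n ⋆ 1#
    ⟦ 0 , 0 ⟧ = 0#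
    ⟦ 1 , 0 ⟧ = 1#
    ⟦ m , n ⟧ = ⟦ m , n ⟧ᵤ

    ⟦⟧≈⟦⟧ᵤ : ∀ x → ⟦ x ⟧ ≈ ⟦ x ⟧ᵤ
    ⟦⟧≈⟦⟧ᵤ (0 , 0) = sym (-‿inverseʳ 0#)
    ⟦⟧≈⟦⟧ᵤ (1 , 0) = sym (trans (+-cong (+-identityʳ 1#) -0#≈0#) (+-identityʳ 1#))
    ⟦⟧≈⟦⟧ᵤ (0 , ℕ.suc n) = refl
    ⟦⟧≈⟦⟧ᵤ (1 , ℕ.suc n) = refl
    ⟦⟧≈⟦⟧ᵤ (ℕ.suc (ℕ.suc m) , n) = refl

    coefficients : RawRing 0ℓ 0ℓ
    coefficients = record
      { Carrier = ℕ × ℕ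
      ; _≈_ = _≡_
      ; _+_ = λ { (a , b) (c , d) → a ℕ.+ c , b ℕ.+ d }
      ; _*_ = λ { (a , b) (c , d) → a ℕ.* c ℕ.+ b ℕ.* d , a ℕ.* d ℕ.+ b ℕ.* c }
      ; -_ = λ { (a , b) → b , a }
      ; 0# = 0 , 0
      ; 1# = 1 , 0
      }

    open import Relation.Binary.Reasoning.Setoid setoid

    [w-x]+[y-z] : ∀ w x y z → (w - x) + (y - z) ≈ (w + y) - (x + z)
    [w-x]+[y-z] w x y z = trans (interchange w (- x) y (- z)) (+-congˡ (-‿+-comm x z))

    +-homo : ∀ a b c d → ⟦ a ℕ.+ c , b ℕ.+ d ⟧ᵤ ≈ ⟦ a , b ⟧ᵤ + ⟦ c , d ⟧ᵤ
    +-homo a b c d = trans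
      (+-cong (×-homo-+ 1# a c) (-‿cong (×-homo-+ 1# b d)))
      (sym ([w-x]+[y-z] (a ⋆ 1#) (b ⋆ 1#) (c ⋆ 1#) (d ⋆ 1#)))

    [w-x][y-z] : ∀ w x y z → (w - x) * (y - z) ≈ (w * y + x * z) - (w * z + x * y)
    [w-x][y-z] w x y z = begin
      (w - x) * (y - z)                        ≈⟨ [y-z]x≈yx-zx (y - z) w x ⟩
      w * (y - z) - x * (y - z)                ≈⟨ +-cong (x[y-z]≈xy-xz w y z) (-‿cong (x[y-z]≈xy-xz x y z)) ⟩
      (w * y - w * z) - (x * y - x * z)        ≈⟨ +-congˡ (⁻¹-anti-homo‿- (x * y) (x * z)) ⟩
      (w * y - w * z) + (x * z - x * y)        ≈⟨ [w-x]+[y-z] _ _ _ _ ⟩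
      (w * y + x * z) - (w * z + x * y)        ∎

    homo-*+* : ∀ a b c d → (a ℕ.* c ℕ.+ b ℕ.* d) ⋆ 1# ≈ (a ⋆ 1#) * (c ⋆ 1#) + (b ⋆ 1#) * (d ⋆ 1#)
    homo-*+* a b c d = trans (×-homo-+ 1# (a ℕ.* c) (b ℕ.* d)) (+-cong (×1-homo-* a c) (×1-homo-* b d))

    homomorphism : coefficients -Raw-AlmostCommutative⟶ fromCommutativeRing R
    homomorphism = record
      { ⟦_⟧ = ⟦_⟧
      ; +-homo = λ { (a , b) (c , d) → trans (⟦⟧≈⟦⟧ᵤ (a ℕ.+ c , b ℕ.+ d))
          (trans (+-homo a b c d) (sym (+-cong (⟦⟧≈⟦⟧ᵤ (a , b)) (⟦⟧≈⟦⟧ᵤ (c , d))))) }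
      ; *-homo = λ { (a , b) (c , d) → trans (⟦⟧≈⟦⟧ᵤ (a ℕ.* c ℕ.+ b ℕ.* d , a ℕ.* d ℕ.+ b ℕ.* c))
          (trans (+-cong (homo-*+* a b c d) (-‿cong (homo-*+* a b d c)))
            (trans (sym ([w-x][y-z] (a ⋆ 1#) (b ⋆ 1#) (c ⋆ 1#) (d ⋆ 1#)))
              (sym (*-cong (⟦⟧≈⟦⟧ᵤ (a , b)) (⟦⟧≈⟦⟧ᵤ (c , d)))))) }
      ; -‿homo = λ { (a , b) → trans (⟦⟧≈⟦⟧ᵤ (b , a))
          (trans (sym (⁻¹-anti-homo‿- (a ⋆ 1#) (b ⋆ 1#))) (-‿cong (sym (⟦⟧≈⟦⟧ᵤ (a , b))))) }
      ; 0-homo = refl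
      ; 1-homo = refl
      }

    _≟_ : ∀ x y → Maybe (⟦ x ⟧ ≈ ⟦ y ⟧)
    -- Coefficients are never normalised, so a - b = c - d is tested in the form a + d = c + b.
    (a , b) ≟ (c , d) with a ℕ.+ d ℕₚ.≟ c ℕ.+ b
    ... | no _ = nothing
    ... | yes eq = just (begin
      ⟦ a , b ⟧            ≈⟨ ⟦⟧≈⟦⟧ᵤ (a , b) ⟩
      A - B                ≈⟨ sym (+-identityʳ (A - B)) ⟩
      (A - B) + 0#         ≈⟨ +-congˡ (sym (-‿inverseʳ D)) ⟩
      (A - B) + (D - D)    ≈⟨ [w-x]+[y-z] A B D D ⟩
      (A + D) - (B + D)    ≈⟨ +-cong A+D≈C+B (-‿cong (+-comm B D)) ⟩
      (C + B) - (D + B)    ≈⟨ sym ([w-x]+[y-z] C D B B) ⟩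
      (C - D) + (B - B)    ≈⟨ +-congˡ (-‿inverseʳ B) ⟩
      (C - D) + 0#         ≈⟨ +-identityʳ (C - D) ⟩
      C - D                ≈⟨ sym (⟦⟧≈⟦⟧ᵤ (c , d)) ⟩
      ⟦ c , d ⟧            ∎)
      where
      A = a ⋆ 1#
      B = b ⋆ 1#
      C = c ⋆ 1#
      D = d ⋆ 1#
      A+D≈C+B : A + D ≈ C + B
      A+D≈C+B = trans (sym (×-homo-+ 1# a d)) (trans (reflexive (≡.cong (_⋆ 1#) eq)) (×-homo-+ 1# c b))

  open Algebra.Solver.Ring coefficients (fromCommutativeRing R) homomorphism _≟_ public

-- Inverses of real and complex numbers

module _ {c ℓ} (R : CommutativeRing c ℓ) where
  open CommutativeRing R
  open RingSolver R
  open AdjoinI R using (mul; one; _≈C_)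

  -- The inverse of a + b i is its conjugate divided by a² + b², and t plays the part of 1 / (a² +
  -- b²).
  *-conjugate : ∀ a b t → (a * a + b * b) * t ≈ 1# → mul (a , b) (a * t , - (b * t)) ≈C one
  *-conjugate a b t eq =
      trans (solve 3 (λ a b t → a :* (a :* t) :- b :* (:- (b :* t)) := (a :* a :+ b :* b) :* t) refl a b t) eq
    , solve 3 (λ a b t → a :* (:- (b :* t)) :+ b :* (a :* t) := con (0 , 0)) refl a b t

module ComplexField (em : ∀ {a} → ExcludedMiddle a) where

  private
    half+half : ∀ p → p ℚ.* ℚ.½ ℚ.+ p ℚ.* ℚ.½ ≡ p
    half+half = solve 1 (λ p → p :* con ℚ.½ :+ p :* con ℚ.½ := p) ≡.refl
      where open +-*-Solver

    *-pos : ∀ {p q} → 0ℚ ℚ.< p → 0ℚ ℚ.< q → 0ℚ ℚ.< p ℚ.* q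
    *-pos {p} {q} p>0 q>0 =
      subst (ℚ._< p ℚ.* q) (ℚₚ.*-zeroˡ q) (ℚₚ.*-monoˡ-<-pos q {{ℚ.positive q>0}} p>0)

    *-mono-≤ : ∀ {p q r s} → 0ℚ ℚ.≤ p → 0ℚ ℚ.≤ s → p ℚ.≤ q → r ℚ.≤ s → p ℚ.* r ℚ.≤ q ℚ.* s
    *-mono-≤ {p} {s = s} 0≤p 0≤s p≤q r≤s = ℚₚ.≤-trans
      (ℚₚ.*-monoˡ-≤-nonNeg p {{ℚ.nonNegative 0≤p}} r≤s)
      (ℚₚ.*-monoʳ-≤-nonNeg s {{ℚ.nonNegative 0≤s}} p≤q)

    ∣p-0∣≡∣p∣ : ∀ p → ℚ.∣ p ℚ.- 0ℚ ∣ ≡ ℚ.∣ p ∣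
    ∣p-0∣≡∣p∣ p = ≡.cong ℚ.∣_∣ (ℚₚ.+-identityʳ p)

    -- The value at 0 makes the termwise inverse of a sequence total; a sequence bounded away from
    -- zero meets it at finitely many indices only.
    inv : ℚ → ℚ
    inv q with q ℚₚ.≟ 0ℚ
    ... | yes _  = 0ℚ
    ... | no q≢0 = ℚ.1/_ q {{ℚ.≢-nonZero q≢0}}

    *-inv : ∀ {q} → q ≢ 0ℚ → q ℚ.* inv q ≡ 1ℚ
    *-inv {q} q≢0 with q ℚₚ.≟ 0ℚ
    ... | yes q≡0 = contradiction q≡0 q≢0
    ... | no q≢0′ = ℚₚ.*-inverseʳ q {{ℚ.≢-nonZero q≢0′}}

  open ℝ

  BoundedAway : ℝ → Set
  BoundedAway x = ∃[ η ] (0ℚ ℚ.< η × ∃[ N ] (∀ {n} → N ℕ.≤ n → η ℚ.≤ ℚ.∣ seq x n ∣))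

  -- A sequence that does not tend to zero has terms of size at least some ε arbitrarily far out;
  -- the Cauchy condition with tolerance ε / 2 then keeps all late terms at size at least ε / 2.
  ≉0⇒BoundedAway : ∀ x → ¬ (x ≈ℝ fromℚ 0ℚ) → BoundedAway x
  ≉0⇒BoundedAway x x≉0 with em {P = ∃[ ε ] (0ℚ ℚ.< ε × (∀ N → ∃[ m ] (N ℕ.≤ m × ε ℚ.≤ ℚ.∣ seq x m ∣)))}
  ... | no ¬large = ⊥-elim (x≉0 (vanishing small))
    where
    small : Vanishing (λ m n → seq x m ℚ.- 0ℚ)
    small {ε} ε>0 with em {P = ∃[ N ] (∀ {m} → N ℕ.≤ m → ℚ.∣ seq x m ∣ ℚ.< ε)}
    ... | yes (N , h) = N , λ {m} p _ → subst (ℚ._< ε) (≡.sym (∣p-0∣≡∣p∣ (seq x m))) (h p)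
    ... | no ¬small = ⊥-elim (¬large (ε , ε>0 , large))
      where
      large : ∀ N → ∃[ m ] (N ℕ.≤ m × ε ℚ.≤ ℚ.∣ seq x m ∣)
      large N with em {P = ∃[ m ] (N ℕ.≤ m × ε ℚ.≤ ℚ.∣ seq x m ∣)}
      ... | yes l = l
      ... | no ¬l = ⊥-elim (¬small (N , λ {m} p → ℚₚ.≰⇒> λ ε≤ → ¬l (m , p , ε≤)))
  ... | yes (ε , ε>0 , large) = η , η>0 , N , bound
    where
    η = ε ℚ.* ℚ.½
    η>0 = *-pos ε>0 (ℚₚ.positive⁻¹ ℚ.½)
    N = proj₁ (_∼_.vanishes (cauchy x) η>0)
    m = proj₁ (large N)
    bound : ∀ {n} → N ℕ.≤ n → η ℚ.≤ ℚ.∣ seq x n ∣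
    bound {n} p = ℚₚ.≮⇒≥ λ xₙ<η → ℚₚ.<-irrefl ≡.refl (begin-strict
      ε                                                ≤⟨ proj₂ (proj₂ (large N)) ⟩
      ℚ.∣ seq x m ∣                                    ≡⟨ ≡.cong ℚ.∣_∣ (sub-add (seq x m) (seq x n)) ⟩
      ℚ.∣ (seq x m ℚ.- seq x n) ℚ.+ seq x n ∣          ≤⟨ ℚₚ.∣p+q∣≤∣p∣+∣q∣ (seq x m ℚ.- seq x n) (seq x n) ⟩
      ℚ.∣ seq x m ℚ.- seq x n ∣ ℚ.+ ℚ.∣ seq x n ∣      <⟨ ℚₚ.+-mono-< (proj₂ (_∼_.vanishes (cauchy x) η>0) (proj₁ (proj₂ (large N))) p) xₙ<η ⟩
      η ℚ.+ η                                          ≡⟨ half+half ε ⟩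
      ε                                                ∎)
      where
      open ℚₚ.≤-Reasoning
      open +-*-Solver
      sub-add : ∀ a b → a ≡ (a ℚ.- b) ℚ.+ b
      sub-add = solve 2 (λ a b → a := (a :- b) :+ b) ≡.refl

  ℝ-inverse : ∀ x → ¬ (x ≈ℝ fromℚ 0ℚ) → ∃[ y ] (x *ℝ y ≈ℝ fromℚ 1ℚ)
  ℝ-inverse x x≉0 = mkℝ y (vanishing y-cauchy) , vanishing xy→1
    where
    bounded = ≉0⇒BoundedAway x x≉0
    η = proj₁ bounded
    η>0 = proj₁ (proj₂ bounded)
    N₁ = proj₁ (proj₂ (proj₂ bounded))
    η≤∣x∣ = proj₂ (proj₂ (proj₂ bounded))
    x≢0 : ∀ {n} → N₁ ℕ.≤ n → seq x n ≢ 0ℚ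
    x≢0 p xₙ≡0 = ℚₚ.<-irrefl ≡.refl (ℚₚ.<-≤-trans η>0 (subst (λ z → η ℚ.≤ ℚ.∣ z ∣) xₙ≡0 (η≤∣x∣ p)))
    y : ℕ → ℚ
    y n = inv (seq x n)
    cross : ∀ {m n} → N₁ ℕ.≤ m → N₁ ℕ.≤ n →
            (y m ℚ.- y n) ℚ.* (seq x m ℚ.* seq x n) ≡ ℚ.- (seq x m ℚ.- seq x n)
    cross {m} {n} p q = begin
      (y m ℚ.- y n) ℚ.* (seq x m ℚ.* seq x n)
        ≡⟨ solve 4 (λ a b c d → (c :- d) :* (a :* b) := (a :* c) :* b :- (b :* d) :* a) ≡.refl (seq x m) (seq x n) (y m) (y n) ⟩
      (seq x m ℚ.* y m) ℚ.* seq x n ℚ.- (seq x n ℚ.* y n) ℚ.* seq x m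
        ≡⟨ ≡.cong₂ (λ u v → u ℚ.* seq x n ℚ.- v ℚ.* seq x m) (*-inv (x≢0 p)) (*-inv (x≢0 q)) ⟩
      1ℚ ℚ.* seq x n ℚ.- 1ℚ ℚ.* seq x m
        ≡⟨ solve 2 (λ a b → con 1ℚ :* b :- con 1ℚ :* a := :- (a :- b)) ≡.refl (seq x m) (seq x n) ⟩
      ℚ.- (seq x m ℚ.- seq x n) ∎
      where
      open ≡.≡-Reasoning
      open +-*-Solver
    y-cauchy : Vanishing (λ m n → y m ℚ.- y n)
    y-cauchy {δ} δ>0 = N₁ ℕ.⊔ N₂ , λ {m} {n} p q → close (≤ˡ p) (≤ʳ p) (≤ˡ q) (≤ʳ q)
      where
      -- By `cross`, 1 / x_m - 1 / x_n has numerator of size |x_m - x_n| and denominator of size at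
      -- least η², so δ η² is the tolerance to ask of `x`.
      δηη>0 = *-pos δ>0 (*-pos η>0 η>0)
      N₂ = proj₁ (_∼_.vanishes (cauchy x) δηη>0)
      ≤ˡ : ∀ {m} → N₁ ℕ.⊔ N₂ ℕ.≤ m → N₁ ℕ.≤ m
      ≤ˡ = ℕₚ.≤-trans (ℕₚ.m≤m⊔n N₁ N₂)
      ≤ʳ : ∀ {m} → N₁ ℕ.⊔ N₂ ℕ.≤ m → N₂ ℕ.≤ m
      ≤ʳ = ℕₚ.≤-trans (ℕₚ.m≤n⊔m N₁ N₂)
      close : ∀ {m n} → N₁ ℕ.≤ m → N₂ ℕ.≤ m → N₁ ℕ.≤ n → N₂ ℕ.≤ n → ℚ.∣ y m ℚ.- y n ∣ ℚ.< δ
      close {m} {n} p₁ p₂ q₁ q₂ = ℚₚ.*-cancelʳ-<-nonNeg w {{ℚₚ.∣-∣-nonNeg (seq x m ℚ.* seq x n)}} (begin-strict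
        ℚ.∣ y m ℚ.- y n ∣ ℚ.* w                        ≡⟨ ≡.sym (ℚₚ.∣p*q∣≡∣p∣*∣q∣ (y m ℚ.- y n) _) ⟩
        ℚ.∣ (y m ℚ.- y n) ℚ.* (seq x m ℚ.* seq x n) ∣  ≡⟨ ≡.cong ℚ.∣_∣ (cross p₁ q₁) ⟩
        ℚ.∣ ℚ.- (seq x m ℚ.- seq x n) ∣                ≡⟨ ℚₚ.∣-p∣≡∣p∣ (seq x m ℚ.- seq x n) ⟩
        ℚ.∣ seq x m ℚ.- seq x n ∣                      <⟨ proj₂ (_∼_.vanishes (cauchy x) δηη>0) p₂ q₂ ⟩
        δ ℚ.* (η ℚ.* η)                                ≤⟨ ℚₚ.*-monoˡ-≤-nonNeg δ {{ℚ.nonNegative (ℚₚ.<⇒≤ δ>0)}}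
                                                            (*-mono-≤ (ℚₚ.<⇒≤ η>0) (ℚₚ.0≤∣p∣ _) (η≤∣x∣ p₁) (η≤∣x∣ q₁)) ⟩
        δ ℚ.* (ℚ.∣ seq x m ∣ ℚ.* ℚ.∣ seq x n ∣)        ≡⟨ ≡.cong (δ ℚ.*_) (≡.sym (ℚₚ.∣p*q∣≡∣p∣*∣q∣ (seq x m) (seq x n))) ⟩
        δ ℚ.* w                                        ∎)
        where
        open ℚₚ.≤-Reasoning
        w = ℚ.∣ seq x m ℚ.* seq x n ∣
    xy→1 : Vanishing (λ m n → seq x m ℚ.* y m ℚ.- 1ℚ)
    xy→1 {δ} δ>0 = N₁ , λ {m} p _ → subst (λ z → ℚ.∣ z ℚ.- 1ℚ ∣ ℚ.< δ) (≡.sym (*-inv (x≢0 p))) δ>0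

  sum-of-squares≈0 : ∀ a b → a *ℝ a +ℝ b *ℝ b ≈ℝ fromℚ 0ℚ → a ≈ℝ fromℚ 0ℚ
  sum-of-squares≈0 a b (vanishing v) = vanishing go
    where
    go : Vanishing (λ m n → seq a m ℚ.- 0ℚ)
    -- If |a_m| ≥ ε, then ε² ≤ a_m² ≤ a_m² + b_m² < ε²; this is the reason for the tolerance ε² in
    -- `near`.
    go {ε} ε>0 = proj₁ near , λ {m} p _ → ℚₚ.≰⇒> λ ε≤ → ℚₚ.<-irrefl ≡.refl (begin-strict
      ε ℚ.* ε                                            ≤⟨ *-mono-≤ (ℚₚ.<⇒≤ ε>0) (ℚₚ.0≤∣p∣ _) ε≤ ε≤ ⟩
      ℚ.∣ seq a m ℚ.- 0ℚ ∣ ℚ.* ℚ.∣ seq a m ℚ.- 0ℚ ∣      ≡⟨ ≡.cong₂ ℚ._*_ (∣p-0∣≡∣p∣ (seq a m)) (∣p-0∣≡∣p∣ (seq a m)) ⟩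
      ∣a∣ m ℚ.* ∣a∣ m                                    ≡⟨ ≡.sym (square (seq a m)) ⟩
      seq a m ℚ.* seq a m                                ≡⟨ ≡.sym (ℚₚ.+-identityʳ _) ⟩
      seq a m ℚ.* seq a m ℚ.+ 0ℚ                         ≤⟨ ℚₚ.+-monoʳ-≤ (seq a m ℚ.* seq a m) (0≤square (seq b m)) ⟩
      seq a m ℚ.* seq a m ℚ.+ seq b m ℚ.* seq b m        ≡⟨ ≡.sym (ℚₚ.0≤p⇒∣p∣≡p (ℚₚ.+-mono-≤ (0≤square (seq a m)) (0≤square (seq b m)))) ⟩
      ℚ.∣ seq a m ℚ.* seq a m ℚ.+ seq b m ℚ.* seq b m ∣  ≡⟨ ≡.sym (∣p-0∣≡∣p∣ _) ⟩
      ℚ.∣ (seq a m ℚ.* seq a m ℚ.+ seq b m ℚ.* seq b m) ℚ.- 0ℚ ∣ <⟨ proj₂ near p p ⟩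
      ε ℚ.* ε                                            ∎)
      where
      open ℚₚ.≤-Reasoning
      near = v (*-pos ε>0 ε>0)
      ∣a∣ : ℕ → ℚ
      ∣a∣ m = ℚ.∣ seq a m ∣
      0≤square : ∀ p → 0ℚ ℚ.≤ p ℚ.* p
      square : ∀ p → p ℚ.* p ≡ ℚ.∣ p ∣ ℚ.* ℚ.∣ p ∣
      square p with ℚₚ.∣p∣≡p∨∣p∣≡-p p
      ... | inj₁ e rewrite e = ≡.refl
      ... | inj₂ e rewrite e = solve 1 (λ p → p :* p := (:- p) :* (:- p)) ≡.refl p
        where open +-*-Solver
      0≤square p = subst (0ℚ ℚ.≤_) (≡.sym (square p))
        (subst (ℚ._≤ ℚ.∣ p ∣ ℚ.* ℚ.∣ p ∣) (ℚₚ.*-zeroˡ ℚ.∣ p ∣)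
          (ℚₚ.*-monoʳ-≤-nonNeg ℚ.∣ p ∣ {{ℚₚ.∣-∣-nonNeg p}} (ℚₚ.0≤∣p∣ p)))

  ℂ-inverse : ∀ z → ¬ CommutativeRing._≈_ ℂ z (CommutativeRing.0# ℂ) →
              ∃[ w ] CommutativeRing._≈_ ℂ (CommutativeRing._*_ ℂ z w) (CommutativeRing.1# ℂ)
  ℂ-inverse (a , b) z≉0 = (a *ℝ t , -ℝ (b *ℝ t)) , *-conjugate ℝ-commutativeRing a b t (proj₂ inverse)
    where
    norm≉0 : ¬ (a *ℝ a +ℝ b *ℝ b ≈ℝ fromℚ 0ℚ)
    norm≉0 norm≈0 = z≉0 ( sum-of-squares≈0 a b norm≈0
                        , sum-of-squares≈0 b a (∼-trans (CommutativeRing.+-comm ℝ-commutativeRing (b *ℝ b) (a *ℝ a)) norm≈0))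
    inverse = ℝ-inverse (a *ℝ a +ℝ b *ℝ b) norm≉0
    t = proj₁ inverse

  ℂ-field : Field 0ℓ 0ℓ
  ℂ-field = record
    { commutativeRing = ℂ
    ; 0≉1 = λ 0≈1 → 0≉1 (proj₁ 0≈1)
    ; inverse = ℂ-inverse
    }
    where
    0≉1 : ¬ (fromℚ 0ℚ ≈ℝ fromℚ 1ℚ)
    0≉1 (vanishing v) = ℚₚ.<-irrefl ≡.refl (proj₂ close ℕₚ.≤-refl ℕₚ.≤-refl)
      where close = v (ℚₚ.positive⁻¹ 1ℚ)

-- Independence, bases and dimension over a field

module LinearAlgebra (em : ∀ {a} → ExcludedMiddle a) {c ℓ} (k : Field c ℓ) where
  open Field k hiding (zero)
  open Linear commutativeRing
  open SemiringSum semiring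
  open RingProperties ring
  open RingSolver commutativeRing
  open import Relation.Binary.Reasoning.Setoid setoid

  decidable-≈ : ∀ x y → Dec (x ≈ y)
  decidable-≈ x y = em

  *-cancelˡ-≈0 : ∀ {x y} → ¬ x ≈ 0# → x * y ≈ 0# → y ≈ 0#
  *-cancelˡ-≈0 {x} {y} x≉0 xy≈0 with inverse x x≉0
  ... | t , xt≈1 = begin
    y            ≈⟨ sym (*-identityˡ y) ⟩
    1# * y       ≈⟨ *-congʳ (sym xt≈1) ⟩
    x * t * y    ≈⟨ solve 3 (λ x t y → x :* t :* y := t :* (x :* y)) refl x t y ⟩
    t * (x * y)  ≈⟨ *-congˡ xy≈0 ⟩
    t * 0#       ≈⟨ zeroʳ t ⟩
    0#           ∎

  sum-≈0 : ∀ {n} {f : Vector Carrier n} → (∀ i → f i ≈ 0#) → sum f ≈ 0#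
  sum-≈0 {n} f≈0 = trans (sum-cong-≋ f≈0) (sum-replicate-zero n)

  InSpan : ∀ {n d} → Vector (Vector Carrier n) d → Pred (Vector Carrier n) _
  InSpan v w = ∃[ a ] (w ≋ lincomb a v)

  lincomb-∘ : ∀ {n d p} (a : Vector Carrier d) (b : Vector (Vector Carrier p) d) (v : Vector (Vector Carrier n) p) →
              lincomb a (λ i → lincomb (b i) v) ≋ lincomb (lincomb a b) v
  lincomb-∘ {d = d} {p} a b v j = begin
    ∑[ i < d ] (a i * ∑[ s < p ] (b i s * v s j))    ≈⟨ sum-cong-≋ (λ i → *-distribˡ-sum (a i) (λ s → b i s * v s j)) ⟩
    ∑[ i < d ] ∑[ s < p ] (a i * (b i s * v s j))    ≈⟨ ∑-comm (λ i s → a i * (b i s * v s j)) ⟩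
    ∑[ s < p ] ∑[ i < d ] (a i * (b i s * v s j))    ≈⟨ sum-cong-≋ (λ s → sum-cong-≋ (λ i → sym (*-assoc (a i) (b i s) (v s j)))) ⟩
    ∑[ s < p ] ∑[ i < d ] (a i * b i s * v s j)      ≈⟨ sum-cong-≋ (λ s → sym (*-distribʳ-sum (v s j) (λ i → a i * b i s))) ⟩
    ∑[ s < p ] (∑[ i < d ] (a i * b i s) * v s j)    ∎

  ·-lincomb : ∀ {n d} (f : Vector Carrier n) (a : Vector Carrier d) (v : Vector (Vector Carrier n) d) →
              f · lincomb a v ≈ ∑[ i < d ] (a i * (f · v i))
  ·-lincomb {n} {d} f a v = begin
    ∑[ j < n ] (f j * ∑[ i < d ] (a i * v i j))    ≈⟨ sum-cong-≋ (λ j → *-distribˡ-sum (f j) (λ i → a i * v i j)) ⟩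
    ∑[ j < n ] ∑[ i < d ] (f j * (a i * v i j))    ≈⟨ ∑-comm (λ j i → f j * (a i * v i j)) ⟩
    ∑[ i < d ] ∑[ j < n ] (f j * (a i * v i j))    ≈⟨ sum-cong-≋ (λ i → sum-cong-≋ (λ j →
                                                       solve 3 (λ x y z → x :* (y :* z) := y :* (x :* z)) refl (f j) (a i) (v i j))) ⟩
    ∑[ i < d ] ∑[ j < n ] (a i * (f j * v i j))    ≈⟨ sum-cong-≋ (λ i → sym (*-distribˡ-sum (a i) (λ j → f j * v i j))) ⟩
    ∑[ i < d ] (a i * (f · v i))                   ∎

  ·-congˡ : ∀ {n} (f : Vector Carrier n) {v w} → v ≋ w → f · v ≈ f · w
  ·-congˡ f v≋w = sum-cong-≋ (λ j → *-congˡ (v≋w j))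

  -- Gaussian elimination, by induction on n. If all first coordinates vanish, that coordinate is
  -- dropped. Otherwise multiples of a pivot vector clear the first coordinate of the others, and
  -- pivot and coordinate are dropped together.
  independent⇒≤ : ∀ {n m} (v : Vector (Vector Carrier n) m) → LinearlyIndependent v → m ℕ.≤ n
  independent⇒≤ {n} {ℕ.zero} v ind = z≤n
  independent⇒≤ {ℕ.zero} {ℕ.suc m} v ind = ⊥-elim (0≉1 (sym (ind (λ _ → 1#) (λ ()) zero)))
  independent⇒≤ {ℕ.suc n} {ℕ.suc m} v ind with em {P = ∃[ i ] (¬ v i zero ≈ 0#)}
  ... | no all≈0 = ℕₚ.m≤n⇒m≤1+n (independent⇒≤ (λ i → v i ∘ suc) λ a eq → ind a λ
    { zero → sum-≈0 (λ i → trans (*-congˡ (v₀≈0 i)) (zeroʳ (a i)))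
    ; (suc j) → eq j })
    where
    v₀≈0 : ∀ i → v i zero ≈ 0#
    v₀≈0 i with decidable-≈ (v i zero) 0#
    ... | yes p = p
    ... | no ¬p = ⊥-elim (all≈0 (i , ¬p))
  ... | yes (i , vᵢ₀≉0) = s≤s (independent⇒≤ (λ j → w j ∘ suc) ind′)
    where
    t = proj₁ (inverse (v i zero) vᵢ₀≉0)
    rest : Vector (Vector Carrier (ℕ.suc n)) m
    rest j = v (punchIn i j)
    s : Vector Carrier m
    s j = - (rest j zero * t)
    w : Vector (Vector Carrier (ℕ.suc n)) m
    w j c = rest j c + s j * v i c
    w₀≈0 : ∀ j → w j zero ≈ 0#
    w₀≈0 j = begin
      rest j zero + - (rest j zero * t) * v i zero   ≈⟨ solve 3 (λ a t b → a :+ (:- (a :* t)) :* b := a :- a :* (b :* t)) refl (rest j zero) t (v i zero) ⟩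
      rest j zero - rest j zero * (v i zero * t)     ≈⟨ +-congˡ (-‿cong (*-congˡ (proj₂ (inverse (v i zero) vᵢ₀≉0)))) ⟩
      rest j zero - rest j zero * 1#                 ≈⟨ +-congˡ (-‿cong (*-identityʳ _)) ⟩
      rest j zero - rest j zero                      ≈⟨ -‿inverseʳ _ ⟩
      0#                                             ∎
    module _ (b : Vector Carrier m) where
      a : Vector Carrier (ℕ.suc m)
      -- A combination of the cleared vectors `w` is one of the original `v` in which the pivot
      -- collects all the multiples that were added.
      a = insertAt b i (∑[ j < m ] (b j * s j))
      a∘punchIn : ∀ j → a (punchIn i j) ≡ b j
      a∘punchIn j = Vector.insertAt-punchIn b i _ j
      expand : ∀ c → lincomb a v c ≈ lincomb b w c
      expand c = begin
        lincomb a v c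
          ≈⟨ sum-remove {i = i} (λ j → a j * v j c) ⟩
        a i * v i c + ∑[ j < m ] (a (punchIn i j) * rest j c)
          ≈⟨ +-cong (*-congʳ (reflexive (Vector.insertAt-lookup b i _))) (sum-cong-≋ (λ j → *-congʳ (reflexive (a∘punchIn j)))) ⟩
        ∑[ j < m ] (b j * s j) * v i c + ∑[ j < m ] (b j * rest j c)
          ≈⟨ +-congʳ (*-distribʳ-sum (v i c) (λ j → b j * s j)) ⟩
        ∑[ j < m ] (b j * s j * v i c) + ∑[ j < m ] (b j * rest j c)
          ≈⟨ sym (∑-distrib-+ (λ j → b j * s j * v i c) (λ j → b j * rest j c)) ⟩
        ∑[ j < m ] (b j * s j * v i c + b j * rest j c)
          ≈⟨ sum-cong-≋ (λ j → solve 4 (λ b s x y → b :* s :* x :+ b :* y := b :* (y :+ s :* x)) refl (b j) (s j) (v i c) (rest j c)) ⟩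
        lincomb b w c ∎
    ind′ : LinearlyIndependent (λ j → w j ∘ suc)
    ind′ b eq j = trans (reflexive (≡.sym (a∘punchIn b j))) (ind (a b) vanish (punchIn i j))
      where
      vanish : lincomb (a b) v ≋ 0ᵛ
      vanish zero = trans (expand b zero) (sum-≈0 (λ j → trans (*-congˡ (w₀≈0 j)) (zeroʳ (b j))))
      vanish (suc c) = trans (expand b (suc c)) (eq c)

  independent-∷ᵛ : ∀ {n d} {w : Vector Carrier n} {v : Vector (Vector Carrier n) d} →
                  LinearlyIndependent v → ¬ InSpan v w → LinearlyIndependent (w ∷ᵛ v)
  independent-∷ᵛ {n} {d} {w} {v} ind w∉ a eq with decidable-≈ (a zero) 0#
  ... | yes a₀≈0 = λ
    { zero → a₀≈0
    ; (suc i) → ind (a ∘ suc) (λ j → trans (sym (trans (+-congʳ (trans (*-congʳ a₀≈0) (zeroˡ (w j)))) (+-identityˡ _))) (eq j)) i }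
  ... | no a₀≉0 = ⊥-elim (w∉ ((λ i → - t * a (suc i)) , λ j → begin
      w j                                               ≈⟨ sym (*-identityˡ (w j)) ⟩
      1# * w j                                          ≈⟨ *-congʳ (sym a₀t≈1) ⟩
      a₀ * t * w j                                      ≈⟨ solve 4 (λ a t w r → a :* t :* w := t :* (a :* w :+ r) :+ (:- t) :* r) refl a₀ t (w j) (rest j) ⟩
      t * (a₀ * w j + rest j) + - t * rest j            ≈⟨ +-cong (trans (*-congˡ (eq j)) (zeroʳ t)) (*-distribˡ-sum (- t) (λ i → a (suc i) * v i j)) ⟩
      0# + ∑[ i < d ] (- t * (a (suc i) * v i j))       ≈⟨ +-identityˡ _ ⟩
      ∑[ i < d ] (- t * (a (suc i) * v i j))            ≈⟨ sum-cong-≋ (λ i → sym (*-assoc (- t) (a (suc i)) (v i j))) ⟩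
      lincomb (λ i → - t * a (suc i)) v j               ∎))
    where
    a₀ = a zero
    t = proj₁ (inverse a₀ a₀≉0)
    a₀t≈1 = proj₂ (inverse a₀ a₀≉0)
    rest : Vector Carrier n
    rest = lincomb (a ∘ suc) v

  -- The functional f kills the whole span of `v`, so a vector on which it is nonzero lies outside.
  -- Codimension bounds are obtained by using the forms of the arrangement as f.
  independent-∷ᵛ-· : ∀ {n d} (f : Vector Carrier n) {w} {v : Vector (Vector Carrier n) d} →
                    LinearlyIndependent v → (∀ i → f · v i ≈ 0#) → ¬ f · w ≈ 0# → LinearlyIndependent (w ∷ᵛ v)
  independent-∷ᵛ-· f {w} {v} ind fv≈0 fw≉0 = independent-∷ᵛ ind λ (a , w≋) → fw≉0 (begin
    f · w                              ≈⟨ ·-congˡ f w≋ ⟩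
    f · lincomb a v                    ≈⟨ ·-lincomb f a v ⟩
    sum (λ i → a i * (f · v i))        ≈⟨ sum-≈0 (λ i → trans (*-congˡ (fv≈0 i)) (zeroʳ (a i))) ⟩
    0#                                 ∎)

  module _ {n p} (W : Pred (Vector Carrier n) p) where

    -- The fuel bounds n - m, the number of vectors that can still be added; running out of it
    -- contradicts `independent⇒≤`.
    extendToBasis : ∀ fuel {m} (v : Vector (Vector Carrier n) m) → (∀ i → W (v i)) → LinearlyIndependent v →
                    n ℕ.≤ m ℕ.+ fuel → ∃[ d ] (HasDim W d × m ℕ.≤ d)
    extendToBasis fuel {m} v v∈W ind n≤ with em {P = ∃[ w ] (W w × ¬ InSpan v w)}
    ... | no maximal = m , (v , v∈W , ind , spans) , ℕₚ.≤-refl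
      where
      spans : ∀ w → W w → InSpan v w
      spans w w∈W with em {P = InSpan v w}
      ... | yes s = s
      ... | no ¬s = ⊥-elim (maximal (w , w∈W , ¬s))
    ... | yes (w , w∈W , w∉) = continue fuel n≤
      where
      ind′ : LinearlyIndependent (w ∷ᵛ v)
      ind′ = independent-∷ᵛ ind w∉
      continue : ∀ fuel → n ℕ.≤ m ℕ.+ fuel → ∃[ d ] (HasDim W d × m ℕ.≤ d)
      continue ℕ.zero n≤ = ⊥-elim (ℕₚ.<-irrefl ≡.refl
        (ℕₚ.≤-trans (independent⇒≤ (w ∷ᵛ v) ind′) (subst (n ℕ.≤_) (ℕₚ.+-identityʳ m) n≤)))
      continue (ℕ.suc fuel) n≤ =
        let (d , dim , m<d) = extendToBasis fuel (w ∷ᵛ v) (λ { zero → w∈W ; (suc i) → v∈W i }) ind′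
                                (subst (n ℕ.≤_) (ℕₚ.+-suc m fuel) n≤)
        in d , dim , ℕₚ.<⇒≤ m<d

    independent⇒Dim≥ : ∀ {m} (v : Vector (Vector Carrier n) m) → (∀ i → W (v i)) → LinearlyIndependent v → Dim≥ W m
    independent⇒Dim≥ {m} v v∈W ind = extendToBasis n v v∈W ind (ℕₚ.m≤n+m n m)

  -- `Dim≥` asserts that a basis exists, so one must be produced for `W′`: a basis of `W` is an
  -- independent family in `W′` and extends.
  Dim≥-mono : ∀ {n p q} {W : Pred (Vector Carrier n) p} {W′ : Pred (Vector Carrier n) q} →
              (∀ {w} → W w → W′ w) → ∀ {m} → Dim≥ W m → Dim≥ W′ m
  Dim≥-mono W⊆W′ (d , (v , v∈W , ind , _) , m≤d) =
    let (d′ , dim , d≤d′) = independent⇒Dim≥ _ v (W⊆W′ ∘ v∈W) ind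
    in d′ , dim , ℕₚ.≤-trans m≤d d≤d′

  δ : ∀ {n} → Fin n → Fin n → Carrier
  δ i j with i Fin.≟ j
  ... | yes _ = 1#
  ... | no  _ = 0#

  δ-refl : ∀ {n} (i : Fin n) → δ i i ≈ 1#
  δ-refl i with i Fin.≟ i
  ... | yes _ = refl
  ... | no i≢i = contradiction ≡.refl i≢i

  δ-≢ : ∀ {n} {i j : Fin n} → i ≢ j → δ i j ≈ 0#
  δ-≢ {i = i} {j} i≢j with i Fin.≟ j
  ... | yes i≡j = contradiction i≡j i≢j
  ... | no  _   = refl

  sum-δ : ∀ {n} (f : Vector Carrier n) j → ∑[ i < n ] (f i * δ i j) ≈ f j
  sum-δ {ℕ.suc n} f j = begin
    ∑[ i < ℕ.suc n ] (f i * δ i j)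
      ≈⟨ sum-remove {i = j} (λ i → f i * δ i j) ⟩
    f j * δ j j + ∑[ i < n ] (f (punchIn j i) * δ (punchIn j i) j)
      ≈⟨ +-cong (trans (*-congˡ (δ-refl j)) (*-identityʳ (f j)))
                (sum-≈0 (λ i → trans (*-congˡ (δ-≢ (Fin.punchInᵢ≢i j i))) (zeroʳ _))) ⟩
    f j + 0#  ≈⟨ +-identityʳ (f j) ⟩
    f j       ∎

  -- A relation between the coordinate vectors of the `δ i` with respect to `v` is also a relation
  -- between the `δ i` themselves. These coordinate vectors are therefore n independent vectors in
  -- dimension p.
  spanning⇒≤ : ∀ {n p} (v : Vector (Vector Carrier n) p) → (∀ w → InSpan v w) → n ℕ.≤ p
  spanning⇒≤ v spans = independent⇒≤ (λ i → proj₁ (spans (δ i))) λ a eq j → begin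
    a j                                                ≈⟨ sym (sum-δ a j) ⟩
    lincomb a δ j                                      ≈⟨ sum-cong-≋ (λ i → *-congˡ (proj₂ (spans (δ i)) j)) ⟩
    lincomb a (λ i → lincomb (proj₁ (spans (δ i))) v) j ≈⟨ lincomb-∘ a _ v j ⟩
    lincomb (lincomb a (λ i → proj₁ (spans (δ i)))) v j ≈⟨ sum-≈0 (λ s → trans (*-congʳ (eq s)) (zeroˡ _)) ⟩
    0#                                                 ∎

-- Subsets of `Fin n`: listings, triples and cardinalities

members : ∀ {n} → Subset n → List (Fin n)
members C = List.filter (_∈? C) (List.allFin _)

∈-members⁻ : ∀ {n} {C : Subset n} {i} → i List.∈ members C → i ∈ C
∈-members⁻ {C = C} = proj₂ ∘ List.∈-filter⁻ (_∈? C) {xs = List.allFin _}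

members-unique : ∀ {n} (C : Subset n) → Unique (members C)
members-unique C = Unique.filter⁺ (_∈? C) (Unique.allFin⁺ _)

-- `tabulate` recurses by composing f with `suc`, so the induction fixes C, varies f and records the
-- preimage of C under f as D.
length-filter-tabulate : ∀ {m n} (f : Fin m → Fin n) (C : Subset n) (D : Subset m) →
  (∀ x → f x ∈ C → x ∈ D) → (∀ x → x ∈ D → f x ∈ C) →
  length (List.filter (_∈? C) (List.tabulate f)) ≡ ∣ D ∣
length-filter-tabulate f C [] to from = ≡.refl
length-filter-tabulate f C (inside ∷ D) to from = ≡.trans
  (≡.cong length (List.filter-accept (_∈? C) (from zero here)))
  (≡.cong ℕ.suc (length-filter-tabulate (f ∘ suc) C D (λ x → drop-there ∘ to (suc x)) (λ x → from (suc x) ∘ there)))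
length-filter-tabulate f C (outside ∷ D) to from = ≡.trans
  (≡.cong length (List.filter-reject (_∈? C) (λ h → contradiction (to zero h) λ ())))
  (length-filter-tabulate (f ∘ suc) C D (λ x → drop-there ∘ to (suc x)) (λ x → from (suc x) ∘ there))

length-members : ∀ {n} (C : Subset n) → length (members C) ≡ ∣ C ∣
length-members C = length-filter-tabulate id C C (λ _ → id) (λ _ → id)

∣p∪q∣≤∣p∣+∣q∣ : ∀ {n} (p q : Subset n) → ∣ p ∪ q ∣ ℕ.≤ ∣ p ∣ ℕ.+ ∣ q ∣
∣p∪q∣≤∣p∣+∣q∣ [] [] = z≤n
∣p∪q∣≤∣p∣+∣q∣ (outside ∷ p) (outside ∷ q) = ∣p∪q∣≤∣p∣+∣q∣ p q
∣p∪q∣≤∣p∣+∣q∣ (outside ∷ p) (inside ∷ q) =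
  subst (ℕ.suc ∣ p ∪ q ∣ ℕ.≤_) (≡.sym (ℕₚ.+-suc ∣ p ∣ ∣ q ∣)) (s≤s (∣p∪q∣≤∣p∣+∣q∣ p q))
∣p∪q∣≤∣p∣+∣q∣ (inside ∷ p) (outside ∷ q) = s≤s (∣p∪q∣≤∣p∣+∣q∣ p q)
∣p∪q∣≤∣p∣+∣q∣ (inside ∷ p) (inside ∷ q) =
  s≤s (ℕₚ.≤-trans (∣p∪q∣≤∣p∣+∣q∣ p q) (ℕₚ.+-monoʳ-≤ ∣ p ∣ (ℕₚ.n≤1+n ∣ q ∣)))

triple : ∀ {n} → Fin n → Fin n → Fin n → Subset n
triple i j m = ⁅ i ⁆ ∪ (⁅ j ⁆ ∪ ⁅ m ⁆)

∈-triple⁻ : ∀ {n} {i j m x : Fin n} → x ∈ triple i j m → x ≡ i ⊎ x ≡ j ⊎ x ≡ m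
∈-triple⁻ {i = i} {j} {m} x∈ with x∈p∪q⁻ ⁅ i ⁆ (⁅ j ⁆ ∪ ⁅ m ⁆) x∈
... | inj₁ h = inj₁ (x∈⁅y⁆⇒x≡y i h)
... | inj₂ h with x∈p∪q⁻ ⁅ j ⁆ ⁅ m ⁆ h
...   | inj₁ h′ = inj₂ (inj₁ (x∈⁅y⁆⇒x≡y j h′))
...   | inj₂ h′ = inj₂ (inj₂ (x∈⁅y⁆⇒x≡y m h′))

∈-triple₁ : ∀ {n} (i j m : Fin n) → i ∈ triple i j m
∈-triple₁ i j m = x∈p∪q⁺ (inj₁ (x∈⁅x⁆ i))

∈-triple₂ : ∀ {n} (i j m : Fin n) → j ∈ triple i j m
∈-triple₂ i j m = x∈p∪q⁺ (inj₂ (x∈p∪q⁺ (inj₁ (x∈⁅x⁆ j))))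

∈-triple₃ : ∀ {n} (i j m : Fin n) → m ∈ triple i j m
∈-triple₃ i j m = x∈p∪q⁺ (inj₂ (x∈p∪q⁺ {p = ⁅ j ⁆} (inj₂ (x∈⁅x⁆ m))))

∈⇒1≤∣p∣ : ∀ {n} {i : Fin n} {p} → i ∈ p → 1 ℕ.≤ ∣ p ∣
∈⇒1≤∣p∣ i∈p = ℕₚ.≤-trans (s≤s z≤n) (x∈p⇒∣p-x∣<∣p∣ i∈p)

distinct⇒2≤∣p∣ : ∀ {n} {i j : Fin n} {p} → i ≢ j → i ∈ p → j ∈ p → 2 ℕ.≤ ∣ p ∣
distinct⇒2≤∣p∣ i≢j i∈p j∈p =
  ℕₚ.≤-trans (s≤s (∈⇒1≤∣p∣ (x∈p∧x≢y⇒x∈p-y i∈p i≢j))) (x∈p⇒∣p-x∣<∣p∣ j∈p)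

distinct⇒3≤∣p∣ : ∀ {n} {i j m : Fin n} {p} → i ≢ j → i ≢ m → j ≢ m → i ∈ p → j ∈ p → m ∈ p → 3 ℕ.≤ ∣ p ∣
distinct⇒3≤∣p∣ i≢j i≢m j≢m i∈p j∈p m∈p = ℕₚ.≤-trans
  (s≤s (distinct⇒2≤∣p∣ i≢j (x∈p∧x≢y⇒x∈p-y i∈p i≢m) (x∈p∧x≢y⇒x∈p-y j∈p j≢m)))
  (x∈p⇒∣p-x∣<∣p∣ m∈p)

∣triple∣≡3 : ∀ {n} {i j m : Fin n} → i ≢ j → i ≢ m → j ≢ m → ∣ triple i j m ∣ ≡ 3
∣triple∣≡3 {i = i} {j} {m} i≢j i≢m j≢m = ℕₚ.≤-antisym
  (ℕₚ.≤-trans (∣p∪q∣≤∣p∣+∣q∣ ⁅ i ⁆ (⁅ j ⁆ ∪ ⁅ m ⁆))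
    (ℕₚ.+-mono-≤ (ℕₚ.≤-reflexive (∣⁅x⁆∣≡1 i))
      (ℕₚ.≤-trans (∣p∪q∣≤∣p∣+∣q∣ ⁅ j ⁆ ⁅ m ⁆)
        (ℕₚ.+-mono-≤ (ℕₚ.≤-reflexive (∣⁅x⁆∣≡1 j)) (ℕₚ.≤-reflexive (∣⁅x⁆∣≡1 m))))))
  (distinct⇒3≤∣p∣ i≢j i≢m j≢m (∈-triple₁ i j m) (∈-triple₂ i j m) (∈-triple₃ i j m))

module _ {n p} {P : Fin n → Set p} (P? : ∀ i → Dec (P i)) where

  ⟪_⟫ : Subset n
  ⟪_⟫ = Vec.tabulate (does ∘ P?)

  ∈-⟪⟫⁺ : ∀ {i} → P i → i ∈ ⟪_⟫
  ∈-⟪⟫⁺ {i} Pi = Vec.lookup⇒[]= i ⟪_⟫ (≡.trans (Vec.lookup∘tabulate (does ∘ P?) i) (dec-true (P? i) Pi))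

  ∈-⟪⟫⁻ : ∀ {i} → i ∈ ⟪_⟫ → P i
  ∈-⟪⟫⁻ {i} i∈ with P? i | ≡.trans (≡.sym (Vec.lookup∘tabulate (does ∘ P?) i)) (Vec.[]=⇒lookup i∈)
  ... | yes Pi | _ = Pi

-- Small circuits and collinearity, from codimensions

module Matroid (em : ∀ {a} → ExcludedMiddle a) {f ℓf} (F : Field f ℓf) {n l}
  (𝒜 : CentralArrangement (Field.commutativeRing F) n l) where
  open Field F hiding (zero)
  open Linear commutativeRing
  open SemiringSum semiring using (sum; sum-syntax; sum-cong-≋; ∑-distrib-+; *-distribˡ-sum)
  open RingProperties ring using (x∙y⁻¹≈ε⇒x≈y)
  open RingSolver commutativeRing
  open LinearAlgebra em F
  open CentralArrangement 𝒜
  open import Relation.Binary.Reasoning.Setoid setoid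

  ·-combination : ∀ {d} (g : Vector Carrier d) a x b y →
                  g · (λ c → a * x c + b * y c) ≈ a * (g · x) + b * (g · y)
  ·-combination {d} g a x b y = begin
    ∑[ c < d ] (g c * (a * x c + b * y c))
      ≈⟨ sum-cong-≋ (λ c → solve 5 (λ g a x b y → g :* (a :* x :+ b :* y) := a :* (g :* x) :+ b :* (g :* y)) refl (g c) a (x c) b (y c)) ⟩
    ∑[ c < d ] (a * (g c * x c) + b * (g c * y c))
      ≈⟨ ∑-distrib-+ (λ c → a * (g c * x c)) (λ c → b * (g c * y c)) ⟩
    ∑[ c < d ] (a * (g c * x c)) + ∑[ c < d ] (b * (g c * y c))
      ≈⟨ sym (+-cong (*-distribˡ-sum a (λ c → g c * x c)) (*-distribˡ-sum b (λ c → g c * y c))) ⟩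
    a * (g · x) + b * (g · y) ∎

  -- Another form h takes on this vector the value of the 2 × 2 determinant of g and h on x and y.
  -- Proportionality of two forms is thus read off without division, as in `cross`.
  eliminate : ∀ {d} → Vector Carrier d → Vector Carrier d → Vector Carrier d → Vector Carrier d
  eliminate g x y c = (g · x) * y c + - (g · y) * x c

  ·-eliminate : ∀ {d} (g : Vector Carrier d) x y → g · eliminate g x y ≈ 0#
  ·-eliminate g x y = trans (·-combination g (g · x) y (- (g · y)) x)
    (solve 2 (λ a b → a :* b :+ (:- b) :* a := con (0 , 0)) refl (g · x) (g · y))

  ·-eliminate-≈0 : ∀ {d} (g h : Vector Carrier d) {x y} → h · x ≈ 0# → h · y ≈ 0# → h · eliminate g x y ≈ 0#
  ·-eliminate-≈0 g h {x} {y} hx≈0 hy≈0 = begin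
    h · eliminate g x y                        ≈⟨ ·-combination h (g · x) y (- (g · y)) x ⟩
    (g · x) * (h · y) + - (g · y) * (h · x)    ≈⟨ +-cong (trans (*-congˡ hy≈0) (zeroʳ _)) (trans (*-congˡ hx≈0) (zeroʳ _)) ⟩
    0# + 0#                                    ≈⟨ +-identityʳ 0# ⟩
    0#                                         ∎

  cross : ∀ {d} (g h : Vector Carrier d) x y → h · eliminate g x y ≈ 0# → (g · x) * (h · y) ≈ (g · y) * (h · x)
  cross g h x y eq = x∙y⁻¹≈ε⇒x≈y _ _ (begin
    (g · x) * (h · y) - (g · y) * (h · x)      ≈⟨ solve 4 (λ a b c d → a :* b :- c :* d := a :* b :+ (:- c) :* d) refl (g · x) (h · y) (g · y) (h · x) ⟩
    (g · x) * (h · y) + - (g · y) * (h · x)    ≈⟨ sym (·-combination h (g · x) y (- (g · y)) x) ⟩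
    h · eliminate g x y                        ≈⟨ eq ⟩
    0#                                         ∎)

  ≉⇒∃ : ∀ {a p} {A : Set a} {P : Pred A p} → ¬ (∀ x → P x) → ∃[ x ] ¬ P x
  ≉⇒∃ {P = P} ¬all with em {P = ∃[ x ] ¬ P x}
  ... | yes h = h
  ... | no ¬h = ⊥-elim (¬all all)
    where
    all : ∀ x → P x
    all x with em {P = P x}
    ... | yes Px = Px
    ... | no ¬Px = ⊥-elim (¬h (x , ¬Px))

  ⊈⇒∃ : ∀ {a p q} {A : Set a} {P : Pred A p} {Q : Pred A q} → ¬ P ⊆ Q → ∃[ x ] (P x × ¬ Q x)
  ⊈⇒∃ {P = P} {Q} ¬⊆ with ≉⇒∃ {P = λ x → P x → Q x} (λ h → ¬⊆ λ {x} → h x)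
  ... | x , ¬PQ with em {P = P x}
  ...   | yes Px = x , Px , λ Qx → ¬PQ λ _ → Qx
  ...   | no ¬Px = ⊥-elim (¬PQ λ Px → contradiction Px ¬Px)

  H-proper : ∀ i → ∃[ x ] ¬ H i x
  H-proper i with ≉⇒∃ (form≉0 i)
  ... | j , fᵢⱼ≉0 = (λ c → δ c j) , λ h → fᵢⱼ≉0 (trans (sym (sum-δ (form i) j)) h)

  -- For z outside `H j`, the inclusion makes the form of i, scaled by `form j · z`, equal to the
  -- form of j, scaled by `form i · z`. Hence `H j` lies in `H i` too, against `distinct`.
  H⊆⇒≡ : ∀ {i j} → H i ⊆ H j → i ≡ j
  H⊆⇒≡ {i} {j} Hᵢ⊆Hⱼ with i Fin.≟ j
  ... | yes i≡j = i≡j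
  ... | no i≢j = ⊥-elim (distinct i≢j (Hᵢ⊆Hⱼ , λ {y} fⱼy≈0 → *-cancelˡ-≈0 fⱼz≉0 (begin
      (form j · z) * (form i · y)    ≈⟨ *-comm _ _ ⟩
      (form i · y) * (form j · z)    ≈⟨ cross (form i) (form j) y z (Hᵢ⊆Hⱼ (·-eliminate (form i) y z)) ⟩
      (form i · z) * (form j · y)    ≈⟨ *-congˡ fⱼy≈0 ⟩
      (form i · z) * 0#              ≈⟨ zeroʳ _ ⟩
      0#                             ∎)))
    where
    z = proj₁ (H-proper j)
    fⱼz≉0 = proj₂ (H-proper j)

  ≢⇒∃ : ∀ {i j} → i ≢ j → ∃[ x ] (H i x × ¬ H j x)
  ≢⇒∃ i≢j = ⊈⇒∃ (i≢j ∘ H⊆⇒≡)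

  -- On `H i` the form of m is a multiple of the form of j; this is `relate`, with x a point of
  -- `H i` outside `H j`. The factor is nonzero, since otherwise `H i` would lie in `H m`.
  exchange : ∀ {i j m} → i ≢ j → i ≢ m → H i ∩ H j ⊆ H m → H i ∩ H m ⊆ H j
  exchange {i} {j} {m} i≢j i≢m Hᵢⱼ⊆Hₘ {y} (fᵢy≈0 , fₘy≈0) = *-cancelˡ-≈0 fₘx≉0 (begin
    (form m · x) * (form j · y)    ≈⟨ *-comm _ _ ⟩
    (form j · y) * (form m · x)    ≈⟨ sym (relate fᵢy≈0) ⟩
    (form j · x) * (form m · y)    ≈⟨ *-congˡ fₘy≈0 ⟩
    (form j · x) * 0#              ≈⟨ zeroʳ _ ⟩
    0#                             ∎)
    where
    x = proj₁ (≢⇒∃ i≢j)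
    fᵢx≈0 = proj₁ (proj₂ (≢⇒∃ i≢j))
    fⱼx≉0 = proj₂ (proj₂ (≢⇒∃ i≢j))
    relate : ∀ {w} → H i w → (form j · x) * (form m · w) ≈ (form j · w) * (form m · x)
    relate {w} fᵢw≈0 = cross (form j) (form m) x w
      (Hᵢⱼ⊆Hₘ (·-eliminate-≈0 (form j) (form i) fᵢx≈0 fᵢw≈0 , ·-eliminate (form j) x w))
    fₘx≉0 : ¬ H m x
    fₘx≉0 fₘx≈0 = i≢m (H⊆⇒≡ λ {w} fᵢw≈0 → *-cancelˡ-≈0 fⱼx≉0
      (trans (relate fᵢw≈0) (trans (*-congˡ fₘx≈0) (zeroʳ _))))

  codim-bound : ∀ {d k r} → r ℕ.+ d ℕ.≤ l → d ℕ.+ k ≡ l → r ℕ.≤ k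
  codim-bound {d} {k} {r} r+d≤l d+k≡l = ℕₚ.+-cancelˡ-≤ d r k
    (subst (ℕ._≤ d ℕ.+ k) (ℕₚ.+-comm r d) (subst (r ℕ.+ d ℕ.≤_) (≡.sym d+k≡l) r+d≤l))

  -- Here and in the next two bounds, vectors are put in front of a basis of the intersection so
  -- that each is separated from all later ones by the form of some member of C. With r such vectors
  -- the codimension is at least r.
  codim≥1 : ∀ {C k i} → i ∈ C → HasCodim (⋂H C) k → 1 ℕ.≤ k
  codim≥1 {i = i} i∈C (d , (v , v∈ , ind , _) , d+k≡l) with H-proper i
  ... | z , z∉Hᵢ = codim-bound (independent⇒≤ (z ∷ᵛ v)
    (independent-∷ᵛ-· (form i) ind (λ s → v∈ s i i∈C) z∉Hᵢ)) d+k≡l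

  codim≥2 : ∀ {C k i j} → i ≢ j → i ∈ C → j ∈ C → HasCodim (⋂H C) k → 2 ℕ.≤ k
  codim≥2 {i = i} {j} i≢j i∈C j∈C (d , (v , v∈ , ind , _) , d+k≡l) with H-proper i | ≢⇒∃ i≢j
  ... | z , z∉Hᵢ | y , y∈Hᵢ , y∉Hⱼ = codim-bound (independent⇒≤ (z ∷ᵛ y ∷ᵛ v)
    (independent-∷ᵛ-· (form i) {v = y ∷ᵛ v}
      (independent-∷ᵛ-· (form j) ind (λ s → v∈ s j j∈C) y∉Hⱼ)
      (λ { zero → y∈Hᵢ ; (suc s) → v∈ s i i∈C }) z∉Hᵢ)) d+k≡l

  codim≥3 : ∀ {C k i j m} → i ≢ j → ¬ (H i ∩ H j ⊆ H m) → i ∈ C → j ∈ C → m ∈ C → HasCodim (⋂H C) k → 3 ℕ.≤ k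
  codim≥3 {i = i} {j} {m} i≢j ⊈ i∈C j∈C m∈C (d , (v , v∈ , ind , _) , d+k≡l) with H-proper i | ≢⇒∃ i≢j | ⊈⇒∃ ⊈
  ... | z , z∉Hᵢ | y , y∈Hᵢ , y∉Hⱼ | x , (x∈Hᵢ , x∈Hⱼ) , x∉Hₘ = codim-bound (independent⇒≤ (z ∷ᵛ y ∷ᵛ x ∷ᵛ v)
    (independent-∷ᵛ-· (form i) {v = y ∷ᵛ x ∷ᵛ v}
      (independent-∷ᵛ-· (form j) {v = x ∷ᵛ v}
        (independent-∷ᵛ-· (form m) ind (λ s → v∈ s m m∈C) x∉Hₘ)
        (λ { zero → x∈Hⱼ ; (suc s) → v∈ s j j∈C }) y∉Hⱼ)
      (λ { zero → y∈Hᵢ ; (suc zero) → x∈Hᵢ ; (suc (suc s)) → v∈ s i i∈C }) z∉Hᵢ)) d+k≡l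

  -- The codimension is at most two. Up to nonzero factors, a multiple of z corrects any vector to
  -- one in `H i`, and then a multiple of y corrects it to one in `H i ∩ H j`, which lies in `⋂H C`.
  -- So z, y and a basis of `⋂H C` span the space.
  collinear⇒Dependent : ∀ {C i j} → i ≢ j → (∀ m → m ∈ C → H i ∩ H j ⊆ H m) → 3 ℕ.≤ ∣ C ∣ → Dependent C
  collinear⇒Dependent {C} {i} {j} i≢j Hᵢⱼ⊆ 3≤∣C∣ with H-proper i | ≢⇒∃ i≢j | independent⇒Dim≥ (⋂H C) []ᵛ (λ ()) (λ _ _ ())
  ... | z , z∉Hᵢ | y , y∈Hᵢ , y∉Hⱼ | d , (v , v∈ , ind , spans) , _ =
    l ℕ.∸ d , (d , (v , v∈ , ind , spans) , ℕₚ.m+[n∸m]≡n (independent⇒≤ v ind)) ,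
    ℕₚ.≤-trans (s≤s (ℕₚ.m≤n+o⇒m∸n≤o l d l≤d+2)) 3≤∣C∣
    where
    s = proj₁ (inverse (form i · z) z∉Hᵢ)
    t = proj₁ (inverse (form j · y) y∉Hⱼ)
    span : ∀ w → InSpan (z ∷ᵛ y ∷ᵛ v) w
    -- The coefficients come from w = s ((f_i · w) z + w₁) and w₁ = t ((f_j · w₁) y + w₂), where s
    -- and t invert f_i · z and f_j · y.
    span w = (s * (form i · w)) ∷ᵛ (s * (t * (form j · w₁))) ∷ᵛ (λ e → s * (t * a e)) , λ c → begin
      w c
        ≈⟨ cancel (proj₂ (inverse (form i · z) z∉Hᵢ)) ⟩
      s * ((form i · z) * w c)
        ≈⟨ *-congˡ (solve 3 (λ α β γ → α := β :* γ :+ (α :+ (:- β) :* γ)) refl _ (form i · w) (z c)) ⟩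
      s * ((form i · w) * z c + w₁ c)
        ≈⟨ *-congˡ (+-congˡ (cancel (proj₂ (inverse (form j · y) y∉Hⱼ)))) ⟩
      s * ((form i · w) * z c + t * ((form j · y) * w₁ c))
        ≈⟨ *-congˡ (+-congˡ (*-congˡ (solve 3 (λ α β γ → α := β :* γ :+ (α :+ (:- β) :* γ)) refl _ (form j · w₁) (y c)))) ⟩
      s * ((form i · w) * z c + t * ((form j · w₁) * y c + w₂ c))
        ≈⟨ *-congˡ (+-congˡ (*-congˡ (+-congˡ (w₂≋ c)))) ⟩
      s * ((form i · w) * z c + t * ((form j · w₁) * y c + lincomb a v c))
        ≈⟨ solve 7 (λ s t α β γ ε r → s :* (α :* γ :+ t :* (β :* ε :+ r)) := (s :* α) :* γ :+ ((s :* (t :* β)) :* ε :+ s :* t :* r))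
             refl s t (form i · w) (form j · w₁) (z c) (y c) (lincomb a v c) ⟩
      s * (form i · w) * z c + (s * (t * (form j · w₁)) * y c + s * t * lincomb a v c)
        ≈⟨ +-congˡ (+-congˡ (*-distribˡ-sum (s * t) (λ e → a e * v e c))) ⟩
      s * (form i · w) * z c + (s * (t * (form j · w₁)) * y c + sum (λ e → s * t * (a e * v e c)))
        ≈⟨ +-congˡ (+-congˡ (sum-cong-≋ (λ e → solve 4 (λ s t a v → s :* t :* (a :* v) := s :* (t :* a) :* v) refl s t (a e) (v e c)))) ⟩
      s * (form i · w) * z c + (s * (t * (form j · w₁)) * y c + sum (λ e → s * (t * a e) * v e c)) ∎
      where
      w₁ w₂ : Vector Carrier l
      w₁ = eliminate (form i) z w
      w₂ = eliminate (form j) y w₁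
      w₁∈Hᵢ : H i w₁
      w₁∈Hᵢ = ·-eliminate (form i) z w
      w₂∈ : ⋂H C w₂
      w₂∈ m m∈C = Hᵢⱼ⊆ m m∈C (·-eliminate-≈0 (form j) (form i) y∈Hᵢ w₁∈Hᵢ , ·-eliminate (form j) y w₁)
      a = proj₁ (spans w₂ w₂∈)
      w₂≋ = proj₂ (spans w₂ w₂∈)
      cancel : ∀ {p q r} → p * q ≈ 1# → r ≈ q * (p * r)
      cancel {p} {q} {r} pq≈1 = begin
        r            ≈⟨ sym (*-identityˡ r) ⟩
        1# * r       ≈⟨ *-congʳ (sym pq≈1) ⟩
        p * q * r    ≈⟨ solve 3 (λ p q r → p :* q :* r := q :* (p :* r)) refl p q r ⟩
        q * (p * r)  ∎
    l≤d+2 : l ℕ.≤ d ℕ.+ 2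
    l≤d+2 = subst (l ℕ.≤_) (ℕₚ.+-comm 2 d) (spanning⇒≤ (z ∷ᵛ y ∷ᵛ v) span)

  -- One nonzero form cuts out codimension one and two distinct hyperplanes codimension two, so
  -- smaller sets are not dependent.
  Dependent⇒3≤∣C∣ : ∀ {C} → Dependent C → 3 ℕ.≤ ∣ C ∣
  Dependent⇒3≤∣C∣ {C} (k , codim , k<∣C∣) = go (members C) ≡.refl (members-unique C)
    where
    too-small : ∀ {m} → ∣ C ∣ ≡ m → ¬ (m ℕ.≤ k)
    too-small ≡.refl = ℕₚ.<⇒≱ k<∣C∣
    go : ∀ L → members C ≡ L → Unique L → 3 ℕ.≤ ∣ C ∣
    card : ∀ {L} → members C ≡ L → ∣ C ∣ ≡ length L
    card eq = ≡.trans (≡.sym (length-members C)) (≡.cong length eq)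
    mem : ∀ {L i} → members C ≡ L → i List.∈ L → i ∈ C
    mem ≡.refl i∈ = ∈-members⁻ i∈
    go [] eq _ = ⊥-elim (too-small (card eq) z≤n)
    go (i ∷ []) eq _ = ⊥-elim (too-small (card eq) (codim≥1 (mem eq (here ≡.refl)) codim))
    go (i ∷ j ∷ []) eq ((i≢j ∷ _) ∷ _) =
      ⊥-elim (too-small (card eq) (codim≥2 i≢j (mem eq (here ≡.refl)) (mem eq (there (here ≡.refl))) codim))
    go (i ∷ j ∷ m ∷ L) eq _ = subst (3 ℕ.≤_) (≡.sym (card eq)) (s≤s (s≤s (s≤s z≤n)))

  Dependent⇒collinear : ∀ {C i j m} → Dependent C → ∣ C ∣ ≡ 3 → i ≢ j → i ∈ C → j ∈ C → m ∈ C → H i ∩ H j ⊆ H m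
  Dependent⇒collinear {i = i} {j} {m} (k , codim , k<∣C∣) ∣C∣≡3 i≢j i∈C j∈C m∈C with em {P = H i ∩ H j ⊆ H m}
  ... | yes h = h
  ... | no ¬h = ⊥-elim (ℕₚ.<⇒≱ (subst (k ℕ.<_) ∣C∣≡3 k<∣C∣) (codim≥3 i≢j ¬h i∈C j∈C m∈C codim))

  triple-Circuit : ∀ {i j m} → i ≢ j → i ≢ m → j ≢ m → H i ∩ H j ⊆ H m → Circuit (triple i j m)
  triple-Circuit {i} {j} {m} i≢j i≢m j≢m Hᵢⱼ⊆Hₘ =
      collinear⇒Dependent i≢j collinear (ℕₚ.≤-reflexive (≡.sym card))
    , λ D D⊂ dep → ℕₚ.<⇒≱ (subst (∣ D ∣ ℕ.<_) card (p⊂q⇒∣p∣<∣q∣ D⊂)) (Dependent⇒3≤∣C∣ dep)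
    where
    card = ∣triple∣≡3 i≢j i≢m j≢m
    collinear : ∀ x → x ∈ triple i j m → H i ∩ H j ⊆ H x
    collinear x x∈ with ∈-triple⁻ x∈
    ... | inj₁ ≡.refl = proj₁
    ... | inj₂ (inj₁ ≡.refl) = proj₂
    ... | inj₂ (inj₂ ≡.refl) = Hᵢⱼ⊆Hₘ

-- Two linear functionals f and g on the generators induce a ring homomorphism to the
-- exterior algebra on two generators; its components are deg₀, deg₁ f, deg₁ g and deg₂ f g.
module Evaluation {c ℓ} (R : CommutativeRing c ℓ) (n : ℕ) where
  open CommutativeRing R hiding (zero)
  open RingSolver R
  open Exterior R n hiding (distribˡ; distribʳ)

  deg₀ : Term → Carrier
  deg₀ (scalar a) = a
  deg₀ (e i)      = 0#
  deg₀ (x ⊕ y)    = deg₀ x + deg₀ y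
  deg₀ (x ⊗ y)    = deg₀ x * deg₀ y
  deg₀ (⊝ x)      = - deg₀ x

  deg₁ : Vector Carrier n → Term → Carrier
  deg₁ f (scalar a) = 0#
  deg₁ f (e i)      = f i
  deg₁ f (x ⊕ y)    = deg₁ f x + deg₁ f y
  deg₁ f (x ⊗ y)    = deg₀ x * deg₁ f y + deg₁ f x * deg₀ y
  deg₁ f (⊝ x)      = - deg₁ f x

  deg₂ : Vector Carrier n → Vector Carrier n → Term → Carrier
  deg₂ f g (scalar a) = 0#
  deg₂ f g (e i)      = 0#
  deg₂ f g (x ⊕ y)    = deg₂ f g x + deg₂ f g y
  deg₂ f g (x ⊗ y)    = deg₀ x * deg₂ f g y + (deg₁ f x * deg₁ g y - deg₁ g x * deg₁ f y) + deg₂ f g x * deg₀ y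
  deg₂ f g (⊝ x)      = - deg₂ f g x

  private
    ∑Λ : ∀ {m} → Vector Term m → Term
    ∑Λ = Vector.foldr _⊕_ (scalar 0#)

    ∑ : ∀ {m} → Vector Carrier m → Carrier
    ∑ = Vector.foldr _+_ 0#

  deg₀-∑-≈0 : ∀ {m} (t : Vector Term m) → (∀ i → deg₀ (t i) ≈ 0#) → deg₀ (∑Λ t) ≈ 0#
  deg₀-∑-≈0 {ℕ.zero}  t t≈0 = refl
  deg₀-∑-≈0 {ℕ.suc m} t t≈0 = trans (+-cong (t≈0 zero) (deg₀-∑-≈0 (t ∘ suc) (t≈0 ∘ suc))) (+-identityʳ 0#)

  deg₁-∑ : ∀ f {m} (t : Vector Term m) → deg₁ f (∑Λ t) ≈ ∑ (deg₁ f ∘ t)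
  deg₁-∑ f {ℕ.zero}  t = refl
  deg₁-∑ f {ℕ.suc m} t = +-congˡ (deg₁-∑ f (t ∘ suc))

  deg₁-∑-≈0 : ∀ f {m} (t : Vector Term m) → (∀ i → deg₁ f (t i) ≈ 0#) → deg₁ f (∑Λ t) ≈ 0#
  deg₁-∑-≈0 f {ℕ.zero}  t t≈0 = refl
  deg₁-∑-≈0 f {ℕ.suc m} t t≈0 = trans (+-cong (t≈0 zero) (deg₁-∑-≈0 f (t ∘ suc) (t≈0 ∘ suc))) (+-identityʳ 0#)

  deg₂-∑-≈0 : ∀ f g {m} (t : Vector Term m) → (∀ i → deg₂ f g (t i) ≈ 0#) → deg₂ f g (∑Λ t) ≈ 0#
  deg₂-∑-≈0 f g {ℕ.zero}  t t≈0 = refl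
  deg₂-∑-≈0 f g {ℕ.suc m} t t≈0 = trans (+-cong (t≈0 zero) (deg₂-∑-≈0 f g (t ∘ suc) (t≈0 ∘ suc))) (+-identityʳ 0#)

  deg₀-linear : ∀ ξ → deg₀ (linear ξ) ≈ 0#
  deg₀-linear ξ = deg₀-∑-≈0 (λ i → scalar (ξ i) ⊗ e i) (λ i → zeroʳ (ξ i))

  deg₁-linear : ∀ f ξ → deg₁ f (linear ξ) ≈ ∑ (λ i → ξ i * f i)
  deg₁-linear f ξ = trans (deg₁-∑ f (λ i → scalar (ξ i) ⊗ e i)) (go (λ i → solve 2 (λ a b → a :* b :+ con (0 , 0) :* con (0 , 0) := a :* b) refl (ξ i) (f i)))
    where
    go : ∀ {m} {u v : Vector Carrier m} → (∀ i → u i ≈ v i) → ∑ u ≈ ∑ v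
    go {ℕ.zero} h = refl
    go {ℕ.suc m} h = +-cong (h zero) (go (h ∘ suc))

  deg₂-linear-⊗ : ∀ f g ξ ζ → deg₂ f g (linear ξ ⊗ linear ζ) ≈
    deg₁ f (linear ξ) * deg₁ g (linear ζ) - deg₁ g (linear ξ) * deg₁ f (linear ζ)
  deg₂-linear-⊗ f g ξ ζ = trans
    (+-cong (+-congʳ (*-congʳ (deg₀-linear ξ))) (*-congˡ (deg₀-linear ζ)))
    (solve 4 (λ a b c d → con (0 , 0) :* a :+ (b :- c) :+ d :* con (0 , 0) := b :- c) refl
      (deg₂ f g (linear ζ)) (deg₁ f (linear ξ) * deg₁ g (linear ζ)) (deg₁ g (linear ξ) * deg₁ f (linear ζ)) (deg₂ f g (linear ξ)))

  deg₀-cong : ∀ {x y} → x ≈Λ y → deg₀ x ≈ deg₀ y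
  deg₀-cong ≈-refl            = refl
  deg₀-cong (≈-sym p)         = sym (deg₀-cong p)
  deg₀-cong (≈-trans p q)     = trans (deg₀-cong p) (deg₀-cong q)
  deg₀-cong (⊕-cong p q)      = +-cong (deg₀-cong p) (deg₀-cong q)
  deg₀-cong (⊗-cong p q)      = *-cong (deg₀-cong p) (deg₀-cong q)
  deg₀-cong (⊝-cong p)        = -‿cong (deg₀-cong p)
  deg₀-cong (⊕-assoc x y z)   = +-assoc (deg₀ x) (deg₀ y) (deg₀ z)
  deg₀-cong (⊕-comm x y)      = +-comm (deg₀ x) (deg₀ y)
  deg₀-cong (⊕-identityˡ x)   = +-identityˡ (deg₀ x)
  deg₀-cong (⊕-inverseˡ x)    = -‿inverseˡ (deg₀ x)
  deg₀-cong (⊗-assoc x y z)   = *-assoc (deg₀ x) (deg₀ y) (deg₀ z)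
  deg₀-cong (⊗-identityˡ x)   = *-identityˡ (deg₀ x)
  deg₀-cong (Exterior.distribˡ x y z)  = distribˡ (deg₀ x) (deg₀ y) (deg₀ z)
  deg₀-cong (Exterior.distribʳ x y z)  = distribʳ (deg₀ x) (deg₀ y) (deg₀ z)
  deg₀-cong (scalar-cong p)   = p
  deg₀-cong (scalar-+ a b)    = refl
  deg₀-cong (scalar-* a b)    = refl
  deg₀-cong (central a x)     = *-comm a (deg₀ x)
  deg₀-cong (alternating ξ)   = trans (*-congʳ (deg₀-linear ξ)) (zeroˡ _)

  deg₁-cong : ∀ f {x y} → x ≈Λ y → deg₁ f x ≈ deg₁ f y
  deg₁-cong f ≈-refl          = refl
  deg₁-cong f (≈-sym p)       = sym (deg₁-cong f p)
  deg₁-cong f (≈-trans p q)   = trans (deg₁-cong f p) (deg₁-cong f q)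
  deg₁-cong f (⊕-cong p q)    = +-cong (deg₁-cong f p) (deg₁-cong f q)
  deg₁-cong f (⊗-cong p q)    = +-cong (*-cong (deg₀-cong p) (deg₁-cong f q)) (*-cong (deg₁-cong f p) (deg₀-cong q))
  deg₁-cong f (⊝-cong p)      = -‿cong (deg₁-cong f p)
  deg₁-cong f (⊕-assoc x y z) = +-assoc (deg₁ f x) (deg₁ f y) (deg₁ f z)
  deg₁-cong f (⊕-comm x y)    = +-comm (deg₁ f x) (deg₁ f y)
  deg₁-cong f (⊕-identityˡ x) = +-identityˡ (deg₁ f x)
  deg₁-cong f (⊕-inverseˡ x)  = -‿inverseˡ (deg₁ f x)
  deg₁-cong f (⊗-assoc x y z) = solve 6 (λ x₀ x₁ y₀ y₁ z₀ z₁ →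
    (x₀ :* y₀) :* z₁ :+ (x₀ :* y₁ :+ x₁ :* y₀) :* z₀ := x₀ :* (y₀ :* z₁ :+ y₁ :* z₀) :+ x₁ :* (y₀ :* z₀)) refl
    (deg₀ x) (deg₁ f x) (deg₀ y) (deg₁ f y) (deg₀ z) (deg₁ f z)
  deg₁-cong f (⊗-identityˡ x) = solve 2 (λ x₀ x₁ → con (1 , 0) :* x₁ :+ con (0 , 0) :* x₀ := x₁) refl (deg₀ x) (deg₁ f x)
  deg₁-cong f (Exterior.distribˡ x y z) = solve 6 (λ x₀ x₁ y₀ y₁ z₀ z₁ →
    x₀ :* (y₁ :+ z₁) :+ x₁ :* (y₀ :+ z₀) := (x₀ :* y₁ :+ x₁ :* y₀) :+ (x₀ :* z₁ :+ x₁ :* z₀)) refl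
    (deg₀ x) (deg₁ f x) (deg₀ y) (deg₁ f y) (deg₀ z) (deg₁ f z)
  deg₁-cong f (Exterior.distribʳ x y z) = solve 6 (λ x₀ x₁ y₀ y₁ z₀ z₁ →
    (y₀ :+ z₀) :* x₁ :+ (y₁ :+ z₁) :* x₀ := (y₀ :* x₁ :+ y₁ :* x₀) :+ (z₀ :* x₁ :+ z₁ :* x₀)) refl
    (deg₀ x) (deg₁ f x) (deg₀ y) (deg₁ f y) (deg₀ z) (deg₁ f z)
  deg₁-cong f (scalar-cong p) = refl
  deg₁-cong f (scalar-+ a b)  = sym (+-identityʳ 0#)
  deg₁-cong f (scalar-* a b)  = solve 2 (λ a b → con (0 , 0) := a :* con (0 , 0) :+ con (0 , 0) :* b) refl a b
  deg₁-cong f (central a x)   = solve 3 (λ a x₀ x₁ → a :* x₁ :+ con (0 , 0) :* x₀ := x₀ :* con (0 , 0) :+ x₁ :* a) refl a (deg₀ x) (deg₁ f x)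
  deg₁-cong f (alternating ξ) = trans (+-cong (*-congʳ (deg₀-linear ξ)) (*-congˡ (deg₀-linear ξ)))
    (solve 1 (λ a → con (0 , 0) :* a :+ a :* con (0 , 0) := con (0 , 0)) refl (deg₁ f (linear ξ)))

  -- The clause for `⊗-cong` rests on the congruences in degrees zero and one. Associativity is a
  -- polynomial identity in the components, and `alternating` is a determinant with two equal rows.
  deg₂-cong : ∀ f g {x y} → x ≈Λ y → deg₂ f g x ≈ deg₂ f g y
  deg₂-cong f g ≈-refl          = refl
  deg₂-cong f g (≈-sym p)       = sym (deg₂-cong f g p)
  deg₂-cong f g (≈-trans p q)   = trans (deg₂-cong f g p) (deg₂-cong f g q)
  deg₂-cong f g (⊕-cong p q)    = +-cong (deg₂-cong f g p) (deg₂-cong f g q)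
  deg₂-cong f g (⊗-cong p q)    = +-cong
    (+-cong (*-cong (deg₀-cong p) (deg₂-cong f g q))
            (+-cong (*-cong (deg₁-cong f p) (deg₁-cong g q)) (-‿cong (*-cong (deg₁-cong g p) (deg₁-cong f q)))))
    (*-cong (deg₂-cong f g p) (deg₀-cong q))
  deg₂-cong f g (⊝-cong p)      = -‿cong (deg₂-cong f g p)
  deg₂-cong f g (⊕-assoc x y z) = +-assoc (deg₂ f g x) (deg₂ f g y) (deg₂ f g z)
  deg₂-cong f g (⊕-comm x y)    = +-comm (deg₂ f g x) (deg₂ f g y)
  deg₂-cong f g (⊕-identityˡ x) = +-identityˡ (deg₂ f g x)
  deg₂-cong f g (⊕-inverseˡ x)  = -‿inverseˡ (deg₂ f g x)
  deg₂-cong f g (⊗-assoc x y z) = solve 12 (λ x₀ x₁ x₁′ x₂ y₀ y₁ y₁′ y₂ z₀ z₁ z₁′ z₂ →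
    (x₀ :* y₀) :* z₂ :+ ((x₀ :* y₁ :+ x₁ :* y₀) :* z₁′ :- (x₀ :* y₁′ :+ x₁′ :* y₀) :* z₁)
      :+ (x₀ :* y₂ :+ (x₁ :* y₁′ :- x₁′ :* y₁) :+ x₂ :* y₀) :* z₀
    := x₀ :* (y₀ :* z₂ :+ (y₁ :* z₁′ :- y₁′ :* z₁) :+ y₂ :* z₀)
      :+ (x₁ :* (y₀ :* z₁′ :+ y₁′ :* z₀) :- x₁′ :* (y₀ :* z₁ :+ y₁ :* z₀)) :+ x₂ :* (y₀ :* z₀)) refl
    (deg₀ x) (deg₁ f x) (deg₁ g x) (deg₂ f g x) (deg₀ y) (deg₁ f y) (deg₁ g y) (deg₂ f g y)
    (deg₀ z) (deg₁ f z) (deg₁ g z) (deg₂ f g z)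
  deg₂-cong f g (⊗-identityˡ x) = solve 4 (λ x₀ x₁ x₁′ x₂ →
    con (1 , 0) :* x₂ :+ (con (0 , 0) :* x₁′ :- con (0 , 0) :* x₁) :+ con (0 , 0) :* x₀ := x₂) refl
    (deg₀ x) (deg₁ f x) (deg₁ g x) (deg₂ f g x)
  deg₂-cong f g (Exterior.distribˡ x y z) = solve 12 (λ x₀ x₁ x₁′ x₂ y₀ y₁ y₁′ y₂ z₀ z₁ z₁′ z₂ →
    x₀ :* (y₂ :+ z₂) :+ (x₁ :* (y₁′ :+ z₁′) :- x₁′ :* (y₁ :+ z₁)) :+ x₂ :* (y₀ :+ z₀)
    := (x₀ :* y₂ :+ (x₁ :* y₁′ :- x₁′ :* y₁) :+ x₂ :* y₀) :+ (x₀ :* z₂ :+ (x₁ :* z₁′ :- x₁′ :* z₁) :+ x₂ :* z₀)) refl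
    (deg₀ x) (deg₁ f x) (deg₁ g x) (deg₂ f g x) (deg₀ y) (deg₁ f y) (deg₁ g y) (deg₂ f g y)
    (deg₀ z) (deg₁ f z) (deg₁ g z) (deg₂ f g z)
  deg₂-cong f g (Exterior.distribʳ x y z) = solve 12 (λ x₀ x₁ x₁′ x₂ y₀ y₁ y₁′ y₂ z₀ z₁ z₁′ z₂ →
    (y₀ :+ z₀) :* x₂ :+ ((y₁ :+ z₁) :* x₁′ :- (y₁′ :+ z₁′) :* x₁) :+ (y₂ :+ z₂) :* x₀
    := (y₀ :* x₂ :+ (y₁ :* x₁′ :- y₁′ :* x₁) :+ y₂ :* x₀) :+ (z₀ :* x₂ :+ (z₁ :* x₁′ :- z₁′ :* x₁) :+ z₂ :* x₀)) refl
    (deg₀ x) (deg₁ f x) (deg₁ g x) (deg₂ f g x) (deg₀ y) (deg₁ f y) (deg₁ g y) (deg₂ f g y)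
    (deg₀ z) (deg₁ f z) (deg₁ g z) (deg₂ f g z)
  deg₂-cong f g (scalar-cong p) = refl
  deg₂-cong f g (scalar-+ a b)  = sym (+-identityʳ 0#)
  deg₂-cong f g (scalar-* a b)  = solve 2 (λ a b → con (0 , 0) :=
    a :* con (0 , 0) :+ (con (0 , 0) :* con (0 , 0) :- con (0 , 0) :* con (0 , 0)) :+ con (0 , 0) :* b) refl a b
  deg₂-cong f g (central a x)   = solve 5 (λ a x₀ x₁ x₁′ x₂ →
    a :* x₂ :+ (con (0 , 0) :* x₁′ :- con (0 , 0) :* x₁) :+ con (0 , 0) :* x₀
    := x₀ :* con (0 , 0) :+ (x₁ :* con (0 , 0) :- x₁′ :* con (0 , 0)) :+ x₂ :* a) refl
    a (deg₀ x) (deg₁ f x) (deg₁ g x) (deg₂ f g x)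
  deg₂-cong f g (alternating ξ) = trans (deg₂-linear-⊗ f g ξ ξ)
    (solve 2 (λ a b → a :* b :- b :* a := con (0 , 0)) refl (deg₁ f (linear ξ)) (deg₁ g (linear ξ)))

-- Necessity: functionals that vanish on the Orlik-Solomon ideal

module Detect (em : ∀ {a} → ExcludedMiddle a) {f ℓf} (F : Field f ℓf) {n l}
  (𝒜 : CentralArrangement (Field.commutativeRing F) n l) {c ℓ} (k : Field c ℓ) where
  open Field k hiding (zero)
  open Linear commutativeRing
  open RingSolver commutativeRing
  open Evaluation commutativeRing n
  open CentralArrangement 𝒜
  open Matroid em F 𝒜
  open LinearAlgebra em k using (δ; δ-refl; δ-≢; sum-δ)
  open OrlikSolomon k 𝒜
  open Exterior commutativeRing n using (Term; scalar; e; _⊗_; _⊕_; linear; monomial; Λ; ∂)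
  open Quotient Λ ∂Circuit using (Ideal; generator; add; mulˡ; mulʳ; resp) renaming (zero to zeroᴵ)

  indicator : Subset n → Vector Carrier n
  indicator X i = if lookup X i then 1# else 0#

  indicator-∈ : ∀ {X i} → i ∈ X → indicator X i ≈ 1#
  indicator-∈ i∈X rewrite Vec.[]=⇒lookup i∈X = refl

  indicator-∉ : ∀ {X i} → i ∉ X → indicator X i ≈ 0#
  indicator-∉ {X} {i} i∉X with lookup X i in eq
  ... | true  = contradiction (Vec.lookup⇒[]= i X eq) i∉X
  ... | false = refl

  *-indicator : ∀ X (ξ : Vector Carrier n) i → ξ i * indicator X i ≈ (if lookup X i then ξ i else 0#)
  *-indicator X ξ i with lookup X i
  ... | true  = *-identityʳ (ξ i)
  ... | false = zeroʳ (ξ i)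

  Line-closed : ∀ {X p q s} → Line X → p ∈ X → q ∈ X → H p ∩ H q ⊆ H s → s ∈ X
  Line-closed {s = s} (i , j , _ , X⇔) p∈X q∈X Hₚ∩Hq⊆Hₛ =
    Equivalence.from (X⇔ s) λ h → Hₚ∩Hq⊆Hₛ (Equivalence.to (X⇔ _) p∈X h , Equivalence.to (X⇔ _) q∈X h)

  deg₀-monomial : ∀ L → 1 ℕ.≤ length L → deg₀ (monomial L) ≈ 0#
  deg₀-monomial (i ∷ L) _ = zeroˡ (deg₀ (monomial L))

  deg₁-monomial : ∀ w L → 2 ℕ.≤ length L → deg₁ w (monomial L) ≈ 0#
  deg₁-monomial w (i ∷ L) (s≤s len) = trans
    (+-cong (zeroˡ (deg₁ w (monomial L))) (trans (*-congˡ (deg₀-monomial L len)) (zeroʳ (w i)))) (+-identityʳ 0#)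

  deg₁-⊗-≈0 : ∀ w s x → deg₀ x ≈ 0# → deg₁ w x ≈ 0# → deg₁ w (s ⊗ x) ≈ 0#
  deg₁-⊗-≈0 w s x d₀ d₁ = trans (+-cong (trans (*-congˡ d₁) (zeroʳ _)) (trans (*-congˡ d₀) (zeroʳ _))) (+-identityʳ 0#)

  sign : ℕ → Term
  sign j = Ring.-_ Λ (Ring.1# Λ) ^ j
    where open Exp (Ring.semiring Λ) using (_^_)

  -- On `members C` this computes to `∂ C`, as `members` unfolds to the same list as `elements`. A
  -- list argument allows case analysis on its length.
  ∂ᴸ : List (Fin n) → Term
  ∂ᴸ L = Vector.foldr _⊕_ (scalar 0#) (λ (j : Fin (length L)) → sign (toℕ j) ⊗ monomial (removeAt L j))

  module _ (u v : Vector Carrier n) where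

    minor : Fin n → Fin n → Carrier
    minor i j = u i * v j - v i * u j

    -- The degree-two component of a product with x involves the lower components of x, so only the
    -- joint vanishing is stable under multiplication by arbitrary terms.
    Killed : Pred Term ℓ
    Killed x = deg₀ x ≈ 0# × deg₁ u x ≈ 0# × deg₁ v x ≈ 0# × deg₂ u v x ≈ 0#

    deg₂-monomial : ∀ L → 3 ℕ.≤ length L → deg₂ u v (monomial L) ≈ 0#
    deg₂-monomial (i ∷ L) (s≤s len) = trans
      (+-congʳ (+-congˡ (+-cong (*-congˡ (deg₁-monomial v L len)) (-‿cong (*-congˡ (deg₁-monomial u L len))))))
      (solve 4 (λ a b d₂ d₀ → con (0 , 0) :* d₂ :+ (a :* con (0 , 0) :- b :* con (0 , 0)) :+ con (0 , 0) :* d₀ := con (0 , 0)) refl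
        (u i) (v i) (deg₂ u v (monomial L)) (deg₀ (monomial L)))

    deg₂-e⊗e : ∀ p q → deg₂ u v (monomial (p ∷ q ∷ [])) ≈ minor p q
    deg₂-e⊗e p q = solve 4 (λ uₚ vₚ u v →
      con (0 , 0) :* (con (0 , 0) :* con (0 , 0) :+ (u :* con (0 , 0) :- v :* con (0 , 0)) :+ con (0 , 0) :* con (1 , 0))
        :+ (uₚ :* (con (0 , 0) :* con (0 , 0) :+ v :* con (1 , 0)) :- vₚ :* (con (0 , 0) :* con (0 , 0) :+ u :* con (1 , 0)))
        :+ con (0 , 0) :* (con (0 , 0) :* con (1 , 0))
      := uₚ :* v :- vₚ :* u) refl (u p) (v p) (u q) (v q)

    deg₂-⊗ : ∀ s x → deg₀ x ≈ 0# → deg₁ u x ≈ 0# → deg₁ v x ≈ 0# → deg₂ u v (s ⊗ x) ≈ deg₀ s * deg₂ u v x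
    deg₂-⊗ s x d₀ d₁ d₁′ = trans
      (+-cong (+-congˡ (+-cong (*-congˡ d₁′) (-‿cong (*-congˡ d₁)))) (*-congˡ d₀))
      (solve 4 (λ a b c d → a :+ (b :* con (0 , 0) :- c :* con (0 , 0)) :+ d :* con (0 , 0) := a) refl
        (deg₀ s * deg₂ u v x) (deg₁ u s) (deg₁ v s) (deg₂ u v s))

    -- The value of `deg₂ u v` on the boundary of e_p e_q e_s.
    alternatingSum : Fin n → Fin n → Fin n → Carrier
    alternatingSum p q s = minor q s - minor p s + minor p q

    -- Each monomial of the boundary has one factor fewer than L, and a product of generators has no
    -- component below its length. Lists of length three leave one condition in degree two; longer
    -- ones leave none.
    ∂ᴸ-Killed : ∀ L → 3 ℕ.≤ length L → (∀ {p q s} → L ≡ p ∷ q ∷ s ∷ [] → alternatingSum p q s ≈ 0#) → Killed (∂ᴸ L)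
    ∂ᴸ-Killed L 3≤len alt =
        deg₀-∑-≈0 (t L) (λ j → trans (*-congˡ (d₀ j)) (zeroʳ _))
      , deg₁-∑-≈0 u (t L) (d₁⊗ u)
      , deg₁-∑-≈0 v (t L) (d₁⊗ v)
      , d₂ L 3≤len ≡.refl
      where
      t : ∀ L → Fin (length L) → Term
      t L j = sign (toℕ j) ⊗ monomial (removeAt L j)
      2≤ : ∀ j → 2 ℕ.≤ length (removeAt L j)
      2≤ j = ℕ.s≤s⁻¹ (subst (3 ℕ.≤_) (List.length-removeAt′ L j) 3≤len)
      d₀ : ∀ j → deg₀ (monomial (removeAt L j)) ≈ 0#
      d₀ j = deg₀-monomial (removeAt L j) (ℕₚ.≤-trans (s≤s z≤n) (2≤ j))
      d₁ : ∀ w j → deg₁ w (monomial (removeAt L j)) ≈ 0#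
      d₁ w j = deg₁-monomial w (removeAt L j) (2≤ j)
      d₁⊗ : ∀ w j → deg₁ w (t L j) ≈ 0#
      d₁⊗ w j = deg₁-⊗-≈0 w (sign (toℕ j)) (monomial (removeAt L j)) (d₀ j) (d₁ w j)
      d₂⊗ : ∀ j → deg₂ u v (t L j) ≈ deg₀ (sign (toℕ j)) * deg₂ u v (monomial (removeAt L j))
      d₂⊗ j = deg₂-⊗ (sign (toℕ j)) (monomial (removeAt L j)) (d₀ j) (d₁ u j) (d₁ v j)
      d₂ : ∀ L′ → 3 ℕ.≤ length L′ → L ≡ L′ → deg₂ u v (∂ᴸ L) ≈ 0#
      d₂ (_ ∷ []) (s≤s ()) _
      d₂ (_ ∷ _ ∷ []) (s≤s (s≤s ())) _
      d₂ (p ∷ q ∷ s ∷ []) _ ≡.refl = trans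
        (+-cong (trans (d₂⊗ zero) (*-congˡ (deg₂-e⊗e q s)))
          (+-cong (trans (d₂⊗ (suc zero)) (*-congˡ (deg₂-e⊗e p s)))
            (+-congʳ (trans (d₂⊗ (suc (suc zero))) (*-congˡ (deg₂-e⊗e p q))))))
        (trans (solve 3 (λ a b c → con (1 , 0) :* a :+ ((:- con (1 , 0)) :* con (1 , 0) :* b
                  :+ ((:- con (1 , 0)) :* ((:- con (1 , 0)) :* con (1 , 0)) :* c :+ con (0 , 0))) := a :- b :+ c) refl
                  (minor q s) (minor p s) (minor p q))
          (alt ≡.refl))
      d₂ (_ ∷ _ ∷ _ ∷ _ ∷ _) 3≤ ≡.refl = deg₂-∑-≈0 u v (t L) (λ j → trans (d₂⊗ j)
        (trans (*-congˡ (deg₂-monomial (removeAt L j)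
          (ℕ.s≤s⁻¹ (subst (4 ℕ.≤_) (List.length-removeAt′ L j) (s≤s (s≤s (s≤s (s≤s z≤n)))))))) (zeroʳ _)))

    module _ (alt : ∀ {p q s} → p ≢ q → p ≢ s → q ≢ s → H p ∩ H q ⊆ H s → H p ∩ H s ⊆ H q → H q ∩ H s ⊆ H p → alternatingSum p q s ≈ 0#) where

      ∂-Killed : ∀ {C} → Circuit C → Killed (∂ C)
      ∂-Killed {C} (dep , _) = ∂ᴸ-Killed (members C)
        (subst (3 ℕ.≤_) (≡.sym (length-members C)) (Dependent⇒3≤∣C∣ dep)) collinear
        where
        collinear : ∀ {p q s} → members C ≡ p ∷ q ∷ s ∷ [] → alternatingSum p q s ≈ 0#
        collinear {p} {q} {s} eq with members-unique C
        -- Rewriting turns the uniqueness proof into one about an explicit list, which can be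
        -- matched for the three inequalities.
        ... | unique rewrite eq with unique
        ... | (p≢q ∷ p≢s ∷ _) ∷ (q≢s ∷ _) ∷ _ = alt p≢q p≢s q≢s
          (Dependent⇒collinear dep card p≢q p∈ q∈ s∈)
          (Dependent⇒collinear dep card p≢s p∈ s∈ q∈)
          (Dependent⇒collinear dep card q≢s q∈ s∈ p∈)
          where
          card : ∣ C ∣ ≡ 3
          card = ≡.trans (≡.sym (length-members C)) (≡.cong length eq)
          mem : ∀ {i} → i List.∈ p ∷ q ∷ s ∷ [] → i ∈ C
          mem {i} i∈ = ∈-members⁻ (subst (i List.∈_) (≡.sym eq) i∈)
          p∈ = mem (here ≡.refl)
          q∈ = mem (there (here ≡.refl))
          s∈ = mem (there (there (here ≡.refl)))

      Ideal-Killed : ∀ {x} → Ideal x → Killed x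
      Ideal-Killed (generator (C , circuit , ≡.refl)) = ∂-Killed circuit
      Ideal-Killed zeroᴵ = refl , refl , refl , refl
      Ideal-Killed (add p q) with Ideal-Killed p | Ideal-Killed q
      ... | a , b , c , d | a′ , b′ , c′ , d′ = 0+0 a a′ , 0+0 b b′ , 0+0 c c′ , 0+0 d d′
        where
        0+0 : ∀ {x y} → x ≈ 0# → y ≈ 0# → x + y ≈ 0#
        0+0 p q = trans (+-cong p q) (+-identityʳ 0#)
      Ideal-Killed (mulˡ r {x} p) with Ideal-Killed p
      ... | a , b , c , d =
          trans (*-congˡ a) (zeroʳ _) , deg₁-⊗-≈0 u r x a b , deg₁-⊗-≈0 v r x a c
        , trans (deg₂-⊗ r x a b c) (trans (*-congˡ d) (zeroʳ _))
      Ideal-Killed (mulʳ r {x} p) with Ideal-Killed p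
      ... | a , b , c , d =
          trans (*-congʳ a) (zeroˡ _)
        , trans (+-cong (*-congʳ a) (*-congʳ b)) (0*+0* (deg₁ u r) (deg₀ r))
        , trans (+-cong (*-congʳ a) (*-congʳ c)) (0*+0* (deg₁ v r) (deg₀ r))
        , trans (+-cong (+-cong (*-congʳ a) (+-cong (*-congʳ b) (-‿cong (*-congʳ c)))) (*-congʳ d))
            (solve 4 (λ x y z w → con (0 , 0) :* x :+ (con (0 , 0) :* y :- con (0 , 0) :* z) :+ con (0 , 0) :* w := con (0 , 0)) refl
              (deg₂ u v r) (deg₁ v r) (deg₁ u r) (deg₀ r))
        where
        0*+0* : ∀ x y → 0# * x + 0# * y ≈ 0#
        0*+0* x y = solve 2 (λ x y → con (0 , 0) :* x :+ con (0 , 0) :* y := con (0 , 0)) refl x y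
      Ideal-Killed (resp eq p) with Ideal-Killed p
      ... | a , b , c , d = trans (sym (deg₀-cong eq)) a , trans (sym (deg₁-cong u eq)) b
                          , trans (sym (deg₁-cong v eq)) c , trans (sym (deg₂-cong u v eq)) d

  Z⇒Line : ∀ {λ′ η X r} → Z λ′ η → Line X → r ∈ X → λ′ r * sumOver η X ≈ sumOver λ′ X * η r
  Z⇒Line {λ′} {η} {X} {r} aλaη≈0 line r∈X = begin
    λ′ r * sumOver η X                        ≈⟨ sym (*-cong (value-u λ′) (value-v η)) ⟩
    deg₁ u (linear λ′) * deg₁ v (linear η)    ≈⟨ x∙y⁻¹≈ε⇒x≈y _ _ killed ⟩
    deg₁ v (linear λ′) * deg₁ u (linear η)    ≈⟨ *-cong (value-v λ′) (value-u η) ⟩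
    sumOver λ′ X * η r                        ∎
    where
    open import Relation.Binary.Reasoning.Setoid setoid
    open RingProperties ring using (x∙y⁻¹≈ε⇒x≈y)
    open SemiringSum semiring using (sum-cong-≋)
    u v : Vector Carrier n
    u i = δ i r
    v = indicator X
    value-u : ∀ ξ → deg₁ u (linear ξ) ≈ ξ r
    value-u ξ = trans (deg₁-linear u ξ) (sum-δ ξ r)
    value-v : ∀ ξ → deg₁ v (linear ξ) ≈ sumOver ξ X
    value-v ξ = trans (deg₁-linear v ξ) (sum-cong-≋ (*-indicator X ξ))
    -- Since r lies in X, both functionals vanish off X.
    u∉ : ∀ {i} → i ∉ X → u i ≈ 0#
    u∉ i∉X = δ-≢ λ i≡r → i∉X (subst (_∈ X) (≡.sym i≡r) r∈X)
    minor-∉ˡ : ∀ {i j} → i ∉ X → minor u v i j ≈ 0#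
    minor-∉ˡ {i} {j} i∉ = trans (+-cong (*-congʳ (u∉ i∉)) (-‿cong (*-congʳ (indicator-∉ i∉))))
      (solve 2 (λ x y → con (0 , 0) :* x :- con (0 , 0) :* y := con (0 , 0)) refl (v j) (u j))
    minor-∉ʳ : ∀ {i j} → j ∉ X → minor u v i j ≈ 0#
    minor-∉ʳ {i} {j} j∉ = trans (+-cong (*-congˡ (indicator-∉ j∉)) (-‿cong (*-congˡ (u∉ j∉))))
      (solve 2 (λ x y → x :* con (0 , 0) :- y :* con (0 , 0) := con (0 , 0)) refl (u i) (v i))
    0-0+0 : ∀ {x y z} → x ≈ 0# → y ≈ 0# → z ≈ 0# → x - y + z ≈ 0#
    0-0+0 p q r = trans (+-cong (+-cong p (-‿cong q)) r) (solve 0 (con (0 , 0) :- con (0 , 0) :+ con (0 , 0) := con (0 , 0)) refl)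
    -- A collinear triple with two points in X lies in X, where the indicator is constant and the
    -- three minors cancel. With at most one point in X, each minor involves a point off X and
    -- vanishes.
    alt : ∀ {p q s} → p ≢ q → p ≢ s → q ≢ s → H p ∩ H q ⊆ H s → H p ∩ H s ⊆ H q → H q ∩ H s ⊆ H p → alternatingSum u v p q s ≈ 0#
    alt {p} {q} {s} p≢q p≢s q≢s pq⊆s ps⊆q qs⊆p with p ∈? X | q ∈? X | s ∈? X
    ... | yes p∈ | yes q∈ | no s∉  = contradiction (Line-closed line p∈ q∈ pq⊆s) s∉
    ... | yes p∈ | no q∉  | yes s∈ = contradiction (Line-closed line p∈ s∈ ps⊆q) q∉
    ... | no p∉  | yes q∈ | yes s∈ = contradiction (Line-closed line q∈ s∈ qs⊆p) p∉
    ... | yes p∈ | yes q∈ | yes s∈ = trans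
      (+-cong (+-cong (+-cong (*-congˡ (indicator-∈ s∈)) (-‿cong (*-congʳ (indicator-∈ q∈))))
                      (-‿cong (+-cong (*-congˡ (indicator-∈ s∈)) (-‿cong (*-congʳ (indicator-∈ p∈))))))
              (+-cong (*-congˡ (indicator-∈ q∈)) (-‿cong (*-congʳ (indicator-∈ p∈)))))
      (solve 3 (λ uₚ uq uₛ → (uq :* con (1 , 0) :- con (1 , 0) :* uₛ) :- (uₚ :* con (1 , 0) :- con (1 , 0) :* uₛ)
        :+ (uₚ :* con (1 , 0) :- con (1 , 0) :* uq) := con (0 , 0)) refl (u p) (u q) (u s))
    ... | _      | no q∉  | no s∉  = 0-0+0 (minor-∉ˡ q∉) (minor-∉ʳ s∉) (minor-∉ʳ q∉)
    ... | no p∉  | _      | no s∉  = 0-0+0 (minor-∉ʳ s∉) (minor-∉ˡ p∉) (minor-∉ˡ p∉)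
    ... | no p∉  | no q∉  | _      = 0-0+0 (minor-∉ˡ q∉) (minor-∉ˡ p∉) (minor-∉ˡ p∉)
    killed : deg₁ u (linear λ′) * deg₁ v (linear η) - deg₁ v (linear λ′) * deg₁ u (linear η) ≈ 0#
    killed = trans (sym (deg₂-linear-⊗ u v λ′ η))
      -- Equality in `A` means that the difference lies in the ideal, so the killed term carries a
      -- subtracted zero.
      (trans (solve 1 (λ x → x := x :- con (0 , 0)) refl (deg₂ u v (linear λ′ ⊗ linear η)))
        (proj₂ (proj₂ (proj₂ (Ideal-Killed u v alt aλaη≈0)))))

-- Lines through two points and their base points

module Lines (em : ∀ {a} → ExcludedMiddle a) {f ℓf} (F : Field f ℓf) {n l}
  (𝒜 : CentralArrangement (Field.commutativeRing F) n l) where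
  open CentralArrangement 𝒜
  open Matroid em F 𝒜

  -- This is {i} if i = j.
  line : Fin n → Fin n → Subset n
  line i j = ⟪ (λ m → em {P = H i ∩ H j ⊆ H m}) ⟫

  ∈-line⁺ : ∀ {i j m} → H i ∩ H j ⊆ H m → m ∈ line i j
  ∈-line⁺ = ∈-⟪⟫⁺ (λ _ → em)

  ∈-line⁻ : ∀ {i j m} → m ∈ line i j → H i ∩ H j ⊆ H m
  ∈-line⁻ m∈ = ∈-⟪⟫⁻ (λ _ → em) m∈

  ∈-lineˡ : ∀ i j → i ∈ line i j
  ∈-lineˡ i j = ∈-line⁺ proj₁

  line-Line : ∀ {i j} → i ≢ j → Line (line i j)
  line-Line {i} {j} i≢j = i , j , i≢j , λ m → mk⇔ ∈-line⁻ ∈-line⁺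

  line-comm : ∀ i j → line i j ≡ line j i
  line-comm i j = ⊆-antisym (λ m∈ → ∈-line⁺ λ (p , q) → ∈-line⁻ m∈ (q , p)) (λ m∈ → ∈-line⁺ λ (p , q) → ∈-line⁻ m∈ (q , p))

  line-self : ∀ {i m} → m ∈ line i i → i ≡ m
  line-self m∈ = H⊆⇒≡ λ h → ∈-line⁻ m∈ (h , h)

  line-exchange : ∀ {i j m} → i ≢ m → m ∈ line i j → line i m ≡ line i j
  line-exchange {i} {j} {m} i≢m m∈ with i Fin.≟ j
  ... | yes ≡.refl = contradiction (line-self m∈) i≢m
  ... | no i≢j = ⊆-antisym
    (λ s∈ → ∈-line⁺ λ (p , q) → ∈-line⁻ s∈ (p , ∈-line⁻ m∈ (p , q)))
    (λ s∈ → ∈-line⁺ λ (p , q) → ∈-line⁻ s∈ (p , exchange i≢j i≢m (∈-line⁻ m∈) (p , q)))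

  -- A default in place of a proof of nonemptiness lets equal sets give equal points by `cong`.
  choose : Fin n → Subset n → Fin n
  choose default S with nonempty? S
  ... | yes (m , _) = m
  ... | no _        = default

  choose-∈ : ∀ d {S x} → x ∈ S → choose d S ∈ S
  choose-∈ d {S} x∈S with nonempty? S
  ... | yes (m , m∈) = m∈
  ... | no empty     = contradiction (_ , x∈S) empty

  choose-default : ∀ d d′ {S x} → x ∈ S → choose d S ≡ choose d′ S
  choose-default d d′ {S} x∈S with nonempty? S
  ... | yes _    = ≡.refl
  ... | no empty = contradiction (_ , x∈S) empty

  -- Apart from the unused default, a function of the line only, so that all the products e i * e j
  -- of points of a line are expressed through the same point.
  base : Fin n → Fin n → Fin n
  base i j = choose i (line i j)

  base-∈ : ∀ i j → base i j ∈ line i j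
  base-∈ i j = choose-∈ i (∈-lineˡ i j)

  base-comm : ∀ i j → base i j ≡ base j i
  base-comm i j = ≡.trans (≡.cong (choose i) (line-comm i j)) (choose-default i j (∈-lineˡ j i))

  base-exchange : ∀ {i j m} → i ≢ m → m ∈ line i j → base i m ≡ base i j
  base-exchange {i} i≢m m∈ = ≡.cong (choose i) (line-exchange i≢m m∈)

-- Scalar coefficients after rewriting through base points

module BaseMinors (em : ∀ {a} → ExcludedMiddle a) {f ℓf} (F : Field f ℓf) {n l}
  (𝒜 : CentralArrangement (Field.commutativeRing F) n l) {c ℓ} (k : Field c ℓ)
  (λ′ η : Vector (Field.Carrier k) n) where
  open Field k hiding (zero)
  open Linear commutativeRing using (sumOver)
  open SemiringSum semiring
  open RingSolver commutativeRing
  open CentralArrangement 𝒜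
  open Lines em F 𝒜
  open LinearAlgebra em k using (δ; δ-refl; δ-≢)
  open Detect em F 𝒜 k using (indicator; indicator-∈; indicator-∉; *-indicator)
  open import Relation.Binary.Reasoning.Setoid setoid

  det : Fin n → Fin n → Carrier
  det i j = λ′ i * η j - λ′ j * η i

  Proportional : Set _
  Proportional = ∀ {X i} → Line X → i ∈ X → λ′ i * sumOver η X ≈ sumOver λ′ X * η i

  -- If `base i j` is r and r differs from i, then j lies on the line X through i and r, and r is
  -- the base point of X. So either no j ≠ i contributes, or exactly the points of X other than i
  -- do, and the sum is λ_i η_X - λ_X η_i.
  fibre-scalar : Proportional → ∀ {i r} → i ≢ r → sum (λ j → det i j * δ r (base i j)) ≈ 0#
  fibre-scalar proportional {i} {r} i≢r = go (base i r Fin.≟ r)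
    where
    X = line i r
    -- The index j = i is set apart because `line i i` is a single point; its term vanishes in any
    -- case, so it may be counted as a point of X.
    det-self : ∀ {j x} → i ≡ j → det i j * x ≈ 0#
    det-self {x = x} ≡.refl = solve 3 (λ a b x → (a :* b :- a :* b) :* x := con (0 , 0)) refl (λ′ i) (η i) x
    r∈⇒≡ : ∀ {j} → r ≡ base i j → line i r ≡ line i j
    r∈⇒≡ {j} eq = line-exchange i≢r (subst (_∈ line i j) (≡.sym eq) (base-∈ i j))
    off-base : ∀ {j} → base i r ≢ r → det i j * δ r (base i j) ≈ 0#
    off-base {j} base≢r with i Fin.≟ j | r Fin.≟ base i j
    ... | yes i≡j | _ = det-self i≡j
    ... | no _ | no _  = zeroʳ _
    ... | no _ | yes eq = contradiction (≡.trans (≡.cong (choose i) (r∈⇒≡ eq)) (≡.sym eq)) base≢r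
    on-base : ∀ {j} → base i r ≡ r → det i j * δ r (base i j) ≈ det i j * indicator X j
    on-base {j} base≡r with i Fin.≟ j | j ∈? X
    ... | yes i≡j | _ = trans (det-self i≡j) (sym (det-self i≡j))
    ... | no i≢j | yes j∈ = *-congˡ (trans
      (trans (reflexive (≡.cong (δ r) (≡.trans (base-exchange i≢j j∈) base≡r))) (δ-refl r))
      (sym (indicator-∈ j∈)))
    ... | no i≢j | no j∉ = *-congˡ (trans
      (δ-≢ (λ eq → j∉ (subst (j ∈_) (≡.sym (r∈⇒≡ eq)) (∈-line⁺ proj₂))))
      (sym (indicator-∉ j∉)))
    go : Dec (base i r ≡ r) → sum (λ j → det i j * δ r (base i j)) ≈ 0#
    go (no base≢r) = trans (sum-cong-≋ (λ j → off-base {j} base≢r)) (sum-replicate-zero n)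
    go (yes base≡r) = begin
      sum (λ j → det i j * δ r (base i j))
        ≈⟨ sum-cong-≋ (λ j → on-base {j} base≡r) ⟩
      sum (λ j → det i j * indicator X j)
        ≈⟨ sum-cong-≋ (λ j → solve 5 (λ λᵢ ηⱼ λⱼ ηᵢ g → (λᵢ :* ηⱼ :- λⱼ :* ηᵢ) :* g := λᵢ :* (ηⱼ :* g) :+ (:- ηᵢ) :* (λⱼ :* g))
             refl (λ′ i) (η j) (λ′ j) (η i) (indicator X j)) ⟩
      sum (λ j → λ′ i * (η j * indicator X j) + (- η i) * (λ′ j * indicator X j))
        ≈⟨ ∑-distrib-+ (λ j → λ′ i * (η j * indicator X j)) (λ j → (- η i) * (λ′ j * indicator X j)) ⟩
      sum (λ j → λ′ i * (η j * indicator X j)) + sum (λ j → (- η i) * (λ′ j * indicator X j))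
        ≈⟨ sym (+-cong (*-distribˡ-sum (λ′ i) (λ j → η j * indicator X j)) (*-distribˡ-sum (- η i) (λ j → λ′ j * indicator X j))) ⟩
      λ′ i * sum (λ j → η j * indicator X j) + (- η i) * sum (λ j → λ′ j * indicator X j)
        ≈⟨ +-cong (*-congˡ (sum-cong-≋ (*-indicator X η))) (*-congˡ (sum-cong-≋ (*-indicator X λ′))) ⟩
      λ′ i * sumOver η X + (- η i) * sumOver λ′ X
        ≈⟨ +-congʳ (proportional (line-Line i≢r) (∈-lineˡ i r)) ⟩
      sumOver λ′ X * η i + (- η i) * sumOver λ′ X
        ≈⟨ solve 2 (λ x y → x :* y :+ (:- y) :* x := con (0 , 0)) refl (sumOver λ′ X) (η i) ⟩
      0# ∎

-- Sufficiency: products of degree two in the Orlik-Solomon algebra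

module Relations (em : ∀ {a} → ExcludedMiddle a) {f ℓf} (F : Field f ℓf) {n l}
  (𝒜 : CentralArrangement (Field.commutativeRing F) n l) {c ℓ} (k : Field c ℓ) where
  private
    module k = Field k
  open CentralArrangement 𝒜
  open Matroid em F 𝒜
  open Lines em F 𝒜
  open LinearAlgebra em k using (δ; δ-refl; δ-≢; sum-δ)
  open Detect em F 𝒜 k using (indicator; indicator-∈; indicator-∉; *-indicator; ∂ᴸ)
  open OrlikSolomon k 𝒜
  open Exterior k.commutativeRing n using (Term; scalar; e; linear; monomial; Λ; _≈Λ_; scalar-cong; scalar-+; scalar-*; central; alternating)
  open Quotient Λ ∂Circuit using (Ideal; generator; add; mulˡ; mulʳ; resp) renaming (zero to zeroᴵ)
  open Ring A hiding (zero)
  open RingProperties A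
  open SemiringSum semiring
  open import Relation.Binary.Reasoning.Setoid setoid
  module ∑k = SemiringSum k.semiring

  Λ⇒A : ∀ {x y : Term} → x ≈Λ y → x ≈ y
  Λ⇒A {x} {y} p = resp (Ring.trans Λ (Ring.sym Λ (Ring.-‿inverseʳ Λ y)) (Ring.+-congʳ Λ (Ring.sym Λ p))) zeroᴵ

  Ideal⇒≈0 : ∀ {x : Term} → Ideal x → x ≈ 0#
  Ideal⇒≈0 {x} p = resp (Ring.sym Λ (Ring.trans Λ (Ring.+-congˡ Λ (RingProperties.-0#≈0# Λ)) (Ring.+-identityʳ Λ x))) p

  scalar-≈0 : ∀ {s} x → s k.≈ k.0# → scalar s * x ≈ 0#
  scalar-≈0 {s} x s≈0 = trans (*-congʳ (Λ⇒A (scalar-cong s≈0))) (zeroˡ x)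

  scalar-1 : ∀ {s} x → s k.≈ k.1# → scalar s * x ≈ x
  scalar-1 {s} x s≈1 = trans (*-congʳ (Λ⇒A (scalar-cong s≈1))) (*-identityˡ x)

  scalar-sum : ∀ {m} (s : Vector k.Carrier m) → scalar (∑k.sum s) ≈ ∑[ i < m ] scalar (s i)
  scalar-sum {ℕ.zero}  s = refl
  scalar-sum {ℕ.suc m} s = trans (Λ⇒A (scalar-+ (s zero) (∑k.sum (s ∘ suc)))) (+-congˡ (scalar-sum (s ∘ suc)))

  sum-≈0 : ∀ {m} (t : Vector Term m) → (∀ i → t i ≈ 0#) → sum t ≈ 0#
  sum-≈0 {m} t t≈0 = trans (sum-cong-≋ {x = t} t≈0) (sum-replicate-zero m)

  scalar-δ : ∀ {m} (t : Vector Term m) j → ∑[ i < m ] (scalar (δ i j) * t i) ≈ t j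
  scalar-δ {ℕ.suc m} t j = begin
    ∑[ i < ℕ.suc m ] (scalar (δ i j) * t i)
      ≈⟨ sum-remove {i = j} (λ i → scalar (δ i j) * t i) ⟩
    scalar (δ j j) * t j + ∑[ i < m ] (scalar (δ (punchIn j i) j) * t (punchIn j i))
      ≈⟨ +-cong (scalar-1 (t j) (δ-refl j)) (sum-≈0 (λ i → scalar (δ (punchIn j i) j) * t (punchIn j i))
           (λ i → scalar-≈0 (t (punchIn j i)) (δ-≢ (Fin.punchInᵢ≢i j i)))) ⟩
    t j + 0#  ≈⟨ +-identityʳ (t j) ⟩
    t j       ∎

  a-δ : ∀ i → a (λ j → δ j i) ≈ e i
  a-δ i = scalar-δ e i

  a-+ : ∀ ξ ζ → a (λ i → ξ i k.+ ζ i) ≈ a ξ + a ζ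
  a-+ ξ ζ = begin
    a (λ i → ξ i k.+ ζ i)
      ≈⟨ sum-cong-≋ {x = λ i → scalar (ξ i k.+ ζ i) * e i} (λ i → trans (*-congʳ (Λ⇒A (scalar-+ (ξ i) (ζ i)))) (distribʳ (e i) (scalar (ξ i)) (scalar (ζ i)))) ⟩
    ∑[ i < n ] (scalar (ξ i) * e i + scalar (ζ i) * e i)
      ≈⟨ ∑-distrib-+ (λ i → scalar (ξ i) * e i) (λ i → scalar (ζ i) * e i) ⟩
    a ξ + a ζ ∎

  a²≈0 : ∀ ξ → a ξ * a ξ ≈ 0#
  a²≈0 ξ = Λ⇒A (alternating ξ)

  e²≈0 : ∀ i → e i * e i ≈ 0#
  e²≈0 i = trans (*-cong (sym (a-δ i)) (sym (a-δ i))) (a²≈0 (λ j → δ j i))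

  -- Polarisation: the square of e_i + e_j vanishes, and so do the squares of e_i and e_j.
  e-anticomm : ∀ i j → e i * e j + e j * e i ≈ 0#
  e-anticomm i j = begin
    e i * e j + e j * e i                                  ≈⟨ sym (+-cong (+-identityˡ _) (+-identityʳ _)) ⟩
    (0# + e i * e j) + (e j * e i + 0#)                    ≈⟨ sym (+-cong (+-congʳ (e²≈0 i)) (+-congˡ (e²≈0 j))) ⟩
    (e i * e i + e i * e j) + (e j * e i + e j * e j)      ≈⟨ sym (+-cong (distribˡ (e i) (e i) (e j)) (distribˡ (e j) (e i) (e j))) ⟩
    e i * (e i + e j) + e j * (e i + e j)                  ≈⟨ sym (distribʳ (e i + e j) (e i) (e j)) ⟩
    (e i + e j) * (e i + e j)                              ≈⟨ sym (*-cong a-δ-+ a-δ-+) ⟩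
    a ξ * a ξ                                              ≈⟨ a²≈0 ξ ⟩
    0#                                                     ∎
    where
    ξ : Vector k.Carrier n
    ξ m = δ m i k.+ δ m j
    a-δ-+ : a ξ ≈ e i + e j
    a-δ-+ = trans (a-+ (λ m → δ m i) (λ m → δ m j)) (+-cong (a-δ i) (a-δ j))

  -- In this cyclic form the relation ∂ e_{ijm} only changes sign when i, j and m are permuted.
  Cyclic : Fin n → Fin n → Fin n → Set _
  Cyclic i j m = e i * e j + e j * e m + e m * e i ≈ 0#

  Cyclic-rotate : ∀ {i j m} → Cyclic i j m → Cyclic j m i
  Cyclic-rotate {i} {j} {m} h = trans (trans (+-comm _ _) (sym (+-assoc _ _ _))) h

  x+y≈0⇒y≈-x : ∀ {x y} → x + y ≈ 0# → y ≈ - x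
  x+y≈0⇒y≈-x {x} {y} h = begin
    y                ≈⟨ sym (+-identityˡ y) ⟩
    0# + y           ≈⟨ +-congʳ (sym (-‿inverseˡ x)) ⟩
    - x + x + y      ≈⟨ +-assoc (- x) x y ⟩
    - x + (x + y)    ≈⟨ +-congˡ h ⟩
    - x + 0#         ≈⟨ +-identityʳ (- x) ⟩
    - x              ∎

  e-swap : ∀ i j → e j * e i ≈ - (e i * e j)
  e-swap i j = x+y≈0⇒y≈-x (e-anticomm i j)

  Cyclic-swap : ∀ {i j m} → Cyclic i j m → Cyclic j i m
  Cyclic-swap {i} {j} {m} h = begin
    e j * e i + e i * e m + e m * e j                      ≈⟨ +-cong (+-cong (e-swap i j) (e-swap m i)) (e-swap j m) ⟩
    - (e i * e j) + - (e m * e i) + - (e j * e m)          ≈⟨ +-congʳ (-‿+-comm _ _) ⟩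
    - (e i * e j + e m * e i) + - (e j * e m)              ≈⟨ -‿+-comm _ _ ⟩
    - (e i * e j + e m * e i + e j * e m)                  ≈⟨ -‿cong (trans (+-assoc _ _ _) (trans (+-congˡ (+-comm _ _)) (sym (+-assoc _ _ _)))) ⟩
    - (e i * e j + e j * e m + e m * e i)                  ≈⟨ -‿cong h ⟩
    - 0#                                                   ≈⟨ -0#≈0# ⟩
    0#                                                     ∎

  ∂ᴸ⇒Cyclic : ∀ p q s → ∂ᴸ (p ∷ q ∷ s ∷ []) ≈ 0# → Cyclic p q s
  ∂ᴸ⇒Cyclic p q s h = begin
    e p * e q + e q * e s + e s * e p      ≈⟨ +-cong (+-comm _ _) (e-swap p s) ⟩
    e q * e s + e p * e q - e p * e s      ≈⟨ +-assoc _ _ _ ⟩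
    e q * e s + (e p * e q - e p * e s)    ≈⟨ +-congˡ (+-comm _ _) ⟩
    e q * e s + (- (e p * e s) + e p * e q)
      ≈⟨ sym (+-cong (trans (*-identityˡ _) (monomial₂ q s)) (+-cong minus (trans (+-identityʳ _) plus))) ⟩
    ∂ᴸ (p ∷ q ∷ s ∷ [])                    ≈⟨ h ⟩
    0#                                     ∎
    where
    monomial₂ : ∀ i j → monomial (i ∷ j ∷ []) ≈ e i * e j
    monomial₂ i j = *-congˡ (*-identityʳ (e j))
    minus : - 1# * 1# * monomial (p ∷ s ∷ []) ≈ - (e p * e s)
    minus = trans (*-cong (*-identityʳ (- 1#)) (monomial₂ p s)) (-1*x≈-x (e p * e s))
    plus : - 1# * (- 1# * 1#) * monomial (p ∷ q ∷ []) ≈ e p * e q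
    plus = trans
      (*-cong (trans (*-congˡ (*-identityʳ (- 1#))) (trans (-1*x≈-x (- 1#)) (-‿involutive 1#))) (monomial₂ p q))
      (*-identityˡ (e p * e q))

  Cyclic-first : ∀ {x y z q s} → q ≢ s → q ≡ y ⊎ q ≡ z → s ≡ y ⊎ s ≡ z → Cyclic x q s → Cyclic x y z
  Cyclic-first q≢s (inj₁ ≡.refl) (inj₂ ≡.refl) h = h
  Cyclic-first q≢s (inj₂ ≡.refl) (inj₁ ≡.refl) h = Cyclic-rotate (Cyclic-swap h)
  Cyclic-first q≢s (inj₁ ≡.refl) (inj₁ ≡.refl) h = contradiction ≡.refl q≢s
  Cyclic-first q≢s (inj₂ ≡.refl) (inj₂ ≡.refl) h = contradiction ≡.refl q≢s

  -- `members` lists a triple in increasing order, which may be any permutation of i, j and m, so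
  -- the relation has to be brought back to the given order.
  Cyclic-permute : ∀ {i j m p q s} → p ≢ q → p ≢ s → q ≢ s →
                   p ∈ triple i j m → q ∈ triple i j m → s ∈ triple i j m → Cyclic p q s → Cyclic i j m
  Cyclic-permute {i} {j} {m} {p} {q} {s} p≢q p≢s q≢s p∈ q∈ s∈ h with ∈-triple⁻ p∈
  ... | inj₁ ≡.refl = Cyclic-first q≢s (others q∈ p≢q) (others s∈ p≢s) h
    where
    others : ∀ {x} → x ∈ triple i j m → i ≢ x → x ≡ j ⊎ x ≡ m
    others x∈ i≢x with ∈-triple⁻ x∈
    ... | inj₁ x≡i = contradiction (≡.sym x≡i) i≢x
    ... | inj₂ r   = r
  ... | inj₂ (inj₁ ≡.refl) = Cyclic-rotate (Cyclic-rotate (Cyclic-first q≢s (others q∈ p≢q) (others s∈ p≢s) h))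
    where
    others : ∀ {x} → x ∈ triple i j m → j ≢ x → x ≡ m ⊎ x ≡ i
    others x∈ j≢x with ∈-triple⁻ x∈
    ... | inj₁ x≡i        = inj₂ x≡i
    ... | inj₂ (inj₁ x≡j) = contradiction (≡.sym x≡j) j≢x
    ... | inj₂ (inj₂ x≡m) = inj₁ x≡m
  ... | inj₂ (inj₂ ≡.refl) = Cyclic-rotate (Cyclic-first q≢s (others q∈ p≢q) (others s∈ p≢s) h)
    where
    others : ∀ {x} → x ∈ triple i j m → m ≢ x → x ≡ i ⊎ x ≡ j
    others x∈ m≢x with ∈-triple⁻ x∈
    ... | inj₁ x≡i        = inj₁ x≡i
    ... | inj₂ (inj₁ x≡j) = inj₂ x≡j
    ... | inj₂ (inj₂ x≡m) = contradiction (≡.sym x≡m) m≢x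

  collinear⇒Cyclic : ∀ {i j m} → i ≢ j → i ≢ m → j ≢ m → H i ∩ H j ⊆ H m → Cyclic i j m
  collinear⇒Cyclic {i} {j} {m} i≢j i≢m j≢m Hᵢⱼ⊆Hₘ =
    go (members C) ≡.refl (members-unique C) (≡.trans (length-members C) (∣triple∣≡3 i≢j i≢m j≢m))
    where
    C = triple i j m
    go : ∀ L → members C ≡ L → Unique L → length L ≡ 3 → Cyclic i j m
    go (p ∷ q ∷ s ∷ []) eq ((p≢q ∷ p≢s ∷ _) ∷ (q≢s ∷ _) ∷ _) _ = Cyclic-permute p≢q p≢s q≢s
      (mem (here ≡.refl)) (mem (there (here ≡.refl))) (mem (there (there (here ≡.refl))))
      (∂ᴸ⇒Cyclic p q s (subst (λ L → ∂ᴸ L ≈ 0#) eq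
        (Ideal⇒≈0 (generator (C , triple-Circuit i≢j i≢m j≢m Hᵢⱼ⊆Hₘ , ≡.refl)))))
      where
      mem : ∀ {x} → x List.∈ p ∷ q ∷ s ∷ [] → x ∈ C
      mem {x} x∈ = ∈-members⁻ (subst (x List.∈_) (≡.sym eq) x∈)

  -- When two of i, j and the base point coincide, the relation reduces to a vanishing square and
  -- anticommutativity; otherwise the three form a circuit.
  Cyclic-base : ∀ i j → Cyclic i j (base i j)
  Cyclic-base i j with i Fin.≟ j
  ... | yes ≡.refl = trans (+-congʳ (trans (+-congʳ (e²≈0 i)) (+-identityˡ _))) (e-anticomm i (base i i))
  ... | no i≢j with i Fin.≟ base i j | j Fin.≟ base i j
  ...   | yes eq | _ = subst (Cyclic i j) eq (trans (+-congˡ (e²≈0 i)) (trans (+-identityʳ _) (e-anticomm i j)))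
  ...   | no _ | yes eq = subst (Cyclic i j) eq (trans (+-congʳ (trans (+-congˡ (e²≈0 j)) (+-identityʳ _))) (e-anticomm i j))
  ...   | no i≢m | no j≢m = collinear⇒Cyclic i≢j i≢m j≢m (∈-line⁻ (base-∈ i j))

  e*e-base : ∀ i j → e i * e j ≈ e i * e (base i j) - e j * e (base i j)
  e*e-base i j = begin
    e i * e j                                      ≈⟨ x+y≈0⇒y≈-x (trans (+-comm _ _) (trans (sym (+-assoc _ _ _)) (Cyclic-base i j))) ⟩
    - (e j * e m + e m * e i)                      ≈⟨ sym (-‿+-comm _ _) ⟩
    - (e j * e m) + - (e m * e i)                  ≈⟨ +-congˡ (-‿cong (e-swap i m)) ⟩
    - (e j * e m) + - (- (e i * e m))              ≈⟨ +-congˡ (-‿involutive _) ⟩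
    - (e j * e m) + e i * e m                      ≈⟨ +-comm _ _ ⟩
    e i * e m - e j * e m                          ∎
    where m = base i j

  infixr 7 _•_
  _•_ : k.Carrier → Term → Term
  s • x = scalar s * x

  •-distribˡ : ∀ s x y → s • (x + y) ≈ s • x + s • y
  •-distribˡ s = distribˡ (scalar s)

  •-+ : ∀ s t x → (s k.+ t) • x ≈ s • x + t • x
  •-+ s t x = trans (*-congʳ (Λ⇒A (scalar-+ s t))) (distribʳ x (scalar s) (scalar t))

  •-assoc : ∀ s t x → s • t • x ≈ (s k.* t) • x
  •-assoc s t x = trans (sym (*-assoc _ _ _)) (*-congʳ (sym (Λ⇒A (scalar-* s t))))

  •-*-comm : ∀ s x y → x * (s • y) ≈ s • (x * y)
  •-*-comm s x y = trans (sym (*-assoc _ _ _)) (trans (*-congʳ (sym (Λ⇒A (central s x)))) (*-assoc _ _ _))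

  •-neg : ∀ s x → s • (- x) ≈ (k.- s) • x
  •-neg s x = trans (sym (-‿distribʳ-* (scalar s) x)) (sym (x+y≈0⇒y≈-x (trans (sym (•-+ s (k.- s) x)) (scalar-≈0 x (k.-‿inverseʳ s)))) )

  •-sum : ∀ {m} (s : Vector k.Carrier m) x → ∑[ j < m ] (s j • x) ≈ ∑k.sum s • x
  •-sum {m} s x = trans (sym (*-distribʳ-sum x (λ j → scalar (s j)))) (*-congʳ (sym (scalar-sum s)))

  sum-cong : ∀ {m} {s t : Vector Term m} → (∀ i → s i ≈ t i) → sum s ≈ sum t
  sum-cong {s = s} {t} h = sum-cong-≋ {x = s} {t} h

  module _ (λ′ η : Vector k.Carrier n) where
    open BaseMinors em F 𝒜 k λ′ η

    a*a : a λ′ * a η ≈ ∑[ i < n ] ∑[ j < n ] ((λ′ i k.* η j) • (e i * e j))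
    a*a = begin
      a λ′ * a η                                                 ≈⟨ *-distribʳ-sum (a η) (λ i → λ′ i • e i) ⟩
      ∑[ i < n ] ((λ′ i • e i) * a η)                            ≈⟨ sum-cong (λ i → *-distribˡ-sum (λ′ i • e i) (λ j → η j • e j)) ⟩
      ∑[ i < n ] ∑[ j < n ] ((λ′ i • e i) * (η j • e j))         ≈⟨ sum-cong (λ i → sum-cong (λ j →
                                                                      trans (*-assoc _ _ _) (trans (*-congˡ (•-*-comm (η j) (e i) (e j))) (•-assoc (λ′ i) (η j) (e i * e j))))) ⟩
      ∑[ i < n ] ∑[ j < n ] ((λ′ i k.* η j) • (e i * e j))       ∎

    a*a-base : a λ′ * a η ≈ ∑[ i < n ] ∑[ j < n ] (det i j • (e i * e (base i j)))
    a*a-base = begin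
      a λ′ * a η
        ≈⟨ a*a ⟩
      ∑[ i < n ] ∑[ j < n ] ((λ′ i k.* η j) • (e i * e j))
        ≈⟨ sum-cong (λ i → sum-cong (λ j → trans (*-congˡ (e*e-base i j))
             (trans (•-distribˡ _ _ _) (+-congˡ (•-neg (λ′ i k.* η j) (e j * e (base i j))))))) ⟩
      ∑[ i < n ] ∑[ j < n ] (P i j + Q i j)
        ≈⟨ sum-cong (λ i → ∑-distrib-+ (P i) (Q i)) ⟩
      ∑[ i < n ] (sum (P i) + sum (Q i))
        ≈⟨ ∑-distrib-+ (λ i → sum (P i)) (λ i → sum (Q i)) ⟩
      ∑[ i < n ] sum (P i) + ∑[ i < n ] sum (Q i)
        -- Renaming the indices of the second double sum turns e_j e_b into e_i e_b; as `base` is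
        -- symmetric, its coefficients join the first ones to form `det i j`.
        ≈⟨ +-congˡ (∑-comm Q) ⟩
      ∑[ i < n ] sum (P i) + ∑[ i < n ] ∑[ j < n ] Q j i
        ≈⟨ sym (∑-distrib-+ (λ i → sum (P i)) (λ i → ∑[ j < n ] Q j i)) ⟩
      ∑[ i < n ] (sum (P i) + ∑[ j < n ] Q j i)
        ≈⟨ sum-cong (λ i → sym (∑-distrib-+ (P i) (λ j → Q j i))) ⟩
      ∑[ i < n ] ∑[ j < n ] (P i j + Q j i)
        ≈⟨ sum-cong (λ i → sum-cong (λ j → trans
             (+-congˡ (*-congˡ (*-congˡ (reflexive (≡.cong e (base-comm j i))))))
             (sym (•-+ (λ′ i k.* η j) (k.- (λ′ j k.* η i)) (e i * e (base i j)))))) ⟩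
      ∑[ i < n ] ∑[ j < n ] (det i j • (e i * e (base i j))) ∎
      where
      P Q : Fin n → Fin n → Term
      P i j = (λ′ i k.* η j) • (e i * e (base i j))
      Q i j = (k.- (λ′ i k.* η j)) • (e j * e (base i j))

    -- A Kronecker delta at r = `base i j` is inserted and the summations are exchanged, which
    -- groups the terms by base point.
    fibre : ∀ i → ∑[ j < n ] (det i j • (e i * e (base i j))) ≈
                  ∑[ r < n ] (∑k.sum (λ j → det i j k.* δ r (base i j)) • (e i * e r))
    fibre i = begin
      ∑[ j < n ] (det i j • (e i * e (base i j)))
        ≈⟨ sum-cong (λ j → *-congˡ (sym (scalar-δ (λ r → e i * e r) (base i j)))) ⟩
      ∑[ j < n ] (det i j • ∑[ r < n ] (δ r (base i j) • (e i * e r)))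
        ≈⟨ sum-cong (λ j → *-distribˡ-sum (scalar (det i j)) (λ r → δ r (base i j) • (e i * e r))) ⟩
      ∑[ j < n ] ∑[ r < n ] (det i j • δ r (base i j) • (e i * e r))
        ≈⟨ sum-cong (λ j → sum-cong (λ r → •-assoc (det i j) (δ r (base i j)) (e i * e r))) ⟩
      ∑[ j < n ] ∑[ r < n ] ((det i j k.* δ r (base i j)) • (e i * e r))
        ≈⟨ ∑-comm (λ j r → (det i j k.* δ r (base i j)) • (e i * e r)) ⟩
      ∑[ r < n ] ∑[ j < n ] ((det i j k.* δ r (base i j)) • (e i * e r))
        ≈⟨ sum-cong (λ r → •-sum (λ j → det i j k.* δ r (base i j)) (e i * e r)) ⟩
      ∑[ r < n ] (∑k.sum (λ j → det i j k.* δ r (base i j)) • (e i * e r)) ∎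

    Line⇒Z : Proportional → Z λ′ η
    Line⇒Z proportional = trans a*a-base (sum-≈0 (λ i → ∑[ j < n ] (det i j • (e i * e (base i j)))) (λ i → trans (fibre i)
      (sum-≈0 (λ r → ∑k.sum (λ j → det i j k.* δ r (base i j)) • (e i * e r)) (vanish i))))
      where
      vanish : ∀ i r → ∑k.sum (λ j → det i j k.* δ r (base i j)) • (e i * e r) ≈ 0#
      vanish i r with i Fin.≟ r
      -- Nothing is known about the coefficient when r = i, but there the product itself is zero.
      ... | yes ≡.refl = trans (*-congˡ (e²≈0 i)) (zeroʳ _)
      ... | no i≢r = scalar-≈0 (e i * e r) (fibre-scalar proportional i≢r)

-- Cliques, blocks and neighborliness

1≤∣p∣⇒Nonempty : ∀ {n} {p : Subset n} → 1 ℕ.≤ ∣ p ∣ → Nonempty p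
1≤∣p∣⇒Nonempty {n} {p} 1≤ with nonempty? p
... | yes ne = ne
... | no empty = contradiction (subst (1 ℕ.≤_) (≡.trans (≡.cong ∣_∣ (Empty-unique empty)) (∣⊥∣≡0 n)) 1≤) λ ()

-- At most one point of p can be missing from q, and x already is; a second one would give |q| + 2 ≤
-- |p|.
∣p∣∸1≤∣q∣⇒∈ : ∀ {n} {p q : Subset n} {x y} → q Subset.⊆ p → ∣ p ∣ ℕ.∸ 1 ℕ.≤ ∣ q ∣ →
              x ∈ p → x ∉ q → y ∈ p → y ≢ x → y ∈ q
∣p∣∸1≤∣q∣⇒∈ {p = p} {q} {x} {y} q⊆p nearly x∈p x∉q y∈p y≢x with y ∈? q
... | yes y∈q = y∈q
... | no y∉q = contradiction 2+∣q∣≤∣p∣ (ℕₚ.<⇒≱ (s≤s (ℕₚ.≤-trans (ℕₚ.m≤n+m∸n ∣ p ∣ 1) (s≤s nearly))))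
  where
  ∉⇒≢ : ∀ {z w} → z ∈ q → w ∉ q → z ≢ w
  ∉⇒≢ z∈q w∉q ≡.refl = w∉q z∈q
  q⊆p-x-y : q Subset.⊆ p Subset.- x Subset.- y
  q⊆p-x-y z∈q = x∈p∧x≢y⇒x∈p-y (x∈p∧x≢y⇒x∈p-y (q⊆p z∈q) (∉⇒≢ z∈q x∉q)) (∉⇒≢ z∈q y∉q)
  2+∣q∣≤∣p∣ : 2 ℕ.+ ∣ q ∣ ℕ.≤ ∣ p ∣
  2+∣q∣≤∣p∣ = ℕₚ.≤-trans
    (s≤s (ℕₚ.≤-trans (s≤s (p⊆q⇒∣p∣≤∣q∣ q⊆p-x-y)) (x∈p⇒∣p-x∣<∣p∣ (x∈p∧x≢y⇒x∈p-y y∈p y≢x))))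
    (x∈p⇒∣p-x∣<∣p∣ x∈p)

module Blocks {n} (Γ : Graph n) where
  open Graph Γ

  -- Adding x to S leaves a clique, so maximality forces x into S.
  Block-absorbs : ∀ {S x} → Block S → (∀ {y} → y ∈ S → y ≢ x → Adj y x) → x ∈ S
  Block-absorbs {S} {x} (clique , maximal) adj =
    subst (x ∈_) (maximal (S ∪ ⁅ x ⁆) clique′ (p⊆p∪q ⁅ x ⁆)) (q⊆p∪q S ⁅ x ⁆ (x∈⁅x⁆ x))
    where
    split : ∀ {y} → y ∈ S ∪ ⁅ x ⁆ → y ∈ S ⊎ y ≡ x
    split y∈ with x∈p∪q⁻ S ⁅ x ⁆ y∈
    ... | inj₁ y∈S = inj₁ y∈S
    ... | inj₂ y∈x = inj₂ (x∈⁅y⁆⇒x≡y x y∈x)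
    clique′ : Clique (S ∪ ⁅ x ⁆)
    clique′ i∈ j∈ i≢j with split i∈ | split j∈
    ... | inj₁ i∈S    | inj₁ j∈S    = clique i∈S j∈S i≢j
    ... | inj₁ i∈S    | inj₂ ≡.refl = adj i∈S i≢j
    ... | inj₂ ≡.refl | inj₁ j∈S    = sym (adj j∈S (i≢j ∘ ≡.sym))
    ... | inj₂ ≡.refl | inj₂ ≡.refl = contradiction ≡.refl i≢j

  -- The fuel bounds n - |S|, the number of times that the clique can still grow.
  Clique⇒Block : (∀ {a} → ExcludedMiddle a) → ∀ fuel S → Clique S → n ℕ.≤ ∣ S ∣ ℕ.+ fuel → ∃[ T ] (Block T × S Subset.⊆ T)
  Clique⇒Block em fuel S clique n≤ with em {P = ∃[ T ] (Clique T × S Subset.⊂ T)}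
  ... | no maximal = S , (clique , λ T cliqueT S⊆T → ⊆-antisym (T⊆S T cliqueT S⊆T) S⊆T) , id
    where
    T⊆S : ∀ T → Clique T → S Subset.⊆ T → T Subset.⊆ S
    T⊆S T cliqueT S⊆T {x} x∈T with x ∈? S
    ... | yes x∈S = x∈S
    ... | no x∉S = ⊥-elim (maximal (T , cliqueT , S⊆T , x , x∈T , x∉S))
  ... | yes (T , cliqueT , S⊂T) = continue fuel n≤
    where
    continue : ∀ fuel → n ℕ.≤ ∣ S ∣ ℕ.+ fuel → ∃[ T ] (Block T × S Subset.⊆ T)
    continue ℕ.zero n≤ = contradiction
      (ℕₚ.≤-trans (p⊂q⇒∣p∣<∣q∣ S⊂T) (ℕₚ.≤-trans (∣p∣≤n T) (subst (n ℕ.≤_) (ℕₚ.+-identityʳ ∣ S ∣) n≤)))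
      (ℕₚ.<-irrefl ≡.refl)
    continue (ℕ.suc fuel) n≤ =
      let (B , block , T⊆B) = Clique⇒Block em fuel T cliqueT (ℕₚ.≤-trans (subst (n ℕ.≤_) (ℕₚ.+-suc ∣ S ∣ fuel) n≤)
                                (ℕₚ.+-monoˡ-≤ fuel (p⊂q⇒∣p∣<∣q∣ S⊂T)))
      in B , block , T⊆B ∘ p⊂q⇒p⊆q S⊂T

  ∈-Block : (∀ {a} → ExcludedMiddle a) → ∀ i → ∃[ S ] (Block S × i ∈ S)
  ∈-Block em i =
    let (S , block , ⊆S) = Clique⇒Block em n ⁅ i ⁆ clique (ℕₚ.m≤n+m n _)
    in S , block , ⊆S (x∈⁅x⁆ i)
    where
    clique : Clique ⁅ i ⁆
    clique x∈ y∈ x≢y = contradiction (≡.trans (x∈⁅y⁆⇒x≡y i x∈) (≡.sym (x∈⁅y⁆⇒x≡y i y∈))) x≢y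

  -- `does (¬? d)` computes to `not (does d)`, so `nonCone` is an instance of `⟪_⟫`.
  ∈-nonCone⁺ : ∀ {v} → ¬ Cone v → v ∈ nonCone
  ∈-nonCone⁺ = ∈-⟪⟫⁺ (λ v → ¬? (cone? v))

  ∈-nonCone⁻ : ∀ {v} → v ∈ nonCone → ¬ Cone v
  ∈-nonCone⁻ = ∈-⟪⟫⁻ (λ v → ¬? (cone? v))

-- If a non-cone point x of X is not in S, it is the only point of X ∩ U outside S. Take u in X ∩ U
-- ∩ S: all points of X other than x and u are adjacent to u, so the second hypothesis makes x
-- adjacent to u. Transitivity through u, which is not a cone vertex, makes x adjacent to the rest
-- of S, and the block absorbs x.
neighborly-criterion : ∀ {f ℓf} {F : CommutativeRing f ℓf} {n l} (𝒜 : CentralArrangement F n l) (Γ : Graph n) →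
  let open CentralArrangement 𝒜; open Graph Γ in
  (∀ {i u j} → ¬ Cone u → Adj i u → Adj u j → i ≢ j → Adj i j) →
  (∀ {X i u} → Line X → i ∈ X → u ∈ X → i ≢ u → (∀ {j} → j ∈ X → j ≢ i → j ≢ u → Adj j u) → Adj i u) →
  IsNeighborly 𝒜 Γ
neighborly-criterion 𝒜 Γ Adj-trans Adj-on-Line X line 2≤ S block@(S-clique , _) nearly {x} x∈X
  with x ∈? S | Graph.cone? Γ x
... | yes x∈S | _ = x∈S
... | no _    | yes cone = Blocks.Block-absorbs Γ block λ {y} y∈S y≢x → Graph.sym Γ (cone y y≢x)
... | no x∉S  | no ¬cone = Block-absorbs block adjacent
  where
  open Graph Γ renaming (sym to Adj-sym; nonCone to U)
  open Blocks Γ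
  Q = X Subset.∩ U Subset.∩ S
  Q⊆ : ∀ {y} → y ∈ Q → y ∈ X × y ∈ U × y ∈ S
  Q⊆ y∈ = let (y∈X , y∈US) = x∈p∩q⁻ X (U Subset.∩ S) y∈ in y∈X , x∈p∩q⁻ U S y∈US
  Q-nonempty : Nonempty Q
  -- From |X ∩ U| ≥ 2 the bound on |X ∩ U ∩ S| is at least one.
  Q-nonempty = 1≤∣p∣⇒Nonempty (ℕₚ.≤-trans (ℕₚ.∸-monoˡ-≤ 1 2≤) nearly)
  u = proj₁ Q-nonempty
  u∈X = proj₁ (Q⊆ (proj₂ Q-nonempty))
  ¬cone-u = ∈-nonCone⁻ (proj₁ (proj₂ (Q⊆ (proj₂ Q-nonempty))))
  u∈S = proj₂ (proj₂ (Q⊆ (proj₂ Q-nonempty)))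
  x≢u : x ≢ u
  x≢u x≡u = x∉S (subst (_∈ S) (≡.sym x≡u) u∈S)
  others : ∀ {y} → y ∈ X → y ≢ x → y ≢ u → Adj y u
  others {y} y∈X y≢x y≢u with cone? y
  -- A cone point of X may lie outside U, but its adjacency to u is free.
  ... | yes cone-y = cone-y u (y≢u ∘ ≡.sym)
  ... | no ¬cone-y = S-clique (proj₂ (proj₂ (Q⊆ y∈Q))) u∈S y≢u
    where
    y∈Q : y ∈ Q
    y∈Q = ∣p∣∸1≤∣q∣⇒∈ (λ q∈ → let (q∈X , q∈U , _) = Q⊆ q∈ in x∈p∩q⁺ (q∈X , q∈U)) nearly
      (x∈p∩q⁺ (x∈X , ∈-nonCone⁺ ¬cone)) (x∉S ∘ proj₂ ∘ proj₂ ∘ Q⊆) (x∈p∩q⁺ (y∈X , ∈-nonCone⁺ ¬cone-y)) y≢x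
  u~x : Adj u x
  u~x = Adj-sym (Adj-on-Line line x∈X u∈X x≢u others)
  adjacent : ∀ {y} → y ∈ S → y ≢ x → Adj y x
  adjacent {y} y∈S y≢x with y Fin.≟ u
  ... | yes ≡.refl = u~x
  ... | no y≢u = Adj-trans ¬cone-u (S-clique y∈S u∈S y≢u) u~x y≢x

-- Comparison of Z(λ) with Z_Γ(λ)

module Resonances (em : ∀ {a} → ExcludedMiddle a) {f ℓf} (F : Field f ℓf) {n l}
  (𝒜 : CentralArrangement (Field.commutativeRing F) n l) {c ℓ} (k : Field c ℓ) where
  open Field k hiding (zero)
  open Linear commutativeRing
  open SemiringSum semiring using (sum; sum-cong-≋; *-distribˡ-sum; *-distribʳ-sum; ∑-distrib-+)
  open RingProperties ring using (x∙y⁻¹≈ε⇒x≈y)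
  open RingSolver commutativeRing
  open LinearAlgebra em k
  open CentralArrangement 𝒜
  open Matroid em F 𝒜 using (⊈⇒∃)
  open Detect em F 𝒜 k using (indicator; indicator-∈; indicator-∉; *-indicator; Z⇒Line)
  open Relations em F 𝒜 k using (Line⇒Z)
  open OrlikSolomon k 𝒜 using (Z)
  open import Relation.Binary.Reasoning.Setoid setoid

  sum-indicator : ∀ ξ X → sumOver ξ X ≈ sum (λ j → ξ j * indicator X j)
  sum-indicator ξ X = sum-cong-≋ (λ j → sym (*-indicator X ξ j))

  -- K puts no condition on lines with two points; neighborliness makes them cliques.
  two-point-Clique : ∀ {Γ X} → IsNeighborly 𝒜 Γ → Line X → ¬ 3 ℕ.≤ ∣ X ∣ → Graph.Clique Γ X
  two-point-Clique {Γ} {X} neighborly line@(i , j , i≢j , X⇔) ∣X∣<3 = clique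
    where
    open Graph Γ renaming (sym to Adj-sym; nonCone to U)
    open Blocks Γ
    i∈X : i ∈ X
    i∈X = Equivalence.from (X⇔ i) proj₁
    j∈X : j ∈ X
    j∈X = Equivalence.from (X⇔ j) proj₂
    adjacent : Adj i j
    adjacent with adj? i j
    ... | yes a = a
    ... | no ¬a with ∈-Block em i
    ...   | S , block@(S-clique , _) , i∈S = S-clique i∈S (X⊆S j∈X) i≢j
      where
      i∈U : i ∈ U
      i∈U = ∈-nonCone⁺ λ cone → ¬a (cone j (i≢j ∘ ≡.sym))
      j∈U : j ∈ U
      j∈U = ∈-nonCone⁺ λ cone → ¬a (Adj-sym (cone i i≢j))
      i∈X∩U : i ∈ X Subset.∩ U
      i∈X∩U = x∈p∩q⁺ (i∈X , i∈U)
      X⊆S : X Subset.⊆ S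
      X⊆S = neighborly X line
        (distinct⇒2≤∣p∣ i≢j i∈X∩U (x∈p∩q⁺ (j∈X , j∈U)))
        S block
        -- |X ∩ U| is at most two, so the single point i of X ∩ U ∩ S meets the bound.
        (ℕₚ.≤-trans (ℕₚ.∸-monoˡ-≤ 1 (ℕₚ.≤-trans (∣p∩q∣≤∣p∣ X U) (ℕ.s≤s⁻¹ (ℕₚ.≰⇒> ∣X∣<3))))
          (∈⇒1≤∣p∣ (x∈p∩q⁺ {p = X} (i∈X , x∈p∩q⁺ (i∈U , i∈S)))))
    member : ∀ {m} → m ∈ X → m ≡ i ⊎ m ≡ j
    member {m} m∈X with m Fin.≟ i | m Fin.≟ j
    ... | yes m≡i | _ = inj₁ m≡i
    ... | no _ | yes m≡j = inj₂ m≡j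
    ... | no m≢i | no m≢j = contradiction (distinct⇒3≤∣p∣ m≢i m≢j i≢j m∈X i∈X j∈X) ∣X∣<3
    clique : Clique X
    clique a∈ b∈ a≢b with member a∈ | member b∈
    ... | inj₁ ≡.refl | inj₁ ≡.refl = contradiction ≡.refl a≢b
    ... | inj₁ ≡.refl | inj₂ ≡.refl = adjacent
    ... | inj₂ ≡.refl | inj₁ ≡.refl = Adj-sym adjacent
    ... | inj₂ ≡.refl | inj₂ ≡.refl = contradiction ≡.refl a≢b

  -- On a clique the minors λ_i η_j - λ_j η_i vanish and are summed over j in X. On a nontrivial
  -- line that is not a clique both λ_X and η_X are zero.
  ZΓ⊆Z : ∀ {Γ λ′ η} → IsNeighborly 𝒜 Γ → K 𝒜 k Γ λ′ → ZΓ 𝒜 k Γ λ′ η → Z λ′ η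
  ZΓ⊆Z {Γ} {λ′} {η} neighborly λ∈K (η∈K , parallel) = Line⇒Z λ′ η proportional
    where
    open Graph Γ using (Adj; Clique)
    proportional : ∀ {X i} → Line X → i ∈ X → λ′ i * sumOver η X ≈ sumOver λ′ X * η i
    proportional {X} {i} line i∈X with em {P = Clique X} | 3 ℕₚ.≤? ∣ X ∣
    ... | yes clique | _ = begin
      λ′ i * sumOver η X                          ≈⟨ *-congˡ (sum-indicator η X) ⟩
      λ′ i * sum (λ j → η j * indicator X j)      ≈⟨ *-distribˡ-sum (λ′ i) (λ j → η j * indicator X j) ⟩
      sum (λ j → λ′ i * (η j * indicator X j))    ≈⟨ sum-cong-≋ swap ⟩
      sum (λ j → λ′ j * indicator X j * η i)      ≈⟨ sym (*-distribʳ-sum (η i) (λ j → λ′ j * indicator X j)) ⟩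
      sum (λ j → λ′ j * indicator X j) * η i      ≈⟨ *-congʳ (sym (sum-indicator λ′ X)) ⟩
      sumOver λ′ X * η i                          ∎
      where
      minor≈0 : ∀ {j} → j ∈ X → λ′ i * η j ≈ λ′ j * η i
      minor≈0 {j} j∈X with i Fin.≟ j
      ... | yes ≡.refl = refl
      ... | no i≢j = x∙y⁻¹≈ε⇒x≈y _ _ (parallel i j (clique i∈X j∈X i≢j))
      swap : ∀ j → λ′ i * (η j * indicator X j) ≈ λ′ j * indicator X j * η i
      swap j with j ∈? X
      ... | yes j∈X = begin
        λ′ i * (η j * indicator X j)    ≈⟨ sym (*-assoc _ _ _) ⟩
        λ′ i * η j * indicator X j      ≈⟨ *-congʳ (minor≈0 j∈X) ⟩
        λ′ j * η i * indicator X j      ≈⟨ solve 3 (λ x y z → x :* y :* z := x :* z :* y) refl (λ′ j) (η i) (indicator X j) ⟩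
        λ′ j * indicator X j * η i      ∎
      ... | no j∉X = begin
        λ′ i * (η j * indicator X j)    ≈⟨ *-congˡ (*-congˡ (indicator-∉ j∉X)) ⟩
        λ′ i * (η j * 0#)               ≈⟨ solve 4 (λ x y z w → x :* (y :* con (0 , 0)) := z :* con (0 , 0) :* w) refl (λ′ i) (η j) (λ′ j) (η i) ⟩
        λ′ j * 0# * η i                 ≈⟨ *-congʳ (*-congˡ (sym (indicator-∉ j∉X))) ⟩
        λ′ j * indicator X j * η i      ∎
    ... | no ¬clique | yes 3≤ = begin
      λ′ i * sumOver η X              ≈⟨ *-congˡ (η∈K X (line , 3≤) ¬clique) ⟩
      λ′ i * 0#                       ≈⟨ solve 2 (λ x y → x :* con (0 , 0) := con (0 , 0) :* y) refl (λ′ i) (η i) ⟩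
      0# * η i                        ≈⟨ *-congʳ (sym (λ∈K X (line , 3≤) ¬clique)) ⟩
      sumOver λ′ X * η i              ∎
    ... | no ¬clique | no ¬3≤ = ⊥-elim (¬clique (two-point-Clique {Γ} neighborly line ¬3≤))

  module _ (λ′ : Vector Carrier n) where

    Parallel : Fin n → Fin n → Set _
    Parallel i j = ∀ η → Z λ′ η → λ′ i * η j - λ′ j * η i ≈ 0#

    Parallel-refl : ∀ i → Parallel i i
    Parallel-refl i η _ = -‿inverseʳ (λ′ i * η i)

    Parallel-sym : ∀ {i j} → Parallel i j → Parallel j i
    Parallel-sym {i} {j} p η η∈Z = begin
      λ′ j * η i - λ′ i * η j        ≈⟨ solve 4 (λ a b c d → a :* b :- c :* d := :- (c :* d :- a :* b)) refl (λ′ j) (η i) (λ′ i) (η j) ⟩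
      - (λ′ i * η j - λ′ j * η i)    ≈⟨ -‿cong (p η η∈Z) ⟩
      - 0#                           ≈⟨ solve 0 (:- con (0 , 0) := con (0 , 0)) refl ⟩
      0#                             ∎

    -- `Parallel` lives in a universe that depends on both fields, while `Adj` has to be in `Set`.
    -- Taking `True` of a decision lowers the level and makes adjacency decidable.
    Γ : Graph n
    Γ = record
      { Adj = λ i j → True (adjacent? i j)
      ; sym = λ a → let (i≢j , p) = toWitness a in fromWitness (i≢j ∘ ≡.sym , Parallel-sym p)
      ; irrefl = λ i≡j a → proj₁ (toWitness a) i≡j
      ; adj? = λ i j → T? _
      }
      where
      adjacent? : ∀ i j → Dec (i ≢ j × Parallel i j)
      adjacent? i j = em

    open Graph Γ renaming (sym to Adj-sym; nonCone to U)
    open Blocks Γ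

    Adj⁺ : ∀ {i j} → i ≢ j → Parallel i j → Adj i j
    Adj⁺ i≢j p = fromWitness (i≢j , p)

    Adj⁻ : ∀ {i j} → Adj i j → Parallel i j
    Adj⁻ a = proj₂ (toWitness a)

    λ∈Z : Z λ′ λ′
    λ∈Z = Line⇒Z λ′ λ′ λ {X} {i} _ _ → *-comm (λ′ i) (sumOver λ′ X)

    -- Let ζ in Z(λ) have nonzero minor at i and j. Computing λ_i λ_j ζ_X in two ways shows that
    -- this minor times λ_X is zero, so λ_X = 0. Then λ_i η_X and λ_j η_X vanish, so the minor kills
    -- η_X as well.
    ¬Parallel⇒sum≈0 : ∀ {X i j} → Line X → i ∈ X → j ∈ X → ¬ Parallel i j → ∀ η → Z λ′ η → sumOver η X ≈ 0#
    ¬Parallel⇒sum≈0 {X} {i} {j} line i∈X j∈X ¬p η η∈Z with ⊈⇒∃ {P = Z λ′} {Q = λ ζ → λ′ i * ζ j - λ′ j * ζ i ≈ 0#} (λ h → ¬p λ ζ → h {ζ})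
    ... | ζ , ζ∈Z , minor≉0 = *-cancelˡ-≈0 minor≉0 (begin
      (λ′ i * ζ j - λ′ j * ζ i) * sumOver η X
        ≈⟨ solve 5 (λ a b c d s → (a :* b :- c :* d) :* s := b :* (a :* s) :- d :* (c :* s)) refl (λ′ i) (ζ j) (λ′ j) (ζ i) (sumOver η X) ⟩
      ζ j * (λ′ i * sumOver η X) - ζ i * (λ′ j * sumOver η X)
        ≈⟨ +-cong (*-congˡ (vanish i∈X)) (-‿cong (*-congˡ (vanish j∈X))) ⟩
      ζ j * 0# - ζ i * 0#
        ≈⟨ solve 2 (λ x y → x :* con (0 , 0) :- y :* con (0 , 0) := con (0 , 0)) refl (ζ j) (ζ i) ⟩
      0# ∎)
      where
      λX≈0 : sumOver λ′ X ≈ 0#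
      λX≈0 = *-cancelˡ-≈0 minor≉0 (begin
        (λ′ i * ζ j - λ′ j * ζ i) * sumOver λ′ X
          ≈⟨ solve 5 (λ a b c d s → (a :* b :- c :* d) :* s := a :* (s :* b) :- c :* (s :* d)) refl (λ′ i) (ζ j) (λ′ j) (ζ i) (sumOver λ′ X) ⟩
        λ′ i * (sumOver λ′ X * ζ j) - λ′ j * (sumOver λ′ X * ζ i)
          ≈⟨ sym (+-cong (*-congˡ (Z⇒Line ζ∈Z line j∈X)) (-‿cong (*-congˡ (Z⇒Line ζ∈Z line i∈X)))) ⟩
        λ′ i * (λ′ j * sumOver ζ X) - λ′ j * (λ′ i * sumOver ζ X)
          ≈⟨ solve 3 (λ a b s → a :* (b :* s) :- b :* (a :* s) := con (0 , 0)) refl (λ′ i) (λ′ j) (sumOver ζ X) ⟩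
        0# ∎)
      vanish : ∀ {m} → m ∈ X → λ′ m * sumOver η X ≈ 0#
      vanish {m} m∈X = trans (Z⇒Line η∈Z line m∈X) (trans (*-congʳ λX≈0) (zeroˡ (η m)))

    Z⊆K : ∀ {η} → Z λ′ η → K 𝒜 k Γ η
    Z⊆K {η} η∈Z X (line , _) ¬clique with em {P = ∃[ i ] ∃[ j ] (i ∈ X × j ∈ X × i ≢ j × ¬ Parallel i j)}
    ... | yes (i , j , i∈X , j∈X , _ , ¬p) = ¬Parallel⇒sum≈0 line i∈X j∈X ¬p η η∈Z
    ... | no none = ⊥-elim (¬clique λ {i} {j} i∈X j∈X i≢j → adjacent i j i∈X j∈X i≢j)
      where
      adjacent : ∀ i j → i ∈ X → j ∈ X → i ≢ j → Adj i j
      adjacent i j i∈X j∈X i≢j with em {P = Parallel i j}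
      ... | yes p = Adj⁺ i≢j p
      ... | no ¬p = contradiction (i , j , i∈X , j∈X , i≢j , ¬p) none

    Z⊆ZΓ : ∀ {η} → Z λ′ η → ZΓ 𝒜 k Γ λ′ η
    Z⊆ZΓ {η} η∈Z = Z⊆K η∈Z , λ i j a → Adj⁻ a η η∈Z

    -- If λ_u ≠ 0, a three-term identity between minors can be divided by λ_u. If λ_u = 0, some ζ in
    -- Z(λ) has ζ_u ≠ 0, since otherwise u would be a cone vertex; parallelism with u at ζ then
    -- gives λ_i = λ_j = 0.
    Parallel-trans : ∀ {i u j} → ¬ Cone u → Parallel i u → Parallel u j → Parallel i j
    Parallel-trans {i} {u} {j} ¬cone iu uj η η∈Z with decidable-≈ (λ′ u) 0#
    ... | no λᵤ≉0 = *-cancelˡ-≈0 λᵤ≉0 (begin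
      λ′ u * (λ′ i * η j - λ′ j * η i)
        ≈⟨ solve 6 (λ λᵢ λᵤ λⱼ ηᵢ ηᵤ ηⱼ → λᵤ :* (λᵢ :* ηⱼ :- λⱼ :* ηᵢ) := λᵢ :* (λᵤ :* ηⱼ :- λⱼ :* ηᵤ) :+ λⱼ :* (λᵢ :* ηᵤ :- λᵤ :* ηᵢ))
             refl (λ′ i) (λ′ u) (λ′ j) (η i) (η u) (η j) ⟩
      λ′ i * (λ′ u * η j - λ′ j * η u) + λ′ j * (λ′ i * η u - λ′ u * η i)
        ≈⟨ +-cong (*-congˡ (uj η η∈Z)) (*-congˡ (iu η η∈Z)) ⟩
      λ′ i * 0# + λ′ j * 0#
        ≈⟨ solve 2 (λ x y → x :* con (0 , 0) :+ y :* con (0 , 0) := con (0 , 0)) refl (λ′ i) (λ′ j) ⟩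
      0# ∎)
    ... | yes λᵤ≈0 = trans (+-cong (*-congʳ (zero-λ iu)) (-‿cong (*-congʳ (zero-λ (Parallel-sym uj)))))
                       (solve 2 (λ x y → con (0 , 0) :* x :- con (0 , 0) :* y := con (0 , 0)) refl (η j) (η i))
      where
      parallel-all : (∀ ζ → Z λ′ ζ → ζ u ≈ 0#) → ∀ w → Parallel u w
      parallel-all ζᵤ≈0 w ζ ζ∈Z = trans (+-cong (*-congʳ λᵤ≈0) (-‿cong (*-congˡ (ζᵤ≈0 ζ ζ∈Z))))
        (solve 2 (λ x y → con (0 , 0) :* x :- y :* con (0 , 0) := con (0 , 0)) refl (ζ w) (λ′ w))
      nonzero = ⊈⇒∃ {P = Z λ′} {Q = λ ζ → ζ u ≈ 0#}
        (λ h → ¬cone λ w w≢u → Adj⁺ (w≢u ∘ ≡.sym) (parallel-all (λ ζ → h {ζ}) w))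
      ζ = proj₁ nonzero
      zero-λ : ∀ {m} → Parallel m u → λ′ m ≈ 0#
      zero-λ {m} mu = *-cancelˡ-≈0 (proj₂ (proj₂ nonzero)) (begin
        ζ u * λ′ m                          ≈⟨ solve 3 (λ a b c → b :* a := a :* b :- con (0 , 0) :* c) refl (λ′ m) (ζ u) (ζ m) ⟩
        λ′ m * ζ u - 0# * ζ m               ≈⟨ +-congˡ (-‿cong (*-congʳ (sym λᵤ≈0))) ⟩
        λ′ m * ζ u - λ′ u * ζ m             ≈⟨ mu ζ (proj₁ (proj₂ nonzero)) ⟩
        0#                                  ∎)

    -- If i and u were not parallel, λ_X = η_X = 0 for all η in Z(λ), so the minors
    -- (j, u) add up to 0 over j in X, and the minor (i, u) is the only one left.
    Parallel-on-Line : ∀ {X i u} → Line X → i ∈ X → u ∈ X → (∀ {j} → j ∈ X → j ≢ i → Parallel j u) → Parallel i u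
    Parallel-on-Line {X} {i} {u} line i∈X u∈X others with em {P = Parallel i u}
    ... | yes p = p
    ... | no ¬p = λ η η∈Z → begin
      minor η i
        ≈⟨ sym (sum-δ (minor η) i) ⟩
      sum (λ j → minor η j * δ j i)
        ≈⟨ sum-cong-≋ (isolate η η∈Z) ⟩
      sum (λ j → minor η j * indicator X j)
        ≈⟨ sum-cong-≋ (λ j → solve 5 (λ λⱼ ηᵤ λᵤ ηⱼ g → (λⱼ :* ηᵤ :- λᵤ :* ηⱼ) :* g := ηᵤ :* (λⱼ :* g) :+ (:- λᵤ) :* (ηⱼ :* g))
             refl (λ′ j) (η u) (λ′ u) (η j) (indicator X j)) ⟩
      sum (λ j → η u * (λ′ j * indicator X j) + - λ′ u * (η j * indicator X j))
        ≈⟨ ∑-distrib-+ (λ j → η u * (λ′ j * indicator X j)) (λ j → - λ′ u * (η j * indicator X j)) ⟩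
      sum (λ j → η u * (λ′ j * indicator X j)) + sum (λ j → - λ′ u * (η j * indicator X j))
        ≈⟨ sym (+-cong (*-distribˡ-sum (η u) (λ j → λ′ j * indicator X j)) (*-distribˡ-sum (- λ′ u) (λ j → η j * indicator X j))) ⟩
      η u * sum (λ j → λ′ j * indicator X j) + - λ′ u * sum (λ j → η j * indicator X j)
        ≈⟨ sym (+-cong (*-congˡ (sum-indicator λ′ X)) (*-congˡ (sum-indicator η X))) ⟩
      η u * sumOver λ′ X + - λ′ u * sumOver η X
        ≈⟨ +-cong (*-congˡ (sum≈0 λ′ λ∈Z)) (*-congˡ (sum≈0 η η∈Z)) ⟩
      η u * 0# + - λ′ u * 0#
        ≈⟨ solve 2 (λ x y → x :* con (0 , 0) :+ (:- y) :* con (0 , 0) := con (0 , 0)) refl (η u) (λ′ u) ⟩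
      0# ∎
      where
      minor : Vector Carrier n → Fin n → Carrier
      minor η j = λ′ j * η u - λ′ u * η j
      sum≈0 = ¬Parallel⇒sum≈0 line i∈X u∈X ¬p
      isolate : ∀ η → Z λ′ η → ∀ j → minor η j * δ j i ≈ minor η j * indicator X j
      isolate η η∈Z j with j Fin.≟ i | j ∈? X
      ... | yes ≡.refl | yes j∈X = *-congˡ (sym (indicator-∈ j∈X))
      ... | yes ≡.refl | no j∉X  = contradiction i∈X j∉X
      ... | no j≢i | no j∉X  = *-congˡ (sym (indicator-∉ j∉X))
      ... | no j≢i | yes j∈X = trans (zeroʳ _) (sym (trans (*-congʳ (others j∈X j≢i η η∈Z)) (zeroˡ _)))

    Γ-neighborly : IsNeighborly 𝒜 Γ
    Γ-neighborly = neighborly-criterion 𝒜 Γ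
      (λ ¬cone i~u u~j i≢j → Adj⁺ i≢j (Parallel-trans ¬cone (Adj⁻ i~u) (Adj⁻ u~j)))
      (λ {X} {i} {u} line i∈X u∈X i≢u others → Adj⁺ i≢u (Parallel-on-Line line i∈X u∈X λ {j} j∈X j≢i → parallel others j∈X j≢i))
      where
      -- Adjacency is irreflexive, so the case j = u is supplied separately.
      parallel : ∀ {X i u} → (∀ {j} → j ∈ X → j ≢ i → j ≢ u → Adj j u) → ∀ {j} → j ∈ X → j ≢ i → Parallel j u
      parallel {u = u} others {j} j∈X j≢i with j Fin.≟ u
      ... | yes ≡.refl = Parallel-refl j
      ... | no j≢u = Adj⁻ (others j∈X j≢i j≢u)

  Resonance≐⋃V : Resonance k 𝒜 ≐ ⋃ (𝒩 𝒜 k) (V 𝒜 k)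
  Resonance≐⋃V =
      -- The inclusion of Z(λ) in K(Γ) serves twice: it bounds dim K(Γ) from below, and through
      -- `λ∈Z` it places λ itself in K(Γ).
      (λ {λ′} dim → (Γ λ′ , Γ-neighborly λ′ , Dim≥-mono (Z⊆K λ′) dim) , Z⊆K λ′ (λ∈Z λ′) , Dim≥-mono (Z⊆ZΓ λ′) dim)
    , λ { ((Γ , neighborly , _) , λ∈K , dim) → Dim≥-mono (ZΓ⊆Z {Γ} neighborly λ∈K) dim }

corollary2p14 : (∀ {a} → ExcludedMiddle a) →
    ∀ {c ℓ} (k : Field c ℓ) {n l} (𝒜 : CentralArrangement ℂ n l) →
    Resonance k 𝒜 ≐ ⋃ (𝒩 𝒜 k) (V 𝒜 k)
corollary2p14 em k 𝒜 = Resonances.Resonance≐⋃V em (ComplexField.ℂ-field em) 𝒜 k
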